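{- Let $M$ be a planar map with $\dim(\mathbf{P}_{VEF}(M)) \le 3$. Then both $M$ and its dual map $M^*$ are weakly outerplanar.
   Context: A planar map $M=(G,D)$ consists of a finite planar multigraph $G$ together with a plane drawing $D$ of $G$; it determines vertices, edges, faces and their incidences. The vertex-edge-face poset $\mathbf{P}_{VEF}(M)$ is the poset on vertices, edges and faces ordered by incidence/inclusion (vertex below its incident edges and the faces on whose boundary it lies; edge below the faces on whose boundary it lies). The dimension of a finite poset is the minimum number of linear orders on its ground set whose intersection is the poset's order. The dual map $M^*$ has a vertex $F^*$ for each face $F$ of $M$ and an edge $e^*$ for each edge $e$ of $M$ joining the dual vertices of the faces separated by $e$ (a loop if $e$ is a bridge). A planar map $M=(G,D)$ is weakly outerplanar if the graph $G$ is outerplanar. -}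

module Defs where

open import Data.Nat using (ℕ; zero; suc; _+_; _≤_; _<_)
open import Data.Fin using (Fin; _↑ˡ_; splitAt)
open import Data.Bool using (Bool; true; false; not)
open import Data.Product using (Σ; Σ-syntax; ∃; ∃-syntax; _×_; _,_; proj₁; proj₂)
open import Data.Sum using (_⊎_; inj₁; inj₂; [_,_]′)
open import Function.Bundles using (_⇔_)
open import Function.Definitions using (Injective)
open import Relation.Binary.PropositionalEquality using (_≡_)

iter : {A : Set} → (A → A) → ℕ → A → A
iter f zero    x = x
iter f (suc j) x = f (iter f j x)

record Graph : Set where
  field
    nV   : ℕ
    nE   : ℕ
    ends : Fin nE → Fin nV × Fin nV

open Graph public

end : (G : Graph) → Fin (nE G) → Bool → Fin (nV G)
end G e true  = proj₁ (ends G e)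
end G e false = proj₂ (ends G e)

-- Auxiliary connected graph H = G + nI "invisible" edges (used to encode
-- plane drawings of possibly disconnected graphs).

EdgeH : (G : Graph) (nI : ℕ) → Set
EdgeH G nI = Fin (nE G + nI)

endsH : (G : Graph) (nI : ℕ) → (Fin nI → Fin (nV G) × Fin (nV G)) →
        EdgeH G nI → Fin (nV G) × Fin (nV G)
endsH G nI endsI e = [ ends G , endsI ]′ (splitAt (nE G) e)

Dart : (G : Graph) (nI : ℕ) → Set
Dart G nI = EdgeH G nI × Bool

dv : (G : Graph) (nI : ℕ) (endsI : Fin nI → Fin (nV G) × Fin (nV G)) →
     Dart G nI → Fin (nV G)
dv G nI endsI (e , true)  = proj₁ (endsH G nI endsI e)
dv G nI endsI (e , false) = proj₂ (endsH G nI endsI e)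

flipD : (G : Graph) (nI : ℕ) → Dart G nI → Dart G nI
flipD G nI (e , b) = (e , not b)

data Reach (G : Graph) (nI : ℕ) (endsI : Fin nI → Fin (nV G) × Fin (nV G))
     : Fin (nV G) → Fin (nV G) → Set where
  here : ∀ {u} → Reach G nI endsI u u
  step : ∀ (d : Dart G nI) {w} →
         Reach G nI endsI (dv G nI endsI (flipD G nI d)) w →
         Reach G nI endsI (dv G nI endsI d) w

realDart : (G : Graph) (nI : ℕ) → Fin (nE G) → Bool → Dart G nI
realDart G nI e b = (e ↑ˡ nI , b)

invDart : (G : Graph) (nI : ℕ) → Fin nI → Bool → Dart G nI
invDart G nI i b = (Data.Fin._↑ʳ_ (nE G) i , b)

-- Faces of the drawing of G: equivalence closure of "same face-walk of H"
-- (d ~ σ(α d)) and "opposite sides of an invisible edge".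
data SameFace (G : Graph) (nI : ℕ) (σ : Dart G nI → Dart G nI)
     : Dart G nI → Dart G nI → Set where
  sf-walk  : ∀ d → SameFace G nI σ d (σ (flipD G nI d))
  sf-inv   : ∀ i → SameFace G nI σ (invDart G nI i true) (invDart G nI i false)
  sf-refl  : ∀ {d} → SameFace G nI σ d d
  sf-sym   : ∀ {d d'} → SameFace G nI σ d d' → SameFace G nI σ d' d
  sf-trans : ∀ {d d' d''} → SameFace G nI σ d d' → SameFace G nI σ d' d'' →
             SameFace G nI σ d d''

-- A plane drawing (up to homeomorphism of the sphere) of the graph G,
-- encoded combinatorially: G is completed by invisible edges to a
-- connected multigraph H, and H carries a rotation system σ of genus 0
-- (Euler's formula V - E + F = 2, F = number of σ∘α-orbits).
-- The faces of G's drawing are the classes of SameFace, labelled by Fin nF.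

record Embedding (G : Graph) : Set where
  field
    nI      : ℕ
    endsI   : Fin nI → Fin (nV G) × Fin (nV G)
    σ       : Dart G nI → Dart G nI
    σ⁻      : Dart G nI → Dart G nI
    σ⁻σ     : ∀ d → σ⁻ (σ d) ≡ d
    σσ⁻     : ∀ d → σ (σ⁻ d) ≡ d
    σ-vert  : ∀ d → dv G nI endsI (σ d) ≡ dv G nI endsI d
    σ-cyc   : ∀ d d' → dv G nI endsI d ≡ dv G nI endsI d' →
              ∃[ j ] iter σ j d ≡ d'
    connH   : ∀ u v → Reach G nI endsI u v
    kH      : ℕ
    fH      : Dart G nI → Fin kH
    fH-orb  : ∀ d d' → (fH d ≡ fH d') ⇔ (∃[ j ] iter (λ x → σ (flipD G nI x)) j d ≡ d')
    fH-surj : ∀ (i : Fin kH) → ∃[ d ] fH d ≡ i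
    -- genus 0 (the edgeless case is the single-vertex sphere map)
    euler   : (nE G + nI ≡ 0 × nV G ≡ 1) ⊎ (nV G + kH ≡ (nE G + nI) + 2)
    nF      : ℕ
    face    : Dart G nI → Fin nF
    face-cl : ∀ d d' → (face d ≡ face d') ⇔ SameFace G nI σ d d'
    face-n  : (nE G + nI ≡ 0 × nF ≡ 1) ⊎ (0 < nE G + nI × (∀ (F : Fin nF) → ∃[ d ] face d ≡ F))

open Embedding public

VFInc : {G : Graph} (D : Embedding G) → Fin (nV G) → Fin (nF D) → Set
VFInc {G} D v F =
  (∃[ d ] (dv G (nI D) (endsI D) d ≡ v × face D d ≡ F)) ⊎ (nE G + nI D ≡ 0)

record PlanarMap : Set where
  constructor mkMap
  field
    graph   : Graph
    drawing : Embedding graph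

open PlanarMap public

Elem : PlanarMap → Set
Elem M = Fin (nV (graph M)) ⊎ (Fin (nE (graph M)) ⊎ Fin (nF (drawing M)))

data _≤VEF_ {M : PlanarMap} : Elem M → Elem M → Set where
  le-refl : ∀ {x} → x ≤VEF x
  le-ve   : ∀ (v : Fin (nV (graph M))) (e : Fin (nE (graph M))) (b : Bool) →
            end (graph M) e b ≡ v → inj₁ v ≤VEF inj₂ (inj₁ e)
  le-vf   : ∀ v F → VFInc (drawing M) v F → inj₁ v ≤VEF inj₂ (inj₂ F)
  le-ef   : ∀ (e : Fin (nE (graph M))) (F : Fin (nF (drawing M))) (b : Bool) →
            face (drawing M) (realDart (graph M) (nI (drawing M)) e b) ≡ F →
            inj₂ (inj₁ e) ≤VEF inj₂ (inj₂ F)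

-- A realizer of size t: t linear orders (given by injective rank
-- functions into ℕ) whose intersection is exactly ≤VEF.
Realizer : (M : PlanarMap) → ℕ → Set
Realizer M t =
  Σ[ r ∈ (Fin t → Elem M → ℕ) ]
    ((∀ i → Injective _≡_ _≡_ (r i)) ×
     (∀ (x y : Elem M) → (_≤VEF_ {M} x y) ⇔ (∀ i → r i x ≤ r i y)))

DimVEF≤ : PlanarMap → ℕ → Set
DimVEF≤ M d = ∃[ t ] (t ≤ d × Realizer M t)

-- outerplanar graph: some plane drawing has a face containing all vertices
-- on its boundary (that face may be taken as the outer face)
Outerplanar : Graph → Set
Outerplanar G = Σ[ D ∈ Embedding G ] Σ[ F ∈ Fin (nF D) ] (∀ v → VFInc D v F)

WeaklyOuterplanar : PlanarMap → Set
WeaklyOuterplanar M = Outerplanar (graph M)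

-- graph of the dual map M*: one vertex per face, edge e* joins the faces on
-- the two sides of e (a loop if they coincide, e.g. for a bridge)
dualGraph : PlanarMap → Graph
dualGraph M = record
  { nV   = nF (drawing M)
  ; nE   = nE (graph M)
  ; ends = λ e → ( face (drawing M) (realDart (graph M) (nI (drawing M)) e true)
                 , face (drawing M) (realDart (graph M) (nI (drawing M)) e false) )
  }

{-# OPTIONS --safe #-}
module Submission where

-- Take the third linear order as a height and draw each edge as an arch over its two ends.  When a leg
-- of an arch passes the height of a vertex w off the arch, exactly one of the first two orders places
-- the arch below w, so the leg passes w on a definite side: a realizer of the vertex-edge poset is a
-- plane drawing.  Counting modulo 2 the legs passing w on one fixed side gives a winding number around
-- w for closed walks avoiding w.  It vanishes on the boundary of every face not containing w, and on
-- the sphere every closed walk avoiding w is a sum modulo 2 of such boundaries; hence no cycle winds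
-- around any vertex, i.e. all vertices lie on the outer face of the drawing.
--
-- Suppose a has neighbours w₁, w₂, w₃ that are pairwise connected in G − a, each time avoiding the
-- third.  Moving the base point along an edge disjoint from a walk changes the winding of the walk only
-- by boundary terms, and the windings around a, w₁, w₂, w₃ of the four closed walks of this
-- configuration add up to 1, a contradiction.  So among three neighbours of a in one component of G − a
-- one separates the other two, which allows the vertices to be arranged recursively in a linear order
-- without crossing edges.  Drawing the edges as arches over that line gives an outerplanar drawing.
--
-- Reversing the three orders exchanges the roles of vertices and faces and yields the dual statement.

open import Defs
open import Algebra.Bundles using (CommutativeRing)
open import Data.Bool using (Bool; true; false; not; _∧_; _∨_; _xor_; if_then_else_; T)
open import Data.Bool.Properties using (xor-∧-commutativeRing; xor-same; xor-comm; xor-assoc; xor-identityʳ; ∧-zeroʳ; ∧-comm; ∧-identityʳ; ∨-zeroʳ; ∧-distribʳ-xor; not-involutive; not-injective; not-¬; ¬-not)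
import Data.Bool.Properties as Boolₚ
open import Data.Bool.Solver using (module xor-∧-Solver)
open import Data.Empty using (⊥; ⊥-elim)
open import Data.Fin using (Fin; zero; suc; toℕ; fromℕ<; inject≤; combine; _↑ˡ_; _↑ʳ_; splitAt)
open import Data.Fin.Properties using (_≟_; any?; ¬∀⟶∃¬; ¬Fin0; pigeonhole; combine-injective; toℕ<n; toℕ-injective; toℕ-fromℕ<; toℕ-inject≤; toℕ≤pred[n]; splitAt-↑ˡ; splitAt-↑ʳ; splitAt⁻¹-↑ˡ; splitAt⁻¹-↑ʳ; ↑ˡ-injective)
open import Data.List using (List; []; _∷_; _++_; [_]; lookup; length)
open import Data.List.Membership.Propositional using (_∈_)
open import Data.List.Membership.Propositional.Properties using (∈-++⁺ˡ; ∈-++⁺ʳ; ∈-++⁻)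
open import Data.List.Properties using (++-assoc; ++-identityʳ)
open import Data.List.Relation.Binary.Sublist.Propositional using (_⊆_; []; _∷_; _∷ʳ_; minimum; to∈)
open import Data.List.Relation.Binary.Sublist.Propositional.Properties using (++⁺; ∷ˡ⁻)
open import Data.List.Relation.Unary.Any using (here; there; index)
open import Data.List.Relation.Unary.Any.Properties using (lookup-index)
open import Data.Nat using (ℕ; zero; suc; _+_; _*_; _∸_; _⊓_; _≤_; _<_; z≤n; s≤s; _<?_; _≤?_)
open import Data.Nat.Properties using (*-cancelˡ-<; *-cancelˡ-≡; *-monoʳ-≤; *-monoˡ-≤; +-cancelˡ-<; +-cancelˡ-≡; +-comm; +-identityʳ; +-mono-≤; +-monoʳ-<; +-monoʳ-≤; +-suc; <-asym; <-cmp; <-irrefl; <-trans; <-≤-trans; <ᵇ⇒<; <⇒≤; <⇒≱; even≢odd; m+[n∸m]≡n; m<n⇒0<n∸m; m∸n≡0⇒m≤n; m∸n≤m; m≤m+n; m≤n⇒m≤1+n; m≤n⇒m⊓n≡m; n<1+n; n≤0⇒n≡0; n≤1+n; n≮0; suc-injective; ∸-cancelˡ-≡; ∸-monoʳ-<; ∸-monoʳ-≤; ∸-monoˡ-<; ≤-<-trans; ≤-antisym; ≤-pred; ≤-refl; ≤-reflexive; ≤-total; ≤-trans; ≤ᵇ⇒≤; ≤∧≢⇒<; ≮⇒≥; ≰⇒>; ≰⇒≥; m⊓n≤n; module ≤-Reasoning)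
import Data.Nat.Properties as ℕₚ
open import Data.Product using (Σ; ∃-syntax; _×_; _,_; proj₁; proj₂)
open import Data.Product.Properties using (≡-dec)
open import Data.Sum using (_⊎_; inj₁; inj₂; [_,_]′)
open import Data.Unit using (tt)
open import Function using (_∘_; case_of_)
open import Function.Bundles using (_⇔_; mk⇔; Equivalence)
open import Function.Definitions using (Injective)
open import Relation.Binary.Definitions using (tri<; tri≈; tri>)
open import Relation.Binary.PropositionalEquality using (_≡_; _≢_; refl; sym; trans; cong; cong₂; subst; subst₂; module ≡-Reasoning)
open import Relation.Nullary using (¬_; Dec; yes; no; does)
open import Relation.Nullary.Decidable using (dec-true; dec-false; map′; ¬?; _×-dec_; _⊎-dec_)
open import Algebra.Properties.CommutativeMonoid.Sum (CommutativeRing.+-commutativeMonoid xor-∧-commutativeRing) using (∑-distrib-+; ∑-comm; sum-replicate-zero) renaming (sum to ⨁; sum-cong-≗ to ⨁-cong)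

open Equivalence using (to; from)

-- No continuous topology is available: a drawing is a rotation system of genus 0 on `H`, the graph
-- completed by invisible edges. A face of the graph may consist of several faces of `H`, while the
-- winding argument needs a cycle to bound a union of faces of the graph that miss `w`. This works
-- because the cycle uses no invisible edge and no edge at `w`: the function on faces that it bounds
-- is constant across the former and around the latter. In the dual map the nodes themselves are
-- such unions; their pieces are reconnected across invisible edges, where the arch cochain
-- vanishes.
--
-- The two sides play different parts: moving the base point trades side `o₂` of one edge for side
-- `o₁` of the other. Both sides together see only heights, and for two neighbours of `a` they give
-- 1 exactly when both or neither lie above `a`. Three heights agree in an odd number of pairs,
-- which is the final 1.
--
-- The star condition stands in for a theorem on excluded minors; it speaks of connectivity only, so
-- loops and multiple edges do no harm, and it feeds the recursion directly.

does-≡ : ∀ {n} {x y : Fin n} → does (x ≟ y) ≡ true → x ≡ y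
does-≡ {x = x} {y} h with x ≟ y
... | yes p = p
... | no  _ = case h of λ ()

xor-false : ∀ {a b} → a xor b ≡ false → a ≡ b
xor-false {false} h = sym h
xor-false {true} {true} h = refl

≡⇒xor : ∀ {a b} → a ≡ b → a xor b ≡ false
≡⇒xor {a} refl = xor-same a

⨁-false : ∀ {n} (f : Fin n → Bool) → (∀ i → f i ≡ false) → ⨁ f ≡ false
⨁-false {n} f h = trans (⨁-cong h) (sum-replicate-zero n)

⨁-point : ∀ {n} (a : Fin n) (f : Fin n → Bool) → ⨁ (λ i → does (i ≟ a) ∧ f i) ≡ f a
⨁-point {suc n} zero f = trans (cong (f zero xor_) (sum-replicate-zero n)) (xor-identityʳ _)
⨁-point (suc a) f = ⨁-point a (f ∘ suc)

-- Counting

count : ∀ {n} → (Fin n → Bool) → ℕ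
count {zero}  f = 0
count {suc n} f = (if f zero then suc else λ k → k) (count (f ∘ suc))

count-cong : ∀ {n} {f g : Fin n → Bool} → (∀ i → f i ≡ g i) → count f ≡ count g
count-cong {zero}  h = refl
count-cong {suc n} {f} {g} h rewrite h zero | count-cong (h ∘ suc) = refl

count-mono : ∀ {n} {f g : Fin n → Bool} → (∀ i → f i ≡ true → g i ≡ true) → count f ≤ count g
count-mono {zero}  h = z≤n
count-mono {suc n} {f} {g} h with f zero in p | g zero in q
... | true  | true  = s≤s (count-mono (h ∘ suc))
... | true  | false = case trans (sym q) (h zero p) of λ ()
... | false | true  = m≤n⇒m≤1+n (count-mono (h ∘ suc))
... | false | false = count-mono (h ∘ suc)

count-strict : ∀ {n} {f g : Fin n → Bool} → (∀ i → f i ≡ true → g i ≡ true) →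
               ∀ a → f a ≡ false → g a ≡ true → count f < count g
count-strict {suc n} {f} {g} h zero p q rewrite p | q = s≤s (count-mono (h ∘ suc))
count-strict {suc n} {f} {g} h (suc a) p q with f zero in r | g zero in s
... | true  | true  = s≤s (count-strict (h ∘ suc) a p q)
... | true  | false = case trans (sym s) (h zero r) of λ ()
... | false | true  = m≤n⇒m≤1+n (count-strict (h ∘ suc) a p q)
... | false | false = count-strict (h ∘ suc) a p q

count-≡⇒≗ : ∀ {n} {f g : Fin n → Bool} → (∀ i → f i ≡ true → g i ≡ true) →
            count f ≡ count g → ∀ i → f i ≡ g i
count-≡⇒≗ {f = f} {g} h e i with f i in p | g i in q
... | true  | true  = refl
... | false | false = refl
... | true  | false = trans (sym (h i p)) q
... | false | true  = ⊥-elim (<-irrefl e (count-strict h i p q))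

count-remove : ∀ {n} {f g : Fin n → Bool} a → f a ≡ true → g a ≡ false →
               (∀ x → x ≢ a → g x ≡ f x) → count f ≡ suc (count g)
count-remove {suc n} {f} {g} zero p q h rewrite p | q = cong suc (count-cong λ i → sym (h (suc i) λ ()))
count-remove {suc n} {f} {g} (suc a) p q h rewrite h zero (λ ()) with f zero
... | true  = cong suc (count-remove a p q λ x ne → h (suc x) λ { refl → ne refl })
... | false = count-remove a p q λ x ne → h (suc x) λ { refl → ne refl }

count-none : ∀ {n} {f : Fin n → Bool} → (∀ i → f i ≡ false) → count f ≡ 0
count-none {zero}  h = refl
count-none {suc n} h rewrite h zero = count-none (h ∘ suc)

count-all : ∀ {n} {f : Fin n → Bool} → (∀ i → f i ≡ true) → count f ≡ n
count-all {zero}  h = refl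
count-all {suc n} h rewrite h zero = cong suc (count-all (h ∘ suc))

count-not : ∀ {n} (f : Fin n → Bool) → count f + count (not ∘ f) ≡ n
count-not {zero}  f = refl
count-not {suc n} f with f zero
... | true  = cong suc (count-not (f ∘ suc))
... | false = trans (+-suc _ _) (cong suc (count-not (f ∘ suc)))

-- The coboundary modulo 2 of the 0-cochain `h`, for the graph whose edge `e` joins `l e` to `r e`.
δ : ∀ {A B : Set} → (A → B) → (A → B) → (B → Bool) → A → Bool
δ l r h e = h (l e) xor h (r e)

-- Forests of edges, by union-find

module _ {n : ℕ} where

  merge : Fin n → Fin n → Fin n → Fin n
  merge a b x = if does (x ≟ a) then b else x

  -- Edges are inserted from the last index to the first, edge `zero` being the most recent; the
  -- value is a representative of the component of `x`.
  comp : ∀ {m} → (Fin m → Fin n) → (Fin m → Fin n) → Fin n → Fin n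
  comp {zero}  l r x = x
  comp {suc m} l r x = merge (c (l zero)) (c (r zero)) (c x)
    where c = comp (l ∘ suc) (r ∘ suc)

  -- An edge is useful when it joins two components of the edges inserted before it; the useful
  -- edges form a spanning forest.
  useful : ∀ {m} → (Fin m → Fin n) → (Fin m → Fin n) → Fin m → Bool
  useful l r zero    = not (does (comp (l ∘ suc) (r ∘ suc) (l zero) ≟ comp (l ∘ suc) (r ∘ suc) (r zero)))
  useful l r (suc e) = useful (l ∘ suc) (r ∘ suc) e

  merge-hit : ∀ a b → merge a b a ≡ b
  merge-hit a b rewrite dec-true (a ≟ a) refl = refl

  merge-other : ∀ a b x → x ≢ a → merge a b x ≡ x
  merge-other a b x ne rewrite dec-false (x ≟ a) ne = refl

  merge-target : ∀ a b → merge a b b ≡ b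
  merge-target a b with b ≟ a
  ... | yes _ = refl
  ... | no  _ = refl

  comp-edge : ∀ {m} (l r : Fin m → Fin n) e → comp l r (l e) ≡ comp l r (r e)
  comp-edge l r zero    = trans (merge-hit (c (l zero)) (c (r zero))) (sym (merge-target (c (l zero)) (c (r zero))))
    where c = comp (l ∘ suc) (r ∘ suc)
  comp-edge l r (suc e) = cong (merge _ _) (comp-edge (l ∘ suc) (r ∘ suc) e)

  -- Stated for an arbitrary equivalence relation containing the edges, since it serves both for
  -- walks in a graph and for faces of a drawing.
  comp-sound : ∀ {m} (l r : Fin m → Fin n) (R : Fin n → Fin n → Set) →
               (∀ {x} → R x x) → (∀ {x y} → R x y → R y x) → (∀ {x y z} → R x y → R y z → R x z) →
               (∀ e → R (l e) (r e)) → ∀ x → R x (comp l r x)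
  comp-sound {zero}  l r R rf sy tr ed x = rf
  comp-sound {suc m} l r R rf sy tr ed x
    with comp (l ∘ suc) (r ∘ suc) x ≟ comp (l ∘ suc) (r ∘ suc) (l zero)
       | comp-sound (l ∘ suc) (r ∘ suc) R rf sy tr (ed ∘ suc)
  ... | yes p | ih = tr (ih x) (tr (subst (λ z → R z (l zero)) (sym p) (sy (ih (l zero)))) (tr (ed zero) (ih (r zero))))
  ... | no  _ | ih = ih x

  comp-idem : ∀ {m} (l r : Fin m → Fin n) x → comp l r (comp l r x) ≡ comp l r x
  comp-idem {zero}  l r x = refl
  comp-idem {suc m} l r x = lem (c x ≟ c (l zero))
    where
    c = comp (l ∘ suc) (r ∘ suc)
    ih = comp-idem (l ∘ suc) (r ∘ suc)
    a = c (l zero)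
    b = c (r zero)
    lem : Dec (c x ≡ a) → merge a b (c (merge a b (c x))) ≡ merge a b (c x)
    lem (yes p) rewrite p | merge-hit a b = trans (cong (merge a b) (ih (r zero))) (merge-target a b)
    lem (no ne) rewrite merge-other a b (c x) ne | ih x = merge-other a b (c x) ne

  root : ∀ {m} → (Fin m → Fin n) → (Fin m → Fin n) → Fin n → Bool
  root l r x = does (comp l r x ≟ x)

  -- Each useful edge turns exactly one root into a non-root; any other edge leaves the roots as
  -- they are.
  count-root : ∀ {m} (l r : Fin m → Fin n) → count (root l r) + count (useful l r) ≡ n
  count-root {zero} l r = trans (cong (_+ 0) (count-all λ x → dec-true (x ≟ x) refl)) (+-comm n 0)
  count-root {suc m} l r with comp (l ∘ suc) (r ∘ suc) (l zero) ≟ comp (l ∘ suc) (r ∘ suc) (r zero)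
                            | count-root (l ∘ suc) (r ∘ suc)
  ... | yes p | ih = trans (cong (_+ count (useful (l ∘ suc) (r ∘ suc))) (count-cong same)) ih
    where
    c = comp (l ∘ suc) (r ∘ suc)
    same : ∀ x → root l r x ≡ root (l ∘ suc) (r ∘ suc) x
    same x = cong (λ z → does (z ≟ x)) (lem (c x ≟ c (l zero)))
      where
      lem : Dec (c x ≡ c (l zero)) → merge (c (l zero)) (c (r zero)) (c x) ≡ c x
      lem (yes q) = trans (cong (merge (c (l zero)) (c (r zero))) q) (trans (merge-hit (c (l zero)) (c (r zero))) (trans (sym p) (sym q)))
      lem (no ne) = merge-other (c (l zero)) (c (r zero)) (c x) ne
  ... | no np | ih = trans (+-suc _ _) (trans (cong (_+ count (useful (l ∘ suc) (r ∘ suc)))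
                       (sym (count-remove a isroot notroot same))) ih)
    where
    c = comp (l ∘ suc) (r ∘ suc)
    idem = comp-idem (l ∘ suc) (r ∘ suc)
    a = c (l zero)
    b = c (r zero)
    isroot : does (c a ≟ a) ≡ true
    isroot = dec-true (c a ≟ a) (idem (l zero))
    notroot : does (merge a b (c a) ≟ a) ≡ false
    notroot = dec-false (merge a b (c a) ≟ a) λ q → np (trans (sym q) (trans (cong (merge a b) (idem (l zero))) (merge-hit a b)))
    same : ∀ x → x ≢ a → does (merge a b (c x) ≟ x) ≡ does (c x ≟ x)
    same x ne with c x ≟ x
    ... | yes q = dec-true (merge a b (c x) ≟ x) (trans (cong (merge a b) q) (merge-other a b x ne))
    ... | no nq = dec-false (merge a b (c x) ≟ x) λ q → lem q (c x ≟ a)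
      where
      lem : merge a b (c x) ≡ x → Dec (c x ≡ a) → ⊥
      lem q (yes p) = nq (trans (cong c x≡b) (trans (idem (r zero)) (sym x≡b)))
        where
        x≡b : x ≡ b
        x≡b = trans (sym q) (trans (cong (merge a b) p) (merge-hit a b))
      lem q (no np) = nq (trans (sym (merge-other a b (c x) np)) q)

  count-root-const : ∀ {m} (l r : Fin m → Fin n) (x : Fin n) → (∀ y z → comp l r y ≡ comp l r z) →
                     suc (count (useful l r)) ≡ n
  count-root-const l r x const = trans (cong (_+ count (useful l r)) (sym one)) (count-root l r)
    where
    a = comp l r x
    one : count (root l r) ≡ 1
    one = trans (count-remove {g = λ _ → false} a (dec-true (comp l r a ≟ a) (comp-idem l r x)) refl
                   λ y ne → sym (dec-false (comp l r y ≟ y) λ q → ne (trans (sym q) (const y x))))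
                (cong suc (count-none {n} {λ _ → false} λ _ → refl))

  useful-≢ : ∀ {m} (l r : Fin m → Fin n) e → useful l r e ≡ true → l e ≢ r e
  useful-≢ l r zero u p with comp (l ∘ suc) (r ∘ suc) (l zero) ≟ comp (l ∘ suc) (r ∘ suc) (r zero)
  ... | no np = np (cong (comp (l ∘ suc) (r ∘ suc)) p)
  useful-≢ l r (suc e) u p = useful-≢ (l ∘ suc) (r ∘ suc) e u p

  useful-zero : ∀ {m} (l r : Fin (suc m) → Fin n) → useful l r zero ≡ true →
                comp (l ∘ suc) (r ∘ suc) (l zero) ≢ comp (l ∘ suc) (r ∘ suc) (r zero)
  useful-zero l r u p with comp (l ∘ suc) (r ∘ suc) (l zero) ≟ comp (l ∘ suc) (r ∘ suc) (r zero)
  ... | no np = np p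

  -- A forest has no cycle to obstruct this: the new edge is corrected by flipping `g` on the whole
  -- component of one end, which leaves the coboundary on all edges inserted earlier unchanged.
  integrate : ∀ {m} (l r : Fin m → Fin n) (w : Fin m → Bool) →
              ∃[ g ] (∀ e → useful l r e ≡ true → δ l r g e ≡ w e)
  integrate {zero}  l r w = (λ _ → false) , λ ()
  integrate {suc m} l r w with integrate (l ∘ suc) (r ∘ suc) (w ∘ suc)
  ... | g , ok = g' , ok'
    where
    c = comp (l ∘ suc) (r ∘ suc)
    t : Bool
    t = w zero xor (g (l zero) xor g (r zero))
    g' : Fin n → Bool
    g' x = g x xor (does (c x ≟ c (l zero)) ∧ t)
    ok' : ∀ e → useful l r e ≡ true → δ l r g' e ≡ w e
    ok' zero u
      rewrite dec-true (c (l zero) ≟ c (l zero)) refl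
            | dec-false (c (r zero) ≟ c (l zero)) (λ p → useful-zero l r u (sym p)) =
      solve 3 (λ a b w → (a :+ (w :+ (a :+ b))) :+ (b :+ con false) := w) refl (g (l zero)) (g (r zero)) (w zero)
      where open xor-∧-Solver
    ok' (suc e) u rewrite comp-edge (l ∘ suc) (r ∘ suc) e =
      trans (solve 3 (λ a b w → (a :+ w) :+ (b :+ w) := a :+ b) refl (g (l (suc e))) (g (r (suc e)))
               (does (c (r (suc e)) ≟ c (l zero)) ∧ t)) (ok e u)
      where open xor-∧-Solver

  -- If edge `zero` is useful, take the component of one of its ends just before it is inserted. The
  -- indicator of that component has coboundary on this edge alone, so pairing with it reads off
  -- `w zero`.
  forest-cycle-zero : ∀ {m} (l r : Fin m → Fin n) (w : Fin m → Bool) →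
    (∀ e → useful l r e ≡ false → w e ≡ false) →
    (∀ h → ⨁ (λ e → w e ∧ δ l r h e) ≡ false) → ∀ e → w e ≡ false
  forest-cycle-zero {suc m} l r w sup cyc = λ { zero → w0 ; (suc e) → rest e }
    where
    c = comp (l ∘ suc) (r ∘ suc)
    h : Fin n → Bool
    h x = does (c x ≟ c (l zero))
    w0 : w zero ≡ false
    w0 with useful l r zero in u
    ... | false = sup zero u
    ... | true  = trans (sym eq) (cyc h)
      where
      eq : ⨁ (λ e → w e ∧ δ l r h e) ≡ w zero
      eq rewrite dec-true (c (l zero) ≟ c (l zero)) refl
               | dec-false (c (r zero) ≟ c (l zero)) (λ p → useful-zero l r u (sym p)) =
        trans (cong₂ _xor_ (solve 1 (λ a → a :* con true := a) refl (w zero))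
                 (⨁-false _ λ e → trans (cong (w (suc e) ∧_) (≡⇒xor (cong (λ z → does (z ≟ c (l zero)))
                     (comp-edge (l ∘ suc) (r ∘ suc) e)))) (∧-zeroʳ _)))
              (xor-identityʳ _)
        where open xor-∧-Solver
    rest : ∀ e → w (suc e) ≡ false
    rest = forest-cycle-zero (l ∘ suc) (r ∘ suc) (w ∘ suc) (sup ∘ suc)
             λ k → trans (cong (λ b → (b ∧ δ l r k zero) xor ⨁ (λ e → w (suc e) ∧ δ (l ∘ suc) (r ∘ suc) k e)) (sym w0)) (cyc k)

-- Exactness on the sphere

-- The edges u₂ form a spanning tree of the second graph.  By orthogonality their complement X
-- connects the first graph, so Euler's formula makes it a spanning tree there; a cycle corrected by a
-- boundary to vanish off X is therefore zero.
module Exact {E n₁ n₂ : ℕ}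
  (l₁ r₁ : Fin E → Fin n₁) (l₂ r₂ : Fin E → Fin n₂)
  (orth  : ∀ h g → ⨁ (λ e → δ l₁ r₁ h e ∧ δ l₂ r₂ g e) ≡ false)
  (conn₁ : ∀ h → (∀ e → δ l₁ r₁ h e ≡ false) → ∀ x y → h x ≡ h y)
  (conn₂ : ∀ h → (∀ e → δ l₂ r₂ h e ≡ false) → ∀ x y → h x ≡ h y)
  (x₁ : Fin n₁) (x₂ : Fin n₂)
  (euler : n₁ + n₂ ≡ E + 2)
  where

  private
    u₂ : Fin E → Bool
    u₂ = useful l₂ r₂

    X : Fin E → Bool
    X e = not (u₂ e)

    -- Deleting an edge is encoded as turning it into a loop, which is never useful.
    rX : Fin E → Fin n₁
    rX e = if X e then r₁ e else l₁ e

    const₂ : ∀ y z → comp l₂ r₂ y ≡ comp l₂ r₂ z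
    const₂ y z = does-≡ (trans (conn₂ (λ x → does (comp l₂ r₂ x ≟ comp l₂ r₂ z))
      (λ e → ≡⇒xor (cong (λ x → does (x ≟ comp l₂ r₂ z)) (comp-edge l₂ r₂ e))) y z) (dec-true (comp l₂ r₂ z ≟ comp l₂ r₂ z) refl))

    const₁ : ∀ y z → comp l₁ rX y ≡ comp l₁ rX z
    const₁ y z = does-≡ (trans (conn₁ p pδ y z) (dec-true (comp l₁ rX z ≟ comp l₁ rX z) refl))
      where
      p : Fin n₁ → Bool
      p x = does (comp l₁ rX x ≟ comp l₁ rX z)
      supp : ∀ e → u₂ e ≡ false → δ l₁ r₁ p e ≡ false
      supp e h with comp-edge l₁ rX e
      ... | q rewrite h = ≡⇒xor (cong (λ x → does (x ≟ comp l₁ rX z)) q)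
      -- By `orth` the coboundary of `p` is a cycle of the second graph, and it is supported on the
      -- forest `u₂`.
      pδ : ∀ e → δ l₁ r₁ p e ≡ false
      pδ = forest-cycle-zero l₂ r₂ (δ l₁ r₁ p) supp (orth p)

    usefulX⇒X : ∀ e → useful l₁ rX e ≡ true → X e ≡ true
    usefulX⇒X e u with u₂ e in q
    ... | false = refl
    ... | true  = ⊥-elim (useful-≢ l₁ rX e u (sym (cong (λ b → if not b then r₁ e else l₁ e) q)))

    -- The useful edges of the first graph lie in `X` and number `n₁` - 1; by Euler's formula this
    -- is `E` - (`n₂` - 1), the size of `X`.
    X-all-useful : ∀ e → useful l₁ rX e ≡ X e
    X-all-useful = count-≡⇒≗ usefulX⇒X (+-cancelˡ-≡ (2 + count u₂) _ _ (trans (cong suc lem) (sym lem')))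
      where
      a = count (useful l₁ rX)
      b = count u₂
      lem : suc b + a ≡ E + 1
      lem = suc-injective (begin
        suc (suc b + a)  ≡⟨ +-comm (suc (suc b)) a ⟩
        a + suc (suc b)  ≡⟨ +-suc a (suc b) ⟩
        suc a + suc b    ≡⟨ cong₂ _+_ (count-root-const l₁ rX x₁ const₁) (count-root-const l₂ r₂ x₂ const₂) ⟩
        n₁ + n₂          ≡⟨ euler ⟩
        E + 2            ≡⟨ +-suc E 1 ⟩
        suc (E + 1)      ∎)
        where open ≡-Reasoning
      lem' : 2 + b + count X ≡ suc (E + 1)
      lem' = cong suc (trans (cong suc (count-not u₂)) (+-comm 1 E))

  exact : ∀ w → (∀ h → ⨁ (λ e → w e ∧ δ l₁ r₁ h e) ≡ false) → ∃[ g ] (∀ e → w e ≡ δ l₂ r₂ g e)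
  exact w cyc = g , λ e → xor-false (zero' e)
    where
    g = proj₁ (integrate l₂ r₂ w)
    gok = proj₂ (integrate l₂ r₂ w)
    w' : Fin E → Bool
    w' e = w e xor δ l₂ r₂ g e
    supp₂ : ∀ e → u₂ e ≡ true → w' e ≡ false
    supp₂ e u = ≡⇒xor (sym (gok e u))
    supp₁ : ∀ e → useful l₁ rX e ≡ false → w' e ≡ false
    supp₁ e u = supp₂ e (lem (u₂ e) (trans (sym (X-all-useful e)) u))
      where
      lem : ∀ b → not b ≡ false → b ≡ true
      lem true _ = refl
    term : ∀ h e → w' e ∧ δ l₁ rX h e ≡ (w e ∧ δ l₁ r₁ h e) xor (δ l₁ r₁ h e ∧ δ l₂ r₂ g e)
    term h e with u₂ e in q
    ... | true  = trans (trans (cong (_∧ _) (supp₂ e q)) refl)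
                    (trans (cong (_∧ δ l₁ r₁ h e) (sym (supp₂ e q)))
                      (solve 3 (λ a b c → (a :+ b) :* c := (a :* c) :+ (c :* b)) refl (w e) (δ l₂ r₂ g e) (δ l₁ r₁ h e)))
      where open xor-∧-Solver
    ... | false = solve 3 (λ a b c → (a :+ b) :* c := (a :* c) :+ (c :* b)) refl (w e) (δ l₂ r₂ g e) (δ l₁ r₁ h e)
      where open xor-∧-Solver
    zero' : ∀ e → w' e ≡ false
    zero' = forest-cycle-zero l₁ rX w' supp₁ λ h →
      trans (⨁-cong (term h)) (trans (∑-distrib-+ (λ e → w e ∧ δ l₁ r₁ h e) (λ e → δ l₁ r₁ h e ∧ δ l₂ r₂ g e)) (cong₂ _xor_ (cyc h) (orth h g)))

-- Walks inside a vertex set, and systems of three orders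

true≢false : ∀ {b} → b ≡ true → b ≡ false → ⊥
true≢false refl ()

avoid : ∀ {n} → Fin n → Fin n → Bool
avoid w x = not (does (x ≟ w))

avoid-≢ : ∀ {n} {w x : Fin n} → x ≢ w → avoid w x ≡ true
avoid-≢ {w = w} {x} ne = cong not (dec-false (x ≟ w) ne)

≢-avoid : ∀ {n} {w x : Fin n} → avoid w x ≡ true → x ≢ w
≢-avoid {w = w} {x} h p rewrite dec-true (x ≟ w) p = case h of λ ()

module Paths (G : Graph) where

  V : Set
  V = Fin (nV G)

  data Path (S : V → Bool) : V → V → Set where
    nil  : ∀ {x} → S x ≡ true → Path S x x
    cons : ∀ {x z} e b → end G e b ≡ x → S x ≡ true → Path S (end G e (not b)) z → Path S x z

  Adj : V → V → Set
  Adj x y = ∃[ e ] ∃[ b ] (end G e b ≡ x × end G e (not b) ≡ y)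

  Adj-sym : ∀ {x y} → Adj x y → Adj y x
  Adj-sym (e , b , p , q) = e , not b , q , trans (cong (end G e) (not-involutive b)) p

  start∈ : ∀ {S x y} → Path S x y → S x ≡ true
  start∈ (nil s) = s
  start∈ (cons _ _ _ s _) = s

  stop∈ : ∀ {S x y} → Path S x y → S y ≡ true
  stop∈ (nil s) = s
  stop∈ (cons _ _ _ _ p) = stop∈ p

  infixr 5 _⊙_
  _⊙_ : ∀ {S x y z} → Path S x y → Path S y z → Path S x z
  nil _ ⊙ q = q
  cons e b i s p ⊙ q = cons e b i s (p ⊙ q)

  single : ∀ {S x y} → Adj x y → S x ≡ true → S y ≡ true → Path S x y
  single (e , b , p , refl) sx sy = cons e b p sx (nil sy)

  weaken : ∀ {S S' x y} → (∀ z → S z ≡ true → S' z ≡ true) → Path S x y → Path S' x y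
  weaken h (nil s) = nil (h _ s)
  weaken h (cons e b i s p) = cons e b i (h _ s) (weaken h p)

  reverse : ∀ {S x y} → Path S x y → Path S y x
  reverse (nil s) = nil s
  reverse (cons e b i s p) = reverse p ⊙ single (Adj-sym (e , b , i , refl)) (start∈ p) s

  psum : (Fin (nE G) → Bool) → ∀ {S x y} → Path S x y → Bool
  psum K (nil _) = false
  psum K (cons e _ _ _ p) = K e xor psum K p

  psum-⊙ : ∀ K {S x y z} (p : Path S x y) (q : Path S y z) → psum K (p ⊙ q) ≡ psum K p xor psum K q
  psum-⊙ K (nil _) q = refl
  psum-⊙ K (cons e _ _ _ p) q = trans (cong (K e xor_) (psum-⊙ K p q)) (sym (xor-assoc (K e) _ _))

  psum-weaken : ∀ K {S S' : V → Bool} {x y} (h : ∀ z → S z ≡ true → S' z ≡ true) (p : Path S x y) →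
                psum K (weaken {S} {S'} h p) ≡ psum K p
  psum-weaken K h (nil _) = refl
  psum-weaken K h (cons e _ _ _ p) = cong (K e xor_) (psum-weaken K h p)

  -- Graphs without K₄ and K₂,₃ minors are exactly those in which no vertex a has three neighbours
  -- that are pairwise connected in G − a, each time avoiding the third neighbour.
  NoStar : Set
  NoStar = ∀ {S₁ S₂ S₃ a w₁ w₂ w₃} → Adj a w₁ → Adj a w₂ → Adj a w₃ →
    S₁ a ≡ false → S₂ a ≡ false → S₃ a ≡ false → S₁ w₁ ≡ false → S₂ w₂ ≡ false → S₃ w₃ ≡ false →
    Path S₃ w₁ w₂ → Path S₁ w₂ w₃ → Path S₂ w₁ w₃ → ⊥

  NonCrossing : List V → Set
  NonCrossing xs = ∀ {a b c d} → a ∷ b ∷ c ∷ d ∷ [] ⊆ xs → Adj a c → Adj b d → ⊥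

-- Boolean-valued, so that comparisons enter sums modulo 2 as summands.
record LinOrd (X : Set) : Set where
  field
    lt    : X → X → Bool
    trns  : ∀ {x y z} → lt x y ≡ true → lt y z ≡ true → lt x z ≡ true
    asym  : ∀ {x y} → lt x y ≡ true → lt y x ≡ false
    total : ∀ {x y} → x ≢ y → lt x y ≡ false → lt y x ≡ true

open LinOrd

irrefl : ∀ {X} (o : LinOrd X) {x} → lt o x x ≢ true
irrefl o h = true≢false h (asym o h)

-- The common ground of the two halves of the theorem: vertices with edges, and after reversal faces
-- with edges. The carrier `X` may be larger than nodes and edges, because the cells are later
-- compared in the same orders.
record System (G : Graph) : Set₁ where
  field
    X        : Set
    ν        : Fin (nV G) → X
    ε        : Fin (nE G) → X
    o₁ o₂ o₃ : LinOrd X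
    below₁   : ∀ e b → lt o₁ (ν (end G e b)) (ε e) ≡ true
    below₂   : ∀ e b → lt o₂ (ν (end G e b)) (ε e) ≡ true
    below₃   : ∀ e b → lt o₃ (ν (end G e b)) (ε e) ≡ true
    above    : ∀ v e → (∀ b → end G e b ≢ v) →
               lt o₁ (ε e) (ν v) ≡ true ⊎ lt o₂ (ε e) (ν v) ≡ true ⊎ lt o₃ (ε e) (ν v) ≡ true
    distinct : ∀ v w → v ≢ w →
               lt o₁ (ν w) (ν v) ≡ true ⊎ lt o₂ (ν w) (ν v) ≡ true ⊎ lt o₃ (ν w) (ν v) ≡ true
    ν-inj    : ∀ {v w} → ν v ≡ ν w → v ≡ w
    ν≢ε      : ∀ v e → ν v ≢ ε e

-- Arches, and the parity contradiction of a star

module Star {G : Graph} (Sys : System G) where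

  open System Sys
  open Paths G

  -- Think of the third order as height, an edge being an arch over its ends.  The leg (x , f) of f
  -- passes w at the height of w on one of the two sides given by o₁ and o₂; leg records side o.
  leg : LinOrd X → V → V → Fin (nE G) → Bool
  leg o w x f = lt o₃ (ν x) (ν w) ∧ (lt o₃ (ν w) (ε f) ∧ lt o (ε f) (ν w))

  arch : LinOrd X → V → Fin (nE G) → Bool
  arch o w f = leg o w (end G f true) f xor leg o w (end G f false) f

  arch-flip : ∀ o w f b → arch o w f ≡ leg o w (end G f b) f xor leg o w (end G f (not b)) f
  arch-flip o w f true  = refl
  arch-flip o w f false = xor-comm (leg o w (end G f true) f) _

  -- In `o₃` both vertices lie below the opposite edges, so `above` is witnessed in `o₁` or `o₂`.
  -- Witnessing both in the same order would close the cycle `x` < `f` < `a` < `e` < `x`.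
  side : ∀ {x a} e f → (∃[ b ] end G f b ≡ x) → (∃[ c ] end G e c ≡ a) →
         (∀ d → end G e d ≢ x) → (∀ d → end G f d ≢ a) →
         lt o₃ (ν x) (ε e) ≡ true → lt o₃ (ν a) (ε f) ≡ true →
         lt o₂ (ε f) (ν a) ≡ lt o₁ (ε e) (ν x)
  side {x} {a} e f (b , refl) (c , refl) x∉e a∉f h₁ h₂ with lt o₂ (ε f) (ν a) in q₂ | lt o₁ (ε e) (ν x) in q₁
  ... | true  | true  = refl
  ... | false | false = refl
  ... | true  | false with above x e x∉e
  ...   | inj₁ z = ⊥-elim (true≢false z q₁)
  ...   | inj₂ (inj₁ z) = ⊥-elim (irrefl o₂ (trns o₂ (trns o₂ (below₂ f b) q₂) (trns o₂ (below₂ e c) z)))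
  ...   | inj₂ (inj₂ z) = ⊥-elim (true≢false z (asym o₃ h₁))
  side {x} {a} e f (b , refl) (c , refl) x∉e a∉f h₁ h₂ | false | true with above a f a∉f
  ...   | inj₁ z = ⊥-elim (irrefl o₁ (trns o₁ (trns o₁ (below₁ f b) z) (trns o₁ (below₁ e c) q₁)))
  ...   | inj₂ (inj₁ z) = ⊥-elim (true≢false z q₂)
  ...   | inj₂ (inj₂ z) = ⊥-elim (true≢false z (asym o₃ h₂))

  -- Only the leg starting at the lower of `x` and `a` can pass the other vertex. Both cases give
  -- the same formula because `side` trades `o₂` for `o₁`.
  crossing : ∀ {x a} e f → (∃[ b ] end G f b ≡ x) → (∃[ c ] end G e c ≡ a) →
    (∀ d → end G e d ≢ x) → (∀ d → end G f d ≢ a) →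
    leg o₂ a x f xor leg o₁ x a e ≡ lt o₃ (ν x) (ε e) ∧ (lt o₃ (ν a) (ε f) ∧ lt o₁ (ε e) (ν x))
  crossing {x} {a} e f (b , refl) (c , refl) x∉e a∉f with lt o₃ (ν x) (ν a) in p
  ... | false rewrite total o₃ (λ q → a∉f b (ν-inj q)) p
                    | trns o₃ (total o₃ (λ q → a∉f b (ν-inj q)) p) (below₃ f b) = refl
  ... | true rewrite asym o₃ p | trns o₃ p (below₃ e c) =
        trans (xor-identityʳ _) (lem (lt o₃ (ν a) (ε f)) refl)
    where
    lem : ∀ t → lt o₃ (ν a) (ε f) ≡ t → t ∧ lt o₂ (ε f) (ν a) ≡ t ∧ lt o₁ (ε e) (ν x)
    lem false _ = refl
    lem true  h = side e f (b , refl) (c , refl) x∉e a∉f (trns o₃ p (below₃ e c)) h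

  -- A reciprocity law: the eight leg terms are grouped by pairs of an end of `e` and an end of `f`,
  -- `crossing` evaluates each pair, and a parity check over the heights remains.
  disjoint-arches : ∀ e f → (∀ d c → end G e d ≢ end G f c) →
    arch o₂ (end G e true) f xor arch o₂ (end G e false) f
      ≡ arch o₁ (end G f true) e xor arch o₁ (end G f false) e
  disjoint-arches e f dis = xor-false (begin
      ((leg o₂ a x f xor leg o₂ a y f) xor (leg o₂ w x f xor leg o₂ w y f))
        xor ((leg o₁ x a e xor leg o₁ x w e) xor (leg o₁ y a e xor leg o₁ y w e))
    ≡⟨ solve 8 (λ ax ay wx wy xa xw ya yw →
          ((ax :+ ay) :+ (wx :+ wy)) :+ ((xa :+ xw) :+ (ya :+ yw))
            := ((ax :+ xa) :+ (wx :+ xw)) :+ ((ay :+ ya) :+ (wy :+ yw))) refl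
          (leg o₂ a x f) (leg o₂ a y f) (leg o₂ w x f) (leg o₂ w y f)
          (leg o₁ x a e) (leg o₁ x w e) (leg o₁ y a e) (leg o₁ y w e) ⟩
      ((leg o₂ a x f xor leg o₁ x a e) xor (leg o₂ w x f xor leg o₁ x w e))
        xor ((leg o₂ a y f xor leg o₁ y a e) xor (leg o₂ w y f xor leg o₁ y w e))
    ≡⟨ cong₂ _xor_ (cong₂ _xor_ (cr true true) (cr true false)) (cong₂ _xor_ (cr false true) (cr false false)) ⟩
      ((Xx ∧ (Aa ∧ Ux)) xor (Xx ∧ (Aw ∧ Ux))) xor ((Xy ∧ (Aa ∧ Uy)) xor (Xy ∧ (Aw ∧ Uy)))
    ≡⟨ parity Xx Xy Aa Aw Ux Uy (λ n → low true n true , low true n false) (λ n → low false n true , low false n false)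
          (λ p q r → trans (sym (sd true true p r)) (sd false true q r))
          (λ p q r → trans (sym (sd true false p r)) (sd false false q r)) ⟩
      false ∎)
    where
    open ≡-Reasoning
    open xor-∧-Solver
    x = end G f true
    y = end G f false
    a = end G e true
    w = end G e false
    Xx = lt o₃ (ν x) (ε e)
    Xy = lt o₃ (ν y) (ε e)
    Aa = lt o₃ (ν a) (ε f)
    Aw = lt o₃ (ν w) (ε f)
    Ux = lt o₁ (ε e) (ν x)
    Uy = lt o₁ (ε e) (ν y)
    cr : ∀ b c → _
    cr b c = crossing {end G f b} {end G e c} e f (b , refl) (c , refl) (λ d → dis d b) (λ d q → dis c d (sym q))
    sd : ∀ b c → _
    sd b c = side {end G f b} {end G e c} e f (b , refl) (c , refl) (λ d → dis d b) (λ d q → dis c d (sym q))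
    low : ∀ b → lt o₃ (ν (end G f b)) (ε e) ≡ false → ∀ c → lt o₃ (ν (end G e c)) (ε f) ≡ true
    low b n c = trns o₃ (trns o₃ (below₃ e c) (total o₃ (ν≢ε _ _) n)) (below₃ f b)
    -- The first two hypotheses say that an end of `f` above `e` forces both ends of `e` below `f`.
    -- The other two say that, when both ends of `f` are below `e` and some end of `e` is below `f`,
    -- `o₁` puts the ends of `f` on the same side of `e`.
    parity : ∀ Xx Xy Aa Aw Ux Uy → (Xx ≡ false → Aa ≡ true × Aw ≡ true) → (Xy ≡ false → Aa ≡ true × Aw ≡ true) →
             (Xx ≡ true → Xy ≡ true → Aa ≡ true → Ux ≡ Uy) → (Xx ≡ true → Xy ≡ true → Aw ≡ true → Ux ≡ Uy) →
             ((Xx ∧ (Aa ∧ Ux)) xor (Xx ∧ (Aw ∧ Ux))) xor ((Xy ∧ (Aa ∧ Uy)) xor (Xy ∧ (Aw ∧ Uy))) ≡ false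
    parity false Xy Aa Aw Ux Uy h _ _ _ rewrite proj₁ (h refl) | proj₂ (h refl) = xor-same (Xy ∧ Uy)
    parity true false Aa Aw Ux Uy _ h _ _ rewrite proj₁ (h refl) | proj₂ (h refl) = trans (xor-identityʳ _) (xor-same Ux)
    parity true true false false Ux Uy _ _ _ _ = refl
    parity true true true Aw Ux Uy _ _ h _ rewrite h refl refl refl = xor-same (Uy xor (Aw ∧ Uy))
    parity true true false true Ux Uy _ _ _ h rewrite h refl refl refl = xor-same Uy

  -- `disjoint-arches` telescopes along the walk: `S` misses both ends of `e`, so every edge of the
  -- walk is disjoint from `e`.
  path-arches : ∀ {S x y} e → S (end G e true) ≡ false → S (end G e false) ≡ false → (p : Path S x y) →
    psum (arch o₂ (end G e true)) p xor psum (arch o₂ (end G e false)) p ≡ arch o₁ x e xor arch o₁ y e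
  path-arches {x = x} e sa sw (nil _) = sym (xor-same (arch o₁ x e))
  path-arches {S} {x} {y} e sa sw (cons f b refl s p) = begin
      (arch o₂ a f xor psum (arch o₂ a) p) xor (arch o₂ w f xor psum (arch o₂ w) p)
    ≡⟨ solve 4 (λ p q r t → (p :+ q) :+ (r :+ t) := (p :+ r) :+ (q :+ t)) refl
         (arch o₂ a f) (psum (arch o₂ a) p) (arch o₂ w f) (psum (arch o₂ w) p) ⟩
      (arch o₂ a f xor arch o₂ w f) xor (psum (arch o₂ a) p xor psum (arch o₂ w) p)
    ≡⟨ cong₂ _xor_ (trans (disjoint-arches e f dis) (flp b)) (path-arches e sa sw p) ⟩
      (arch o₁ (end G f b) e xor arch o₁ (end G f (not b)) e) xor (arch o₁ (end G f (not b)) e xor arch o₁ y e)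
    ≡⟨ solve 3 (λ p q r → (p :+ q) :+ (q :+ r) := p :+ r) refl
         (arch o₁ (end G f b) e) (arch o₁ (end G f (not b)) e) (arch o₁ y e) ⟩
      arch o₁ (end G f b) e xor arch o₁ y e ∎
    where
    open ≡-Reasoning
    open xor-∧-Solver
    a = end G e true
    w = end G e false
    flp : ∀ b → arch o₁ (end G f true) e xor arch o₁ (end G f false) e
              ≡ arch o₁ (end G f b) e xor arch o₁ (end G f (not b)) e
    flp true  = refl
    flp false = xor-comm (arch o₁ (end G f true) e) _
    out : ∀ d → S (end G e d) ≡ false
    out true  = sa
    out false = sw
    inn : ∀ b → S (end G f b) ≡ true → S (end G f (not b)) ≡ true → ∀ c → S (end G f c) ≡ true
    inn true  s t true  = s
    inn true  s t false = t
    inn false s t true  = t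
    inn false s t false = s
    dis : ∀ d c → end G e d ≢ end G f c
    dis d c q = true≢false (trans (cong S q) (inn b s (start∈ p) c)) (out d)

  -- A leg at the height of `w` passes on some side because `w` is not an end of `f`; passing on
  -- both sides would put `x` below `w` in all three orders, against `distinct`.
  both-sides : ∀ {w x f} → (∃[ b ] end G f b ≡ x) → (∀ d → end G f d ≢ w) →
               leg o₁ w x f xor leg o₂ w x f ≡ lt o₃ (ν x) (ν w) ∧ lt o₃ (ν w) (ε f)
  both-sides {w} {x} {f} (b , refl) w∉f with lt o₃ (ν x) (ν w) in p | lt o₃ (ν w) (ε f) in q
  ... | false | _     = refl
  ... | true  | false = refl
  ... | true  | true with lt o₁ (ε f) (ν w) in h₁ | lt o₂ (ε f) (ν w) in h₂
  ...   | true  | false = refl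
  ...   | false | true  = refl
  ...   | true  | true with distinct x w (w∉f b)
  ...     | inj₁ z = ⊥-elim (irrefl o₁ (trns o₁ (trns o₁ (below₁ f b) h₁) z))
  ...     | inj₂ (inj₁ z) = ⊥-elim (irrefl o₂ (trns o₂ (trns o₂ (below₂ f b) h₂) z))
  ...     | inj₂ (inj₂ z) = ⊥-elim (irrefl o₃ (trns o₃ p z))
  both-sides {w} {x} {f} (b , refl) w∉f | true | true | false | false with above w f w∉f
  ...     | inj₁ z = ⊥-elim (true≢false z h₁)
  ...     | inj₂ (inj₁ z) = ⊥-elim (true≢false z h₂)
  ...     | inj₂ (inj₂ z) = ⊥-elim (irrefl o₃ (trns o₃ q z))

  ends-of : ∀ {a w} ((e , b , _) : Adj a w) → ∀ d → end G e d ≡ a ⊎ end G e d ≡ w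
  ends-of (e , true  , p , q) true  = inj₁ p
  ends-of (e , true  , p , q) false = inj₂ q
  ends-of (e , false , p , q) true  = inj₂ q
  ends-of (e , false , p , q) false = inj₁ p

  -- Only the heights of a, v, w and the two edges matter here.
  adjacent-arches : ∀ {a v w} (av : Adj a v) (aw : Adj a w) → v ≢ a → w ≢ a → v ≢ w →
    (arch o₁ v (proj₁ aw) xor arch o₂ v (proj₁ aw)) xor (arch o₁ w (proj₁ av) xor arch o₂ w (proj₁ av))
      ≡ not (lt o₃ (ν a) (ν v) xor lt o₃ (ν a) (ν w))
  adjacent-arches {a} {v} {w} av@(e , b , ea , ev) aw@(f , c , fa , fw) v≢a w≢a v≢w = begin
      (arch o₁ v f xor arch o₂ v f) xor (arch o₁ w e xor arch o₂ w e)
    ≡⟨ cong₂ _xor_ (total-arch aw λ d q → v∉f (ends-of aw d) q) (total-arch av λ d q → w∉e (ends-of av d) q) ⟩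
      ((lt o₃ (ν a) (ν v) ∧ lt o₃ (ν v) (ε f)) xor (lt o₃ (ν w) (ν v) ∧ lt o₃ (ν v) (ε f)))
        xor ((lt o₃ (ν a) (ν w) ∧ lt o₃ (ν w) (ε e)) xor (lt o₃ (ν v) (ν w) ∧ lt o₃ (ν w) (ε e)))
    ≡⟨ parity (lt o₃ (ν a) (ν v)) (lt o₃ (ν a) (ν w)) (lt o₃ (ν v) (ε f)) (lt o₃ (ν w) (ε e)) (lt o₃ (ν w) (ν v)) (lt o₃ (ν v) (ν w))
         (opp v w v≢w) (high aw av v≢w ) (high av aw (v≢w ∘ sym)) ⟩
      not (lt o₃ (ν a) (ν v) xor lt o₃ (ν a) (ν w)) ∎
    where
    open ≡-Reasoning
    open xor-∧-Solver
    v∉f : ∀ {x} → x ≡ a ⊎ x ≡ w → x ≢ v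
    v∉f (inj₁ refl) q = v≢a (sym q)
    v∉f (inj₂ refl) q = v≢w (sym q)
    w∉e : ∀ {x} → x ≡ a ⊎ x ≡ v → x ≢ w
    w∉e (inj₁ refl) q = w≢a (sym q)
    w∉e (inj₂ refl) q = v≢w q
    total-arch : ∀ {a w v} ((f , _) : Adj a w) → (∀ d → end G f d ≢ v) →
      arch o₁ v f xor arch o₂ v f ≡ (lt o₃ (ν a) (ν v) ∧ lt o₃ (ν v) (ε f)) xor (lt o₃ (ν w) (ν v) ∧ lt o₃ (ν v) (ε f))
    total-arch {a} {w} {v} (f , b , refl , refl) out = begin
        arch o₁ v f xor arch o₂ v f
      ≡⟨ cong₂ _xor_ (arch-flip o₁ v f b) (arch-flip o₂ v f b) ⟩
        (leg o₁ v a f xor leg o₁ v w f) xor (leg o₂ v a f xor leg o₂ v w f)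
      ≡⟨ solve 4 (λ p q r s → (p :+ q) :+ (r :+ s) := (p :+ r) :+ (q :+ s)) refl
           (leg o₁ v a f) (leg o₁ v w f) (leg o₂ v a f) (leg o₂ v w f) ⟩
        (leg o₁ v a f xor leg o₂ v a f) xor (leg o₁ v w f xor leg o₂ v w f)
      ≡⟨ cong₂ _xor_ (both-sides (b , refl) out) (both-sides (not b , refl) out) ⟩
        (lt o₃ (ν a) (ν v) ∧ lt o₃ (ν v) (ε f)) xor (lt o₃ (ν w) (ν v) ∧ lt o₃ (ν v) (ε f)) ∎
    opp : ∀ v w → v ≢ w → lt o₃ (ν v) (ν w) ≡ not (lt o₃ (ν w) (ν v))
    opp v w ne with lt o₃ (ν w) (ν v) in q
    ... | true  = asym o₃ q
    ... | false = total o₃ (λ r → ne (sym (ν-inj r))) q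
    high : ∀ {a v w} ((f , _) : Adj a w) ((e , _) : Adj a v) → v ≢ w → lt o₃ (ν v) (ε f) ≡ false →
           lt o₃ (ν a) (ν v) ≡ true × lt o₃ (ν w) (ν v) ≡ true × lt o₃ (ν w) (ε e) ≡ true
    high {v = v} {w} (f , c , refl , refl) (e , b , ea , refl) ne n = trns o₃ (below₃ f c) f<v , w<v , trns o₃ w<v (below₃ e (not b))
      where
      f<v = total o₃ (ν≢ε _ _) n
      w<v = trns o₃ (below₃ f (not c)) f<v
    parity : ∀ p q m n r r' → r' ≡ not r → (m ≡ false → p ≡ true × r ≡ true × n ≡ true) →
             (n ≡ false → q ≡ true × r' ≡ true × m ≡ true) →
             ((p ∧ m) xor (r ∧ m)) xor ((q ∧ n) xor (r' ∧ n)) ≡ not (p xor q)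
    parity p q true true r r' refl _ _ with p | q | r
    ... | false | false | false = refl
    ... | false | false | true  = refl
    ... | false | true  | false = refl
    ... | false | true  | true  = refl
    ... | true  | false | false = refl
    ... | true  | false | true  = refl
    ... | true  | true  | false = refl
    ... | true  | true  | true  = refl
    parity p q false n r r' refl h _ with h refl
    ... | refl , refl , refl with q
    ...   | false = refl
    ...   | true  = refl
    parity p q true false r r' e _ h with h refl
    parity p q true false true  r' refl _ h | refl , () , refl
    parity p q true false false r' refl _ h | refl , refl , refl with p
    ... | false = refl
    ... | true  = refl

  module Conclude
    (winding : ∀ w {x y} (p q : Path (avoid w) x y) → psum (arch o₂ w) p ≡ psum (arch o₂ w) q)
    where

    -- The base point moves from `a` to the neighbour `x` by `path-arches`, at the cost of two
    -- boundary terms. Around `x` the walk may be replaced by `v`, `a`, `w`, which has only two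
    -- edges.
    around : ∀ {S a v w x} (e : Adj a x) → S a ≡ false → S x ≡ false → x ≢ a → (av : Adj a v) (aw : Adj a w) (p : Path S v w) →
      psum (arch o₂ a) p ≡ (arch o₂ x (proj₁ av) xor arch o₂ x (proj₁ aw)) xor (arch o₁ v (proj₁ e) xor arch o₁ w (proj₁ e))
    around {S} {a} {v} {w} {x} (e , b , ea , ex) sa sx x≢a av@(f , c , fa , fv) aw@(g , d , ga , gw) p = begin
        A
      ≡⟨ solve 2 (λ a b → a := b :+ (a :+ b)) refl A B ⟩
        B xor (A xor B)
      ≡⟨ cong₂ _xor_ wind (hom b ea ex) ⟩
        (arch o₂ x f xor arch o₂ x g) xor (arch o₁ v e xor arch o₁ w e) ∎
      where
      open ≡-Reasoning
      open xor-∧-Solver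
      A = psum (arch o₂ a) p
      B = psum (arch o₂ x) p
      out : ∀ z → S z ≡ true → avoid x z ≡ true
      out z h = avoid-≢ {w = x} {z} λ { refl → true≢false h sx }
      ax : avoid x a ≡ true
      ax = avoid-≢ (x≢a ∘ sym)
      q : Path (avoid x) v w
      q = single (Adj-sym av) (out v (start∈ p)) ax ⊙ single aw ax (out w (stop∈ p))
      psum-single : ∀ {v w} (K : Fin (nE G) → Bool) {S} (av : Adj v w) (s : S v ≡ true) (t : S w ≡ true) →
                    psum K {S} (single av s t) ≡ K (proj₁ av)
      psum-single K (e , b , _ , refl) s t = xor-identityʳ (K e)
      wind : B ≡ arch o₂ x f xor arch o₂ x g
      wind = trans (sym (psum-weaken (arch o₂ x) out p)) (trans (winding x (weaken out p) q)
               (trans (psum-⊙ (arch o₂ x) (single (Adj-sym av) (out v (start∈ p)) ax) _)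
                      (cong₂ _xor_ (psum-single (arch o₂ x) (Adj-sym av) _ _) (psum-single (arch o₂ x) aw _ _))))
      hom : ∀ b → end G e b ≡ a → end G e (not b) ≡ x → A xor B ≡ arch o₁ v e xor arch o₁ w e
      hom true  refl refl = path-arches e sa sx p
      hom false refl refl = trans (xor-comm A B) (path-arches e sx sa p)

    star : NoStar
    star {S₁} {S₂} {S₃} {a} {w₁} {w₂} {w₃} a₁ a₂ a₃ s₁ s₂ s₃ t₁ t₂ t₃ p₁₂ p₂₃ p₁₃ = case odd of λ ()
      where
      open ≡-Reasoning
      open xor-∧-Solver
      e₁ = proj₁ a₁
      e₂ = proj₁ a₂
      e₃ = proj₁ a₃
      n₁ : w₁ ≢ a
      n₁ refl = true≢false (start∈ p₁₂) s₃
      n₂ : w₂ ≢ a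
      n₂ refl = true≢false (start∈ p₂₃) s₁
      n₃ : w₃ ≢ a
      n₃ refl = true≢false (stop∈ p₂₃) s₁
      n₁₂ : w₁ ≢ w₂
      n₁₂ refl = true≢false (start∈ p₁₃) t₂
      n₁₃ : w₁ ≢ w₃
      n₁₃ refl = true≢false (start∈ p₁₂) t₃
      n₂₃ : w₂ ≢ w₃
      n₂₃ refl = true≢false (stop∈ p₁₂) t₃
      av : ∀ (S : V → Bool) → S a ≡ false → ∀ z → S z ≡ true → avoid a z ≡ true
      av S s z h = avoid-≢ {w = a} {z} λ { refl → true≢false h s }
      P : ∀ {S : V → Bool} {x y} → Path S x y → Bool
      P = psum (arch o₂ a)
      closed : P p₁₃ ≡ P p₁₂ xor P p₂₃
      closed = begin
        P p₁₃                                    ≡⟨ psum-weaken (arch o₂ a) (av S₂ s₂) p₁₃ ⟨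
        P (weaken (av S₂ s₂) p₁₃)                   ≡⟨ winding a (weaken (av S₂ s₂) p₁₃) (weaken (av S₃ s₃) p₁₂ ⊙ weaken (av S₁ s₁) p₂₃) ⟩
        P (weaken (av S₃ s₃) p₁₂ ⊙ weaken (av S₁ s₁) p₂₃)     ≡⟨ psum-⊙ (arch o₂ a) (weaken (av S₃ s₃) p₁₂) _ ⟩
        P (weaken (av S₃ s₃) p₁₂) xor P (weaken (av S₁ s₁) p₂₃) ≡⟨ cong₂ _xor_ (psum-weaken (arch o₂ a) (av S₃ s₃) p₁₂) (psum-weaken (arch o₂ a) (av S₁ s₁) p₂₃) ⟩
        P p₁₂ xor P p₂₃                          ∎
      L₁ = λ w f → arch o₁ w f
      L₂ = λ w f → arch o₂ w f
      h₁ = lt o₃ (ν a) (ν w₁)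
      h₂ = lt o₃ (ν a) (ν w₂)
      h₃ = lt o₃ (ν a) (ν w₃)
      -- Among three bits an odd number of pairs agree. Expanding each pair by `adjacent-arches`
      -- gives twelve arch terms, which regroup into the three right-hand sides of `around`.
      odd : true ≡ false
      odd = begin
          true
        ≡⟨ solve 3 (λ a b c → con true := ((con true :+ (a :+ b)) :+ (con true :+ (a :+ c))) :+ (con true :+ (b :+ c))) refl h₁ h₂ h₃ ⟩
          (not (h₁ xor h₂) xor not (h₁ xor h₃)) xor not (h₂ xor h₃)
        ≡⟨ cong₂ _xor_ (cong₂ _xor_ (adjacent-arches a₁ a₂ n₁ n₂ n₁₂) (adjacent-arches a₁ a₃ n₁ n₃ n₁₃)) (adjacent-arches a₂ a₃ n₂ n₃ n₂₃) ⟨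
          (((L₁ w₁ e₂ xor L₂ w₁ e₂) xor (L₁ w₂ e₁ xor L₂ w₂ e₁)) xor ((L₁ w₁ e₃ xor L₂ w₁ e₃) xor (L₁ w₃ e₁ xor L₂ w₃ e₁)))
            xor ((L₁ w₂ e₃ xor L₂ w₂ e₃) xor (L₁ w₃ e₂ xor L₂ w₃ e₂))
        ≡⟨ solve 12 (λ a b c d e f g h i j k l →
              (((a :+ b) :+ (c :+ d)) :+ ((e :+ f) :+ (g :+ h))) :+ ((i :+ j) :+ (k :+ l)) :=
              ((d :+ j) :+ (a :+ k)) :+ (((h :+ l) :+ (e :+ i)) :+ ((b :+ f) :+ (c :+ g)))) refl
             (L₁ w₁ e₂) (L₂ w₁ e₂) (L₁ w₂ e₁) (L₂ w₂ e₁) (L₁ w₁ e₃) (L₂ w₁ e₃) (L₁ w₃ e₁) (L₂ w₃ e₁) (L₁ w₂ e₃) (L₂ w₂ e₃) (L₁ w₃ e₂) (L₂ w₃ e₂) ⟩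
          ((L₂ w₂ e₁ xor L₂ w₂ e₃) xor (L₁ w₁ e₂ xor L₁ w₃ e₂))
            xor (((L₂ w₃ e₁ xor L₂ w₃ e₂) xor (L₁ w₁ e₃ xor L₁ w₂ e₃))
              xor ((L₂ w₁ e₂ xor L₂ w₁ e₃) xor (L₁ w₂ e₁ xor L₁ w₃ e₁)))
        ≡⟨ cong₂ _xor_ (around a₂ s₂ t₂ n₂ a₁ a₃ p₁₃)
             (cong₂ _xor_ (around a₃ s₃ t₃ n₃ a₁ a₂ p₁₂) (around a₁ s₁ t₁ n₁ a₂ a₃ p₂₃)) ⟨
          P p₁₃ xor (P p₁₂ xor P p₂₃)
        ≡⟨ ≡⇒xor closed ⟩
          false ∎

-- Sums over darts

module _ {E : ℕ} where

  opp : Fin E × Bool → Fin E × Bool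
  opp (e , b) = e , not b

  ⨁ᴰ : (Fin E × Bool → Bool) → Bool
  ⨁ᴰ f = ⨁ λ e → f (e , true) xor f (e , false)

  _≟ᴰ_ : (d d' : Fin E × Bool) → Dec (d ≡ d')
  _≟ᴰ_ = ≡-dec _≟_ Boolₚ._≟_

  ⨁ᴰ-cong : ∀ {f g : Fin E × Bool → Bool} → (∀ d → f d ≡ g d) → ⨁ᴰ f ≡ ⨁ᴰ g
  ⨁ᴰ-cong h = ⨁-cong λ e → cong₂ _xor_ (h (e , true)) (h (e , false))

  ⨁ᴰ-xor : ∀ (f g : Fin E × Bool → Bool) → ⨁ᴰ (λ d → f d xor g d) ≡ ⨁ᴰ f xor ⨁ᴰ g
  ⨁ᴰ-xor f g = trans
    (⨁-cong λ e → solve 4 (λ a b c d → (a :+ b) :+ (c :+ d) := (a :+ c) :+ (b :+ d)) refl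
      (f (e , true)) (g (e , true)) (f (e , false)) (g (e , false)))
    (∑-distrib-+ (λ e → f (e , true) xor f (e , false)) (λ e → g (e , true) xor g (e , false)))
    where open xor-∧-Solver

  ⨁ᴰ-point : ∀ a (f : Fin E × Bool → Bool) → ⨁ᴰ (λ d → does (d ≟ᴰ a) ∧ f d) ≡ f a
  ⨁ᴰ-point (a , b) f = trans (⨁-cong (term b)) (⨁-point a (λ e → f (e , b)))
    where
    term : ∀ b e → (does ((e , true) ≟ᴰ (a , b)) ∧ f (e , true)) xor (does ((e , false) ≟ᴰ (a , b)) ∧ f (e , false))
                 ≡ does (e ≟ a) ∧ f (e , b)
    term true e with e ≟ a
    ... | yes refl = xor-identityʳ _
    ... | no _ = refl
    term false e with e ≟ a
    ... | yes refl = refl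
    ... | no _ = refl

  ⨁ᴰ-comm : ∀ (f : Fin E × Bool → Fin E × Bool → Bool) → ⨁ᴰ (λ d → ⨁ᴰ (f d)) ≡ ⨁ᴰ (λ d' → ⨁ᴰ (λ d → f d d'))
  ⨁ᴰ-comm f = begin
      ⨁ (λ e → ⨁ (λ e' → f (e , true) (e' , true) xor f (e , true) (e' , false))
             xor ⨁ (λ e' → f (e , false) (e' , true) xor f (e , false) (e' , false)))
    ≡⟨ ⨁-cong (λ e → ∑-distrib-+ (λ e' → f (e , true) (e' , true) xor f (e , true) (e' , false))
                                  (λ e' → f (e , false) (e' , true) xor f (e , false) (e' , false))) ⟨
      ⨁ (λ e → ⨁ (λ e' → (f (e , true) (e' , true) xor f (e , true) (e' , false))
                      xor (f (e , false) (e' , true) xor f (e , false) (e' , false))))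
    ≡⟨ ∑-comm (λ e e' → (f (e , true) (e' , true) xor f (e , true) (e' , false))
                      xor (f (e , false) (e' , true) xor f (e , false) (e' , false))) ⟩
      ⨁ (λ e' → ⨁ (λ e → (f (e , true) (e' , true) xor f (e , true) (e' , false))
                      xor (f (e , false) (e' , true) xor f (e , false) (e' , false))))
    ≡⟨ ⨁-cong (λ e' → trans (⨁-cong (λ e → solve 4 (λ a b c d → (a :+ b) :+ (c :+ d) := (a :+ c) :+ (b :+ d)) refl
          (f (e , true) (e' , true)) (f (e , true) (e' , false)) (f (e , false) (e' , true)) (f (e , false) (e' , false))))
          (∑-distrib-+ (λ e → f (e , true) (e' , true) xor f (e , false) (e' , true))
                       (λ e → f (e , true) (e' , false) xor f (e , false) (e' , false)))) ⟩
      ⨁ᴰ (λ d' → ⨁ᴰ (λ d → f d d')) ∎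
    where
    open ≡-Reasoning
    open xor-∧-Solver

  ⨁ᴰ-permute : ∀ (π π⁻ : Fin E × Bool → Fin E × Bool) → (∀ d → π⁻ (π d) ≡ d) → (∀ d → π (π⁻ d) ≡ d) →
               ∀ h → ⨁ᴰ (λ d → h (π d)) ≡ ⨁ᴰ h
  ⨁ᴰ-permute π π⁻ π⁻π ππ⁻ h = begin
      ⨁ᴰ (λ d → h (π d))
    ≡⟨ ⨁ᴰ-cong (λ d → ⨁ᴰ-point (π d) h) ⟨
      ⨁ᴰ (λ d → ⨁ᴰ (λ d' → does (d' ≟ᴰ π d) ∧ h d'))
    ≡⟨ ⨁ᴰ-comm (λ d d' → does (d' ≟ᴰ π d) ∧ h d') ⟩
      ⨁ᴰ (λ d' → ⨁ᴰ (λ d → does (d' ≟ᴰ π d) ∧ h d'))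
    ≡⟨ ⨁ᴰ-cong (λ d' → trans (⨁ᴰ-cong (λ d → cong (_∧ h d') (same d d'))) (⨁ᴰ-point (π⁻ d') (λ _ → h d'))) ⟩
      ⨁ᴰ h ∎
    where
    open ≡-Reasoning
    same : ∀ d d' → does (d' ≟ᴰ π d) ≡ does (d ≟ᴰ π⁻ d')
    same d d' with d' ≟ᴰ π d
    ... | yes refl = sym (dec-true (d ≟ᴰ π⁻ (π d)) (sym (π⁻π d)))
    ... | no ne = sym (dec-false (d ≟ᴰ π⁻ d') λ { refl → ne (sym (ππ⁻ d')) })

  ⨁ᴰ-boundary : ∀ (π π⁻ : Fin E × Bool → Fin E × Bool) → (∀ d → π⁻ (π d) ≡ d) → (∀ d → π (π⁻ d) ≡ d) →
                ∀ h → ⨁ᴰ (λ d → h d xor h (π d)) ≡ false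
  ⨁ᴰ-boundary π π⁻ π⁻π ππ⁻ h = trans (⨁ᴰ-xor h (h ∘ π))
    (≡⇒xor (sym (⨁ᴰ-permute π π⁻ π⁻π ππ⁻ h)))

-- Winding around a vertex

-- Used twice: with the face permutation as `π`, vertices as nodes and faces as cells; and with the
-- rotation as `π`, faces as nodes and vertices as cells. `π` walks around a cell; an invisible edge
-- has one cell on both sides in the first use and joins a node to itself in the second.
module Cells {G : Graph} (Sys : System G) (nI : ℕ)
  (π π⁻ : Fin (nE G + nI) × Bool → Fin (nE G + nI) × Bool)
  (π⁻π : ∀ d → π⁻ (π d) ≡ d) (ππ⁻ : ∀ d → π (π⁻ d) ≡ d)
  (node : Fin (nE G + nI) × Bool → Fin (nV G))
  {C : Set} (cell : Fin (nE G + nI) × Bool → C) (κ : C → System.X Sys)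
  (node-π : ∀ d → node (π d) ≡ node (opp d))
  (cell-π : ∀ d → cell (π d) ≡ cell d)
  (node-end : ∀ e b → end G e b ≡ node (e ↑ˡ nI , b))
  (edge<cell₁ : ∀ e b → lt (System.o₁ Sys) (System.ε Sys e) (κ (cell (e ↑ˡ nI , b))) ≡ true)
  (edge<cell₂ : ∀ e b → lt (System.o₂ Sys) (System.ε Sys e) (κ (cell (e ↑ˡ nI , b))) ≡ true)
  (edge<cell₃ : ∀ e b → lt (System.o₃ Sys) (System.ε Sys e) (κ (cell (e ↑ˡ nI , b))) ≡ true)
  (cell<node : ∀ w d → (∀ d' → cell d' ≡ cell d → node d' ≢ w) →
     lt (System.o₁ Sys) (κ (cell d)) (System.ν Sys w) ≡ true ⊎
     lt (System.o₂ Sys) (κ (cell d)) (System.ν Sys w) ≡ true ⊎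
     lt (System.o₃ Sys) (κ (cell d)) (System.ν Sys w) ≡ true)
  (invisible : ∀ i → cell (nE G ↑ʳ i , true) ≡ cell (nE G ↑ʳ i , false) ⊎
                     node (nE G ↑ʳ i , true) ≡ node (nE G ↑ʳ i , false))
  where

  open System Sys
  open Star Sys

  -- On the boundary of a cell c missing w the cochain arch is the coboundary of level w c.
  level : Fin (nV G) → C → Fin (nV G) → Bool
  level w c x = lt o₂ (κ c) (ν w) ∧ lt o₃ (ν x) (ν w)

  -- Invisible edges carry no arch. Their value makes the identity with `level` true by definition
  -- on one side; `invisible` gives it on the other.
  invArch : Fin (nV G) → Fin nI → Bool
  invArch w i = level w (cell (nE G ↑ʳ i , true)) (node (nE G ↑ʳ i , true))
            xor level w (cell (nE G ↑ʳ i , true)) (node (nE G ↑ʳ i , false))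

  archᴴ : Fin (nV G) → Fin (nE G + nI) → Bool
  archᴴ w e = [ arch o₂ w , invArch w ]′ (splitAt (nE G) e)

  archᴴ-visible : ∀ w e → archᴴ w (e ↑ˡ nI) ≡ arch o₂ w e
  archᴴ-visible w e = cong [ arch o₂ w , invArch w ]′ (splitAt-↑ˡ (nE G) e nI)

  archᴴ-invisible : ∀ w i → archᴴ w (nE G ↑ʳ i) ≡ invArch w i
  archᴴ-invisible w i = cong [ arch o₂ w , invArch w ]′ (splitAt-↑ʳ (nE G) nI i)

  Off : Fin (nV G) → Fin (nE G + nI) × Bool → Set
  Off w d = ∀ d' → cell d' ≡ cell d → node d' ≢ w

  -- If the cell is below `w` in `o₂`, so is `e`, and passing `w` is a matter of heights alone.
  -- Otherwise the leg vanishes: a passing leg would force the cell below `w` in `o₁`, hence the end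
  -- below `w` in all three orders, against `distinct`. The last summand does not depend on the end
  -- and cancels in the arch.
  leg-level : ∀ w e b c → Off w (e ↑ˡ nI , b) →
    leg o₂ w (end G e c) e ≡ level w (cell (e ↑ˡ nI , b)) (end G e c)
                         xor (lt o₂ (κ (cell (e ↑ˡ nI , b))) (ν w) ∧ lt o₃ (ε e) (ν w))
  leg-level w e b c off = main _ refl
    where
    d = (e ↑ˡ nI , b)
    w∉e : end G e c ≢ w
    w∉e q with c Boolₚ.≟ b
    ... | yes refl = off d refl (trans (sym (node-end e b)) q)
    ... | no ne = off (π d) (cell-π d) (trans (node-π d) (trans (cong (λ z → node (e ↑ˡ nI , z)) (sym (¬-not ne))) (trans (sym (node-end e c)) q)))
    main : ∀ t → lt o₂ (κ (cell d)) (ν w) ≡ t →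
           leg o₂ w (end G e c) e ≡ (t ∧ lt o₃ (ν (end G e c)) (ν w)) xor (t ∧ lt o₃ (ε e) (ν w))
    main true h rewrite trns o₂ (edge<cell₂ e b) h with lt o₃ (ε e) (ν w) in q
    ... | true  rewrite trns o₃ (below₃ e c) q | asym o₃ q = refl
    ... | false rewrite total o₃ (λ z → ν≢ε w e (sym z)) q = trans (∧-identityʳ _) (sym (xor-identityʳ _))
    main false h with lt o₃ (ν (end G e c)) (ν w) in p | lt o₃ (ν w) (ε e) in q | lt o₂ (ε e) (ν w) in r
    ... | false | _     | _     = refl
    ... | true  | false | _     = refl
    ... | true  | true  | false = refl
    ... | true  | true  | true with cell<node w d off
    ...   | inj₂ (inj₁ z) = ⊥-elim (true≢false z h)
    ...   | inj₂ (inj₂ z) = ⊥-elim (irrefl o₃ (trns o₃ q (trns o₃ (edge<cell₃ e b) z)))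
    ...   | inj₁ z with distinct (end G e c) w w∉e
    ...     | inj₁ y = ⊥-elim (irrefl o₁ (trns o₁ (trns o₁ (below₁ e c) (edge<cell₁ e b)) (trns o₁ z y)))
    ...     | inj₂ (inj₁ y) = ⊥-elim (irrefl o₂ (trns o₂ (below₂ e c) (trns o₂ r y)))
    ...     | inj₂ (inj₂ y) = ⊥-elim (irrefl o₃ (trns o₃ p y))

  archᴴ-level : ∀ w e b → Off w (e , b) →
    archᴴ w e ≡ level w (cell (e , b)) (node (e , b)) xor level w (cell (e , b)) (node (e , not b))
  archᴴ-level w e b off with splitAt (nE G) e in s
  ... | inj₁ e' rewrite sym (splitAt⁻¹-↑ˡ s) = begin
      arch o₂ w e'
    ≡⟨ arch-flip o₂ w e' b ⟩
      leg o₂ w (end G e' b) e' xor leg o₂ w (end G e' (not b)) e'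
    ≡⟨ cong₂ _xor_ (leg-level w e' b b off) (leg-level w e' b (not b) off) ⟩
      (level w c (end G e' b) xor t) xor (level w c (end G e' (not b)) xor t)
    ≡⟨ solve 3 (λ a b c → (a :+ c) :+ (b :+ c) := a :+ b) refl (level w c (end G e' b)) (level w c (end G e' (not b))) t ⟩
      level w c (end G e' b) xor level w c (end G e' (not b))
    ≡⟨ cong₂ (λ x y → level w c x xor level w c y) (node-end e' b) (node-end e' (not b)) ⟩
      level w c (node (e' ↑ˡ nI , b)) xor level w c (node (e' ↑ˡ nI , not b)) ∎
    where
    open ≡-Reasoning
    open xor-∧-Solver
    c = cell (e' ↑ˡ nI , b)
    t = lt o₂ (κ c) (ν w) ∧ lt o₃ (ε e') (ν w)
  ... | inj₂ i rewrite sym (splitAt⁻¹-↑ʳ {nE G} {nI} {e} s) = lem b (invisible i)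
    where
    j = nE G ↑ʳ i
    lem : ∀ b → cell (j , true) ≡ cell (j , false) ⊎ node (j , true) ≡ node (j , false) →
          invArch w i ≡ level w (cell (j , b)) (node (j , b)) xor level w (cell (j , b)) (node (j , not b))
    lem true  _ = refl
    lem false (inj₁ q) rewrite q = xor-comm (level w (cell (j , false)) (node (j , true))) _
    lem false (inj₂ q) rewrite q = trans (xor-same (level w (cell (j , true)) (node (j , false)))) (sym (xor-same (level w (cell (j , false)) (node (j , false)))))

  -- `γ` selects cells missing `w`. The sum over their boundaries telescopes, because along each
  -- cell the arch is a difference of consecutive `level` values.
  winding-zero : ∀ w (γ : Fin (nE G + nI) × Bool → Bool) → (∀ d → γ (π d) ≡ γ d) →
    (∀ d → γ d ≡ true → Off w d) →
    ⨁ (λ e → (γ (e , true) xor γ (e , false)) ∧ archᴴ w e) ≡ false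
  winding-zero w γ γ-π γ-off = trans (⨁-cong λ e → trans (∧-distribʳ-xor (archᴴ w e) (γ (e , true)) (γ (e , false)))
      (cong₂ _xor_ (term e true) (term e false))) (⨁ᴰ-boundary π π⁻ π⁻π ππ⁻ h)
    where
    h : Fin (nE G + nI) × Bool → Bool
    h d = γ d ∧ level w (cell d) (node d)
    term : ∀ e b → γ (e , b) ∧ archᴴ w e ≡ h (e , b) xor h (π (e , b))
    term e b rewrite γ-π (e , b) | cell-π (e , b) | node-π (e , b) with γ (e , b) in q
    ... | false = refl
    ... | true  = archᴴ-level w e b (γ-off (e , b) q)

-- Chains modulo 2 and the homology of the sphere

module Chains {E : ℕ} where

  infixl 6 _⊕_
  _⊕_ : (Fin E → Bool) → (Fin E → Bool) → Fin E → Bool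
  (c ⊕ c') e = c e xor c' e

  only : Fin E → Fin E → Bool
  only a e = does (e ≟ a)

  pair : (Fin E → Bool) → (Fin E → Bool) → Bool
  pair c F = ⨁ λ e → c e ∧ F e

  pair-⊕ : ∀ c c' F → pair (c ⊕ c') F ≡ pair c F xor pair c' F
  pair-⊕ c c' F = trans (⨁-cong λ e → ∧-distribʳ-xor (F e) (c e) (c' e)) (∑-distrib-+ (λ e → c e ∧ F e) (λ e → c' e ∧ F e))

  pair-only : ∀ a F → pair (only a) F ≡ F a
  pair-only = ⨁-point

  pair-zero : ∀ F → pair (λ _ → false) F ≡ false
  pair-zero F = ⨁-false {E} _ λ _ → refl

vertexOf : ∀ {G} (D : Embedding G) → Dart G (nI D) → Fin (nV G)
vertexOf {G} D = dv G (nI D) (endsI D)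

module Homology {G : Graph} (D : Embedding G) where

  open Chains {nE G + nI D}

  Dt : Set
  Dt = Fin (nE G + nI D) × Bool

  at : Dt → Fin (nV G)
  at = vertexOf D

  φ φ⁻ : Dt → Dt
  φ d = σ D (opp d)
  φ⁻ d = opp (σ⁻ D d)

  opp-opp : ∀ (d : Dt) → opp (opp d) ≡ d
  opp-opp (e , b) = cong (e ,_) (not-involutive b)

  φ⁻φ : ∀ d → φ⁻ (φ d) ≡ d
  φ⁻φ d = trans (cong opp (σ⁻σ D (opp d))) (opp-opp d)

  φφ⁻ : ∀ d → φ (φ⁻ d) ≡ d
  φφ⁻ d = trans (cong (σ D) (opp-opp (σ⁻ D d))) (σσ⁻ D d)

  at-φ : ∀ d → at (φ d) ≡ at (opp d)
  at-φ d = σ-vert D (opp d)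

  φ-opp : ∀ d → φ (opp d) ≡ σ D d
  φ-opp d = cong (σ D) (opp-opp d)

  fH-φ : ∀ d → fH D (φ d) ≡ fH D d
  fH-φ d = sym (from (fH-orb D d (φ d)) (1 , refl))

  face-φ : ∀ d → face D (φ d) ≡ face D d
  face-φ d = sym (from (face-cl D d (φ d)) (sf-walk d))

  face-σ : ∀ d → face D (σ D d) ≡ face D (opp d)
  face-σ d = trans (cong (face D) (sym (φ-opp d))) (face-φ (opp d))

  face-inv : ∀ i → face D (nE G ↑ʳ i , true) ≡ face D (nE G ↑ʳ i , false)
  face-inv i = from (face-cl D _ _) (sf-inv i)

  end-at : ∀ e b → end G e b ≡ at (e ↑ˡ nI D , b)
  end-at e true  = cong (proj₁ ∘ [ ends G , endsI D ]′) (sym (splitAt-↑ˡ (nE G) e (nI D)))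
  end-at e false = cong (proj₂ ∘ [ ends G , endsI D ]′) (sym (splitAt-↑ˡ (nE G) e (nI D)))

  σ-invariant : ∀ {A : Set} (f : Dt → A) (v : Fin (nV G)) → (∀ d → at d ≡ v → f (σ D d) ≡ f d) →
                ∀ d d' → at d ≡ v → at d' ≡ v → f d ≡ f d'
  σ-invariant f v h d d' p q with σ-cyc D d d' (trans p (sym q))
  ... | j , refl = proj₁ (lem j)
    where
    lem : ∀ j → f d ≡ f (iter (σ D) j d) × at (iter (σ D) j d) ≡ v
    lem zero = refl , p
    lem (suc j) with lem j
    ... | r , s = trans r (sym (h _ s)) , trans (σ-vert D _) s

  dart-at : ∀ {w x} → x ≢ w → ∃[ d ] at d ≡ w
  dart-at {w} {x} ne with connH D w x
  ... | here = ⊥-elim (ne refl)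
  ... | step d _ = d , refl

  δV : (Fin (nV G) → Bool) → Fin (nE G + nI D) → Bool
  δV = δ (λ e → at (e , true)) (λ e → at (e , false))

  δF : (Fin (kH D) → Bool) → Fin (nE G + nI D) → Bool
  δF = δ (λ e → fH D (e , true)) (λ e → fH D (e , false))

  -- The boundary of a face is a cycle: regrouped by darts, the sum telescopes around the orbits of
  -- `φ`.
  orth : ∀ h g → ⨁ (λ e → δV h e ∧ δF g e) ≡ false
  orth h g = trans (⨁-cong term) (⨁ᴰ-boundary φ φ⁻ φ⁻φ φφ⁻ u)
    where
    u : Dt → Bool
    u d = g (fH D d) ∧ h (at d)
    term : ∀ e → δV h e ∧ δF g e ≡ (u (e , true) xor u (φ (e , true))) xor (u (e , false) xor u (φ (e , false)))
    term e rewrite fH-φ (e , true) | fH-φ (e , false) | at-φ (e , true) | at-φ (e , false) =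
      solve 4 (λ a b c d → (a :+ b) :* (c :+ d) := ((c :* a) :+ (c :* b)) :+ ((d :* b) :+ (d :* a))) refl
        (h (at (e , true))) (h (at (e , false))) (g (fH D (e , true))) (g (fH D (e , false)))
      where open xor-∧-Solver

  connV : ∀ h → (∀ e → δV h e ≡ false) → ∀ x y → h x ≡ h y
  connV h z x y = go (connH D x y)
    where
    eq : ∀ d → h (at d) ≡ h (at (opp d))
    eq (e , true)  = xor-false (z e)
    eq (e , false) = sym (xor-false (z e))
    go : ∀ {x y} → Reach G (nI D) (endsI D) x y → h x ≡ h y
    go here = refl
    go (step d r) = trans (eq d) (go r)

  -- Follows a walk in `H`: turning around a vertex and passing to the other end of an edge both
  -- lead to the face across an edge, where `g` has the same value.
  connF : ∀ g → (∀ e → δF g e ≡ false) → ∀ x y → g x ≡ g y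
  connF g z x y with fH-surj D x | fH-surj D y
  ... | d , refl | d' , refl = go (connH D (at d) (at d')) d d' refl refl
    where
    f : Dt → Bool
    f d = g (fH D d)
    eq : ∀ d → f d ≡ f (opp d)
    eq (e , true)  = xor-false (z e)
    eq (e , false) = sym (xor-false (z e))
    σ-eq : ∀ d → f (σ D d) ≡ f d
    σ-eq d = trans (cong f (sym (φ-opp d))) (trans (cong g (fH-φ (opp d))) (sym (eq d)))
    go : ∀ {x y} → Reach G (nI D) (endsI D) x y → ∀ d d' → at d ≡ x → at d' ≡ y → f d ≡ f d'
    go here d d' p q = σ-invariant f _ (λ d _ → σ-eq d) d d' p q
    go (step d₀ r) d d' p q = trans (σ-invariant f _ (λ d _ → σ-eq d) d d₀ p refl) (trans (eq d₀) (go r (opp d₀) d' refl q))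

  euler' : Dt → nV G + kH D ≡ (nE G + nI D) + 2
  euler' d with euler D
  ... | inj₂ q = q
  ... | inj₁ (q , _) with subst Fin q (proj₁ d)
  ...   | ()

  module _ (d₀ : Dt) where

    -- The first homology of the sphere vanishes: a cycle of `H` bounds a set of faces. The next
    -- lemma is the same fact with vertices and faces exchanged.
    cycle-bounds : ∀ c → (∀ h → pair c (δV h) ≡ false) → ∃[ g ] (∀ e → c e ≡ δF g e)
    cycle-bounds = Exact.exact _ _ _ _ orth connV connF (at d₀) (fH D d₀) (euler' d₀)

    cocycle-bounds : ∀ c → (∀ g → pair c (δF g) ≡ false) → ∃[ h ] (∀ e → c e ≡ δV h e)
    cocycle-bounds = Exact.exact _ _ _ _ (λ g h → trans (⨁-cong λ e → ∧-comm (δF g e) (δV h e)) (orth h g))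
      connF connV (fH D d₀) (at d₀) (trans (+-comm (kH D) (nV G)) (euler' d₀))

  normalise : ∀ (a b c : Bool) → (a xor c) xor (b xor c) ≡ a xor b
  normalise = solve 3 (λ a b c → (a :+ c) :+ (b :+ c) := a :+ b) refl
    where open xor-∧-Solver

-- Path independence of the winding in the map

module Primal {G : Graph} (D : Embedding G) (Sys : System G) (κ : Fin (nF D) → System.X Sys)
  (edge<cell₁ : ∀ e b → lt (System.o₁ Sys) (System.ε Sys e) (κ (face D (e ↑ˡ nI D , b))) ≡ true)
  (edge<cell₂ : ∀ e b → lt (System.o₂ Sys) (System.ε Sys e) (κ (face D (e ↑ˡ nI D , b))) ≡ true)
  (edge<cell₃ : ∀ e b → lt (System.o₃ Sys) (System.ε Sys e) (κ (face D (e ↑ˡ nI D , b))) ≡ true)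
  (cell<node : ∀ w d → (∀ d' → face D d' ≡ face D d → vertexOf D d' ≢ w) →
     lt (System.o₁ Sys) (κ (face D d)) (System.ν Sys w) ≡ true ⊎
     lt (System.o₂ Sys) (κ (face D d)) (System.ν Sys w) ≡ true ⊎
     lt (System.o₃ Sys) (κ (face D d)) (System.ν Sys w) ≡ true)
  where

  open Chains {nE G + nI D}
  open Homology D
  open Paths G
  open System Sys
  open Star Sys
  open Cells Sys (nI D) φ φ⁻ φ⁻φ φφ⁻ at (face D) κ at-φ face-φ end-at
         edge<cell₁ edge<cell₂ edge<cell₃ cell<node (λ i → inj₁ (face-inv i))

  chain : ∀ {S x y} → Path S x y → Fin (nE G + nI D) → Bool
  chain (nil _) = λ _ → false
  chain (cons e _ _ _ p) = only (e ↑ˡ nI D) ⊕ chain p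

  pair-chain : ∀ F {S x y} (p : Path S x y) → pair (chain p) F ≡ psum (λ e → F (e ↑ˡ nI D)) p
  pair-chain F (nil _) = pair-zero F
  pair-chain F (cons e _ _ _ p) = trans (pair-⊕ (only (e ↑ˡ nI D)) (chain p) F)
    (cong₂ _xor_ (pair-only (e ↑ˡ nI D) F) (pair-chain F p))

  psum-δV : ∀ h {S x y} (p : Path S x y) → psum (λ e → δV h (e ↑ˡ nI D)) p ≡ h x xor h y
  psum-δV h (nil {x} _) = sym (xor-same (h x))
  psum-δV h {y = y} (cons e b refl _ p) = begin
      δV h (e ↑ˡ nI D) xor psum (λ e → δV h (e ↑ˡ nI D)) p
    ≡⟨ cong₂ _xor_ (flp b) (psum-δV h p) ⟩
      (h (end G e b) xor h (end G e (not b))) xor (h (end G e (not b)) xor h y)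
    ≡⟨ solve 3 (λ a b c → (a :+ b) :+ (b :+ c) := a :+ c) refl (h (end G e b)) (h (end G e (not b))) (h y) ⟩
      h (end G e b) xor h y ∎
    where
    open ≡-Reasoning
    open xor-∧-Solver
    flp : ∀ b → δV h (e ↑ˡ nI D) ≡ h (end G e b) xor h (end G e (not b))
    flp true  = cong₂ (λ x y → h x xor h y) (sym (end-at e true)) (sym (end-at e false))
    flp false = trans (flp true) (xor-comm (h (end G e true)) _)

  psum-cong : ∀ {K K'} → (∀ e → K e ≡ K' e) → ∀ {S x y} (p : Path S x y) → psum K p ≡ psum K' p
  psum-cong h (nil _) = refl
  psum-cong h (cons e _ _ _ p) = cong₂ _xor_ (h e) (psum-cong h p)

  chain-off : ∀ {S x y} (p : Path S x y) e b → S (at (e , b)) ≡ false → chain p e ≡ false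
  chain-off (nil _) e b h = refl
  chain-off {S} (cons f c refl s p) e b h rewrite chain-off p e b h =
    trans (xor-identityʳ _) (dec-false (e ≟ (f ↑ˡ nI D)) λ { refl → true≢false (inn b c s (start∈ p)) (trans (cong S (end-at f b)) h) })
    where
    inn : ∀ b c → S (end G f c) ≡ true → S (end G f (not c)) ≡ true → S (end G f b) ≡ true
    inn true  true  s t = s
    inn true  false s t = t
    inn false true  s t = t
    inn false false s t = s

  chain-inv : ∀ {S x y} (p : Path S x y) i → chain p (nE G ↑ʳ i) ≡ false
  chain-inv (nil _) i = refl
  chain-inv (cons f c _ s p) i rewrite chain-inv p i =
    trans (xor-identityʳ _) (dec-false ((nE G ↑ʳ i) ≟ (f ↑ˡ nI D)) λ q →
      case trans (sym (splitAt-↑ʳ (nE G) (nI D) i)) (trans (cong (splitAt (nE G)) q) (splitAt-↑ˡ (nE G) f (nI D))) of λ ())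

  winding : ∀ w {x y} (p q : Path (avoid w) x y) → psum (arch o₂ w) p ≡ psum (arch o₂ w) q
  winding w {x} {y} p q with dart-at {w} {x} (≢-avoid (start∈ p))
  ... | dw , atw = xor-false (begin
      psum (arch o₂ w) p xor psum (arch o₂ w) q
    ≡⟨ cong₂ _xor_ (psum-cong (λ e → sym (archᴴ-visible w e)) p) (psum-cong (λ e → sym (archᴴ-visible w e)) q) ⟩
      psum (λ e → archᴴ w (e ↑ˡ nI D)) p xor psum (λ e → archᴴ w (e ↑ˡ nI D)) q
    ≡⟨ cong₂ _xor_ (pair-chain (archᴴ w) p) (pair-chain (archᴴ w) q) ⟨
      pair (chain p) (archᴴ w) xor pair (chain q) (archᴴ w)
    ≡⟨ pair-⊕ (chain p) (chain q) (archᴴ w) ⟨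
      pair c (archᴴ w)
    ≡⟨ ⨁-cong (λ e → cong (_∧ archᴴ w e) (cγ e)) ⟩
      ⨁ (λ e → (γ (e , true) xor γ (e , false)) ∧ archᴴ w e)
    ≡⟨ winding-zero w γ (λ d → cong (λ z → g z xor g (fH D dw)) (fH-φ d)) γ-off ⟩
      false ∎)
    where
    open ≡-Reasoning
    c : Fin (nE G + nI D) → Bool
    c = chain p ⊕ chain q
    closed : ∀ h → pair c (δV h) ≡ false
    closed h = trans (pair-⊕ (chain p) (chain q) (δV h)) (≡⇒xor
      (trans (trans (pair-chain (δV h) p) (psum-δV h p)) (sym (trans (pair-chain (δV h) q) (psum-δV h q)))))
    g = proj₁ (cycle-bounds dw c closed)
    -- Shifted by a constant so as to vanish at a dart of `w`; the boundary is unaffected.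
    γ : Dt → Bool
    γ d = g (fH D d) xor g (fH D dw)
    cγ : ∀ e → c e ≡ γ (e , true) xor γ (e , false)
    cγ e = trans (proj₂ (cycle-bounds dw c closed) e) (sym (normalise (g (fH D (e , true))) (g (fH D (e , false))) (g (fH D dw))))
    c-off : ∀ e → c e ≡ false → ∀ b → γ (e , b) ≡ γ (e , not b)
    c-off e z true  = xor-false (trans (sym (cγ e)) z)
    c-off e z false = sym (xor-false (trans (sym (cγ e)) z))
    γ-same : ∀ {d d'} → SameFace G (nI D) (σ D) d d' → γ d ≡ γ d'
    γ-same (sf-walk d) = cong (λ z → g z xor g (fH D dw)) (sym (fH-φ d))
    γ-same (sf-inv i) = c-off (nE G ↑ʳ i) (cong₂ _xor_ (chain-inv p i) (chain-inv q i)) true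
    γ-same sf-refl = refl
    γ-same (sf-sym s) = sym (γ-same s)
    γ-same (sf-trans s t) = trans (γ-same s) (γ-same t)
    γ-σ : ∀ d → at d ≡ w → γ (σ D d) ≡ γ d
    γ-σ d@(e , b) z = trans (cong γ (sym (φ-opp d))) (trans (cong (λ z → g z xor g (fH D dw)) (fH-φ (opp d)))
      (sym (c-off e (cong₂ _xor_ (chain-off p e b out) (chain-off q e b out)) b)))
      where
      out : avoid w (at (e , b)) ≡ false
      out = cong not (dec-true (at d ≟ w) z)
    -- A dart at `w` on the face of `d` would carry the value `false` from `dw` around `w` and then
    -- along that face to `d`.
    γ-off : ∀ d → γ d ≡ true → Off w d
    γ-off d t d' fc z = true≢false t (trans (sym (γ-same (to (face-cl D d' d) fc)))
      (trans (σ-invariant γ w γ-σ d' dw z atw) (xor-same (g (fH D dw)))))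

-- Path independence of the winding in the dual map

module Dual (M : PlanarMap) (Sys : System (dualGraph M)) (κ : Fin (nV (graph M)) → System.X Sys)
  (edge<cell₁ : ∀ e b → lt (System.o₁ Sys) (System.ε Sys e) (κ (vertexOf (drawing M) (e ↑ˡ nI (drawing M) , b))) ≡ true)
  (edge<cell₂ : ∀ e b → lt (System.o₂ Sys) (System.ε Sys e) (κ (vertexOf (drawing M) (e ↑ˡ nI (drawing M) , b))) ≡ true)
  (edge<cell₃ : ∀ e b → lt (System.o₃ Sys) (System.ε Sys e) (κ (vertexOf (drawing M) (e ↑ˡ nI (drawing M) , b))) ≡ true)
  (cell<node : ∀ w d → (∀ d' → vertexOf (drawing M) d' ≡ vertexOf (drawing M) d → face (drawing M) d' ≢ w) →
     lt (System.o₁ Sys) (κ (vertexOf (drawing M) d)) (System.ν Sys w) ≡ true ⊎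
     lt (System.o₂ Sys) (κ (vertexOf (drawing M) d)) (System.ν Sys w) ≡ true ⊎
     lt (System.o₃ Sys) (κ (vertexOf (drawing M) d)) (System.ν Sys w) ≡ true)
  where

  private
    G = graph M
    D = drawing M

  open Chains {nE G + nI D}
  open Homology D
  open Paths (dualGraph M)
  open System Sys
  open Star Sys

  side-face : ∀ e b → end (dualGraph M) e b ≡ face D (e ↑ˡ nI D , b)
  side-face e true  = refl
  side-face e false = refl

  open Cells Sys (nI D) (σ D) (σ⁻ D) (σ⁻σ D) (σσ⁻ D) (face D) at κ face-σ (σ-vert D) side-face
         edge<cell₁ edge<cell₂ edge<cell₃ cell<node (λ i → inj₂ (face-inv i))

  -- Two darts of the same face of G are joined, in the dual of H, by crossing invisible edges only.
  record Lift (a : Fin (nF D)) (K : Bool) (d d' : Dt) : Set where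
    field
      c     : Fin (nE G + nI D) → Bool
      bound : ∀ g → pair c (δF g) ≡ g (fH D d) xor g (fH D d')
      value : pair c (archᴴ a) ≡ K
      off   : ∀ e b → face D (e , b) ≡ a → c e ≡ false

  archᴴ-inv-zero : ∀ a i → archᴴ a (nE G ↑ʳ i) ≡ false
  archᴴ-inv-zero a i = trans (archᴴ-invisible a i)
    (≡⇒xor (cong (level a (at (nE G ↑ʳ i , true))) (face-inv i)))

  lift-∙ : ∀ {a K L d d' d''} → Lift a K d d' → Lift a L d' d'' → Lift a (K xor L) d d''
  lift-∙ {a} {d = d} {d'} {d''} l m = record
    { c     = Lift.c l ⊕ Lift.c m
    ; bound = λ g → trans (pair-⊕ (Lift.c l) (Lift.c m) (δF g)) (trans (cong₂ _xor_ (Lift.bound l g) (Lift.bound m g))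
                (solve 3 (λ a b c → (a :+ b) :+ (b :+ c) := a :+ c) refl (g (fH D d)) (g (fH D d')) (g (fH D d''))))
    ; value = trans (pair-⊕ (Lift.c l) (Lift.c m) (archᴴ a)) (cong₂ _xor_ (Lift.value l) (Lift.value m))
    ; off   = λ e b h → cong₂ _xor_ (Lift.off l e b h) (Lift.off m e b h)
    }
    where open xor-∧-Solver

  lift-sym : ∀ {a K d d'} → Lift a K d d' → Lift a K d' d
  lift-sym {d = d} l = record
    { c = Lift.c l ; bound = λ g → trans (Lift.bound l g) (xor-comm (g (fH D d)) _) ; value = Lift.value l ; off = Lift.off l }

  lift-edge : ∀ {a} e b → face D (e , b) ≢ a → face D (e , not b) ≢ a → Lift a (archᴴ a e) (e , b) (e , not b)
  lift-edge {a} e b n m = record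
    { c = only e
    ; bound = λ g → trans (pair-only e (δF g)) (flp g b)
    ; value = pair-only e (archᴴ a)
    ; off = λ e' b' h → dec-false (e' ≟ e) λ { refl → both b b' h n m } }
    where
    flp : ∀ g b → δF g e ≡ g (fH D (e , b)) xor g (fH D (e , not b))
    flp g true  = refl
    flp g false = xor-comm (g (fH D (e , true))) _
    both : ∀ b b' → face D (e , b') ≡ a → face D (e , b) ≢ a → face D (e , not b) ≢ a → ⊥
    both true  true  h n m = n h
    both true  false h n m = m h
    both false true  h n m = m h
    both false false h n m = n h

  lift-refl : ∀ {a d d'} → fH D d ≡ fH D d' → Lift a false d d'
  lift-refl {a} q = record { c = λ _ → false ; bound = λ g → trans (pair-zero (δF g)) (sym (≡⇒xor (cong g q)))
                       ; value = pair-zero (archᴴ a) ; off = λ _ _ _ → refl }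

  lift-face : ∀ {a d d'} → SameFace G (nI D) (σ D) d d' → face D d ≢ a → Lift a false d d'
  lift-face (sf-walk d) n = lift-refl (sym (fH-φ d))
  lift-face {a} (sf-inv i) n = subst (λ K → Lift a K _ _) (archᴴ-inv-zero a i)
    (lift-edge (nE G ↑ʳ i) true n (n ∘ trans (face-inv i)))
  lift-face sf-refl n = lift-refl refl
  lift-face (sf-sym s) n = lift-sym (lift-face s (n ∘ trans (sym (from (face-cl D _ _) s))))
  lift-face (sf-trans s t) n = lift-∙ (lift-face s n) (lift-face t (n ∘ trans (from (face-cl D _ _) s)))

  -- Each step of the dual walk crosses a visible edge, but may arrive in another face of `H` than
  -- the next step leaves from; `lift-face` joins the two inside one face of the graph without
  -- changing the arch sum.
  lift-path : ∀ {a x y} (p : Path (avoid a) x y) d d' → face D d ≡ x → face D d' ≡ y →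
              Lift a (psum (arch o₂ a) p) d d'
  lift-path (nil s) d d' f f' = lift-face (to (face-cl D d d') (trans f (sym f'))) (≢-avoid s ∘ trans (sym f))
  lift-path {a} (cons e b refl s p) d d' f f' =
    lift-∙ (lift-face (to (face-cl D d (e ↑ˡ nI D , b)) (trans f (side-face e b))) (≢-avoid s ∘ trans (sym f)))
      (lift-∙ (subst (λ K → Lift a K (e ↑ˡ nI D , b) (e ↑ˡ nI D , not b)) (archᴴ-visible a e)
                 (lift-edge (e ↑ˡ nI D) b (≢-avoid s ∘ trans (side-face e b)) (≢-avoid (start∈ p) ∘ trans (side-face e (not b)))))
        (lift-path p (e ↑ˡ nI D , not b) d' (sym (side-face e (not b))) f'))

  face-dart : ∀ {x a : Fin (nF D)} → x ≢ a → ∀ F → ∃[ d ] face D d ≡ F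
  face-dart {x} {a} ne with face-n D
  ... | inj₂ (_ , s) = s
  ... | inj₁ (_ , one) = ⊥-elim (ne (uniq one x a))
    where
    uniq : ∀ {n} → n ≡ 1 → (x y : Fin n) → x ≡ y
    uniq refl zero zero = refl

  -- A closed chain of dual edges is the coboundary of a function on vertices. The chain crosses no
  -- edge bordering `a`, so this function is constant along the boundary of `a`; normalised at a
  -- dart of `a`, it is supported on vertices off `a`.
  winding : ∀ a {x y} (p q : Path (avoid a) x y) → psum (arch o₂ a) p ≡ psum (arch o₂ a) q
  winding a {x} {y} p q with face-dart {x} {a} (≢-avoid (start∈ p))
  ... | surj with surj a | surj x | surj y
  ... | da , fa | d , fx | d' , fy = xor-false (begin
      psum (arch o₂ a) p xor psum (arch o₂ a) q
    ≡⟨ Lift.value l ⟨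
      pair c (archᴴ a)
    ≡⟨ ⨁-cong (λ e → cong (_∧ archᴴ a e) (cγ e)) ⟩
      ⨁ (λ e → (γ (e , true) xor γ (e , false)) ∧ archᴴ a e)
    ≡⟨ winding-zero a γ (λ d → cong (λ z → h z xor h (at da)) (σ-vert D d)) γ-off ⟩
      false ∎)
    where
    open ≡-Reasoning
    l : Lift a (psum (arch o₂ a) p xor psum (arch o₂ a) q) d d
    l = lift-∙ (lift-path p d d' fx fy) (lift-sym (lift-path q d d' fx fy))
    c = Lift.c l
    closed : ∀ g → pair c (δF g) ≡ false
    closed g = trans (Lift.bound l g) (xor-same (g (fH D d)))
    h = proj₁ (cocycle-bounds d c closed)
    γ : Dt → Bool
    γ d = h (at d) xor h (at da)
    cγ : ∀ e → c e ≡ γ (e , true) xor γ (e , false)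
    cγ e = trans (proj₂ (cocycle-bounds d c closed) e) (sym (normalise (h (at (e , true))) (h (at (e , false))) (h (at da))))
    γ-opp : ∀ d → face D d ≡ a → γ d ≡ γ (opp d)
    γ-opp (e , true)  z = xor-false (trans (sym (cγ e)) (Lift.off l e true z))
    γ-opp (e , false) z = sym (xor-false (trans (sym (cγ e)) (Lift.off l e false z)))
    γ-same : ∀ {d d'} → SameFace G (nI D) (σ D) d d' → face D d ≡ a → γ d ≡ γ d'
    γ-same (sf-walk d) z = trans (γ-opp d z) (cong (λ v → h v xor h (at da)) (sym (at-φ d)))
    γ-same (sf-inv i) z = γ-opp _ z
    γ-same sf-refl z = refl
    γ-same (sf-sym s) z = sym (γ-same s (trans (from (face-cl D _ _) s) z))
    γ-same (sf-trans s t) z = trans (γ-same s z) (γ-same t (trans (sym (from (face-cl D _ _) s)) z))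
    γ-off : ∀ d → γ d ≡ true → Off a d
    γ-off d t d' v z = true≢false t (trans (cong (λ v → h v xor h (at da)) (sym v))
      (trans (γ-same (to (face-cl D d' da) (trans z (sym fa))) z) (xor-same (h (at da)))))

-- Realizers

rankOrd : ∀ {X : Set} (r : X → ℕ) → Injective _≡_ _≡_ r → LinOrd X
rankOrd r inj = record
  { lt    = λ x y → does (r x <? r y)
  ; trns  = λ {x} {y} {z} p q → dec-true (r x <? r z) (<-trans (sound p) (sound q))
  ; asym  = λ {x} {y} p → dec-false (r y <? r x) (<-asym (sound p))
  ; total = λ {x} {y} ne p → dec-true (r y <? r x) (≤∧≢⇒< (≮⇒≥ (unsound p)) λ q → ne (sym (inj q)))
  }
  where
  sound : ∀ {m n} → does (m <? n) ≡ true → m < n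
  sound {m} {n} h = <ᵇ⇒< m n (subst T (sym h) tt)
  unsound : ∀ {m n} → does (m <? n) ≡ false → ¬ m < n
  unsound {m} {n} h p = true≢false (dec-true (m <? n) p) h

revOrd : ∀ {X : Set} → LinOrd X → LinOrd X
revOrd o = record
  { lt = λ x y → lt o y x ; trns = λ p q → trns o q p ; asym = asym o ; total = λ ne → total o (ne ∘ sym) }

-- Euler's formula excludes the empty graph: without vertices, edges and faces it would read 0 = 2.
some-vertex : ∀ {G} → Embedding G → Fin (nV G)
some-vertex {G} D with inhabited? (nV G) | inhabited? (nE G + nI D) | inhabited? (kH D) | euler D
  where
  inhabited? : ∀ n → Fin n ⊎ n ≡ 0
  inhabited? zero    = inj₂ refl
  inhabited? (suc n) = inj₁ zero
... | inj₁ v | _ | _ | _ = v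
... | _ | inj₁ e | _ | _ = dv G (nI D) (endsI D) (e , true)
... | _ | inj₂ z | inj₁ k | _ = ⊥-elim (¬Fin0 (subst Fin z (proj₁ (proj₁ (fH-surj D k)))))
... | inj₂ v | _ | _ | inj₁ (_ , one) = case trans (sym v) one of λ ()
... | inj₂ v | inj₂ e | inj₂ k | inj₂ q = case trans (sym (cong₂ _+_ v k)) (trans q (cong (_+ 2) e)) of λ ()

some-face : ∀ {G} (D : Embedding G) → Fin (nF D)
some-face D with face-n D
... | inj₁ (_ , one) = subst Fin (sym one) zero
... | inj₂ (pos , _) = face D (fromℕ< pos , true)

-- A shorter family is padded by repeating its last order; an empty one would place a face below a
-- vertex.
three-realizer : ∀ {M t} → t ≤ 3 → Realizer M t → Realizer M 3
three-realizer {M} {zero} _ (r , _ , real)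
  with from (real (inj₂ (inj₂ (some-face (drawing M)))) (inj₁ (some-vertex (drawing M)))) (λ ())
... | ()
three-realizer {M} {suc t} t≤3 (r , inj , real) =
  r ∘ f , (λ i → inj (f i)) , λ y z → mk⇔ (λ le i → to (real y z) le (f i))
    λ h → from (real y z) λ i → subst (λ i → r i y ≤ r i z) (proj₂ (onto i)) (h (proj₁ (onto i)))
  where
  f : Fin 3 → Fin (suc t)
  f i = fromℕ< {toℕ i ⊓ t} (s≤s (m⊓n≤n (toℕ i) t))
  onto : ∀ i → ∃[ j ] f j ≡ i
  onto i = inject≤ i t≤3 , toℕ-injective (trans (toℕ-fromℕ< _)
    (trans (cong (_⊓ t) (toℕ-inject≤ i t≤3)) (m≤n⇒m⊓n≡m (toℕ≤pred[n] i))))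

module Realized {M : PlanarMap} (R : Realizer M 3) where

  private
    G = graph M
    D = drawing M
    r = proj₁ R

  ord : Fin 3 → LinOrd (Elem M)
  ord i = rankOrd (r i) (proj₁ (proj₂ R) i)

  less : ∀ {x y} → _≤VEF_ {M} x y → x ≢ y → ∀ i → lt (ord i) x y ≡ true
  less {x} {y} le ne i = dec-true (r i x <? r i y)
    (≤∧≢⇒< (to (proj₂ (proj₂ R) x y) le i) (λ q → ne (proj₁ (proj₂ R) i q)))

  notless : ∀ {x y} → ¬ (_≤VEF_ {M} x y) →
            lt (ord zero) y x ≡ true ⊎ lt (ord (suc zero)) y x ≡ true ⊎ lt (ord (suc (suc zero))) y x ≡ true
  notless {x} {y} nle with ¬∀⟶∃¬ 3 (λ i → r i x ≤ r i y) (λ i → r i x ≤? r i y) (nle ∘ from (proj₂ (proj₂ R) x y))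
  ... | zero , n = inj₁ (dec-true (r _ y <? r _ x) (≰⇒> n))
  ... | suc zero , n = inj₂ (inj₁ (dec-true (r _ y <? r _ x) (≰⇒> n)))
  ... | suc (suc zero) , n = inj₂ (inj₂ (dec-true (r _ y <? r _ x) (≰⇒> n)))

  open Homology D

  primal : System G
  primal = record
    { X = Elem M ; ν = inj₁ ; ε = inj₂ ∘ inj₁
    ; o₁ = ord zero ; o₂ = ord (suc zero) ; o₃ = ord (suc (suc zero))
    ; below₁ = λ e b → less (le-ve _ e b refl) (λ ()) zero
    ; below₂ = λ e b → less (le-ve _ e b refl) (λ ()) (suc zero)
    ; below₃ = λ e b → less (le-ve _ e b refl) (λ ()) (suc (suc zero))
    ; above = λ v e n → notless λ { (le-ve _ _ b q) → n b q }
    ; distinct = λ v w n → notless λ { le-refl → n refl }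
    ; ν-inj = λ { refl → refl } ; ν≢ε = λ v e () }

  dual : System (dualGraph M)
  dual = record
    { X = Elem M ; ν = inj₂ ∘ inj₂ ; ε = inj₂ ∘ inj₁
    ; o₁ = revOrd (ord zero) ; o₂ = revOrd (ord (suc zero)) ; o₃ = revOrd (ord (suc (suc zero)))
    ; below₁ = λ e b → less (ef e b) (λ ()) zero
    ; below₂ = λ e b → less (ef e b) (λ ()) (suc zero)
    ; below₃ = λ e b → less (ef e b) (λ ()) (suc (suc zero))
    ; above = λ v e n → notless λ { (le-ef _ _ true q) → n true q ; (le-ef _ _ false q) → n false q }
    ; distinct = λ v w n → notless λ { le-refl → n refl }
    ; ν-inj = λ { refl → refl } ; ν≢ε = λ v e () }
    where
    ef : ∀ e b → _≤VEF_ {M} (inj₂ (inj₁ e)) (inj₂ (inj₂ (end (dualGraph M) e b)))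
    ef e true  = le-ef e _ true refl
    ef e false = le-ef e _ false refl

  off-face : ∀ w d → (∀ d' → face D d' ≡ face D d → at d' ≢ w) → ¬ _≤VEF_ {M} (inj₁ w) (inj₂ (inj₂ (face D d)))
  off-face w d off (le-vf _ _ (inj₁ (d' , q , f))) = off d' f q
  off-face w (e , _) off (le-vf _ _ (inj₂ z)) with subst Fin z e
  ... | ()

  off-vertex : ∀ F d → (∀ d' → at d' ≡ at d → face D d' ≢ F) → ¬ _≤VEF_ {M} (inj₁ (at d)) (inj₂ (inj₂ F))
  off-vertex F d off (le-vf _ _ (inj₁ (d' , q , f))) = off d' q f
  off-vertex F (e , _) off (le-vf _ _ (inj₂ z)) with subst Fin z e
  ... | ()

  ve : ∀ e b → _≤VEF_ {M} (inj₁ (at (e ↑ˡ nI D , b))) (inj₂ (inj₁ e))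
  ve e b = le-ve _ e b (end-at e b)

  open Primal D primal (inj₂ ∘ inj₂)
    (λ e b → less (le-ef e _ b refl) (λ ()) zero)
    (λ e b → less (le-ef e _ b refl) (λ ()) (suc zero))
    (λ e b → less (le-ef e _ b refl) (λ ()) (suc (suc zero)))
    (λ w d off → notless (off-face w d off))
    using () renaming (winding to primal-winding)

  open Dual M dual inj₁
    (λ e b → less (ve e b) (λ ()) zero)
    (λ e b → less (ve e b) (λ ()) (suc zero))
    (λ e b → less (ve e b) (λ ()) (suc (suc zero)))
    (λ w d off → notless (off-vertex w d off))
    using () renaming (winding to dual-winding)

  open Star.Conclude primal primal-winding public using () renaming (star to primal-star)
  open Star.Conclude dual dual-winding public using () renaming (star to dual-star)

-- Cyclic orders

Search : Set → Set₁
Search A = ∀ {P : A → Set} → (∀ x → Dec (P x)) → (f : A → ℕ) →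
           (∃[ x ] (P x × (∀ y → P y → f x ≤ f y))) ⊎ (∀ x → ¬ P x)

search-Fin : ∀ {n} → Search (Fin n)
search-Fin {zero}  P? f = inj₂ λ ()
search-Fin {suc n} P? f with P? zero | search-Fin (P? ∘ suc) (f ∘ suc)
... | no n₀ | inj₂ none = inj₂ λ { zero → n₀ ; (suc x) → none x }
... | no n₀ | inj₁ (x , p , m) = inj₁ (suc x , p , λ { zero q → ⊥-elim (n₀ q) ; (suc y) q → m y q })
... | yes p | inj₂ none = inj₁ (zero , p , λ { zero _ → ≤-refl ; (suc y) q → ⊥-elim (none y q) })
... | yes p₀ | inj₁ (x , p , m) with ≤-total (f zero) (f (suc x))
...   | inj₁ le = inj₁ (zero , p₀ , λ { zero _ → ≤-refl ; (suc y) q → ≤-trans le (m y q) })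
...   | inj₂ le = inj₁ (suc x , p , λ { zero _ → le ; (suc y) q → m y q })

search-×Bool : ∀ {A} → Search A → Search (A × Bool)
search-×Bool srch P? f with srch (λ x → P? (x , true)) (λ x → f (x , true)) | srch (λ x → P? (x , false)) (λ x → f (x , false))
... | inj₂ n₁ | inj₂ n₂ = inj₂ λ { (x , true) → n₁ x ; (x , false) → n₂ x }
... | inj₁ (x , p , m) | inj₂ n₂ = inj₁ ((x , true) , p , λ { (y , true) → m y ; (y , false) q → ⊥-elim (n₂ y q) })
... | inj₂ n₁ | inj₁ (x , p , m) = inj₁ ((x , false) , p , λ { (y , true) q → ⊥-elim (n₁ y q) ; (y , false) → m y })
... | inj₁ (x , p , m) | inj₁ (x' , p' , m') with ≤-total (f (x , true)) (f (x' , false))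
...   | inj₁ le = inj₁ ((x , true) , p , λ { (y , true) → m y ; (y , false) q → ≤-trans le (m' y q) })
...   | inj₂ le = inj₁ ((x' , false) , p' , λ { (y , true) q → ≤-trans le (m y q) ; (y , false) → m' y })

iter-+ : ∀ {A : Set} (f : A → A) i j x → iter f (i + j) x ≡ iter f i (iter f j x)
iter-+ f zero    j x = refl
iter-+ f (suc i) j x = cong f (iter-+ f i j x)

iter-shift : ∀ {A : Set} (f : A → A) j x → iter f j (f x) ≡ f (iter f j x)
iter-shift f zero    x = refl
iter-shift f (suc j) x = cong f (iter-shift f j x)

Reaches : ∀ {A : Set} → (A → A) → A → A → Set
Reaches f x y = ∃[ j ] iter f j x ≡ y

reaches-trans : ∀ {A : Set} {f : A → A} {x y z} → Reaches f x y → Reaches f y z → Reaches f x z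
reaches-trans {f = f} {x} (i , refl) (j , refl) = j + i , iter-+ f j i x

reaches-step : ∀ {A : Set} {f : A → A} {x y} → Reaches f (f x) y → Reaches f x y
reaches-step {f = f} {x} (j , q) = suc j , trans (sym (iter-shift f j x)) q

-- The permutation sending each element to the next larger key of its block and the largest to the
-- least; its orbits are the blocks. It serves as the circular order of the vertices, with one
-- block, and as the rotation of darts, with one block per vertex.
module Cyclic {A : Set} {n : ℕ} (srch : Search A) (key : A → ℕ) (key-inj : ∀ {x y} → key x ≡ key y → x ≡ y)
  (N : ℕ) (key<N : ∀ x → key x < N) (blk : A → Fin n) where

  Up : A → A → Set
  Up d x = blk x ≡ blk d × key d < key x

  data Next (d x : A) : Set where
    up   : Up d x → (∀ y → Up d y → key x ≤ key y) → Next d x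
    wrap : (∀ y → ¬ Up d y) → blk x ≡ blk d → (∀ y → blk y ≡ blk d → key x ≤ key y) → Next d x

  abstract
    next-view : ∀ d → ∃[ x ] Next d x
    next-view d with srch (λ x → blk x ≟ blk d ×-dec (key d <? key x)) key
    ... | inj₁ (x , u , m) = x , up u m
    ... | inj₂ none with srch (λ x → blk x ≟ blk d) key
    ...   | inj₁ (x , b , m) = x , wrap none b m
    ...   | inj₂ none' = ⊥-elim (none' d refl)

  next : A → A
  next d = proj₁ (next-view d)

  next-ok : ∀ d → Next d (next d)
  next-ok d = proj₂ (next-view d)

  next-blk : ∀ d → blk (next d) ≡ blk d
  next-blk d with next d | next-ok d
  ... | x | up (b , _) _ = b
  ... | x | wrap _ b _ = b

  next-unique : ∀ {d x y} → Next d x → Next d y → x ≡ y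
  next-unique (up u m) (up u' m') = key-inj (≤-antisym (m _ u') (m' _ u))
  next-unique (up u m) (wrap n _ _) = ⊥-elim (n _ u)
  next-unique (wrap n _ _) (up u _) = ⊥-elim (n _ u)
  next-unique (wrap n b m) (wrap n' b' m') = key-inj (≤-antisym (m _ b') (m' _ b))

  next-≡ : ∀ {d x} → Next d x → next d ≡ x
  next-≡ {d} v = next-unique (next-ok d) v

  next-inj : ∀ {d d'} → next d ≡ next d' → d ≡ d'
  next-inj {d} {d'} eq with next d | next d' | next-ok d | next-ok d' | eq
  ... | x | .x | up (b , k) m | up (b' , k') m' | refl with <-cmp (key d) (key d')
  ...   | tri≈ _ q _ = key-inj q
  ...   | tri< l _ _ = ⊥-elim (<⇒≱ k' (m d' (trans (sym b') b , l)))
  ...   | tri> _ _ l = ⊥-elim (<⇒≱ k (m' d (trans (sym b) b' , l)))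
  next-inj {d} {d'} eq | x | .x | up (b , k) m | wrap n b' m' | refl = ⊥-elim (<⇒≱ k (m' d (trans (sym b) b')))
  next-inj {d} {d'} eq | x | .x | wrap n b m | up (b' , k') m' | refl = ⊥-elim (<⇒≱ k' (m d' (trans (sym b') b)))
  next-inj {d} {d'} eq | x | .x | wrap n b m | wrap n' b' m' | refl =
    key-inj (≤-antisym (≮⇒≥ λ l → n' d (trans (sym b) b' , l)) (≮⇒≥ λ l → n d' (trans (sym b') b , l)))

  private
    climb : ∀ s d d' → key d' ∸ key d ≤ s → blk d' ≡ blk d → key d ≤ key d' → Reaches next d d'
    climb s d d' le b k with next d in eq | next-ok d | <-cmp (key d) (key d')
    ... | x | _ | tri≈ _ q _ = 0 , key-inj q
    ... | x | _ | tri> _ _ l = ⊥-elim (<⇒≱ l k)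
    ... | x | wrap n _ _ | tri< l _ _ = ⊥-elim (n d' (b , l))
    climb zero d d' le b k | x | up u m | tri< l _ _ = ⊥-elim (<⇒≱ l (m∸n≡0⇒m≤n (n≤0⇒n≡0 le)))
    climb (suc s) d d' le b k | x | up (bx , kx) m | tri< l _ _ =
      reaches-step (subst (λ z → Reaches next z d') (sym eq)
        (climb s x d' (≤-pred (≤-trans (∸-monoʳ-< kx (m d' (b , l))) le)) (trans b (sym bx)) (m d' (b , l))))

    to-top : ∀ s d → N ∸ key d ≤ s → ∃[ t ] (Reaches next d t × (∀ y → ¬ Up t y) × blk t ≡ blk d)
    to-top s d le with next d in eq | next-ok d
    ... | x | wrap n _ _ = d , (0 , refl) , n , refl
    to-top zero d le | x | up _ _ = ⊥-elim (<⇒≱ (key<N d) (m∸n≡0⇒m≤n (n≤0⇒n≡0 le)))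
    to-top (suc s) d le | x | up (bx , kx) m with to-top s x (≤-pred (≤-trans (∸-monoʳ-< kx (<⇒≤ (key<N x))) le))
    ... | t , r , n , b = t , reaches-step (subst (λ z → Reaches next z t) (sym eq) r) , n , trans b bx

  next-reaches : ∀ d d' → blk d ≡ blk d' → Reaches next d d'
  next-reaches d d' b with to-top _ d ≤-refl
  ... | t , r , n , bt with next t in eq | next-ok t
  ...   | x | up u _ = ⊥-elim (n _ u)
  ...   | x | wrap _ bx m = reaches-trans r (reaches-step (subst (λ z → Reaches next z d') (sym eq)
          (climb _ x d' ≤-refl (trans (sym b) (trans (sym bt) (sym bx))) (m d' (trans (sym b) (sym bt))))))

  abstract
    prev-view : ∀ d → ∃[ x ] next x ≡ d
    prev-view d with next-reaches (next d) d (next-blk d)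
    ... | zero , q = d , q
    ... | suc j , q = iter next j (next d) , q

  prev : A → A
  prev d = proj₁ (prev-view d)

  next-prev : ∀ d → next (prev d) ≡ d
  next-prev d = proj₂ (prev-view d)

  prev-next : ∀ d → prev (next d) ≡ d
  prev-next d = next-inj (next-prev (next d))

≢true : ∀ {b} → b ≢ true → b ≡ false
≢true {true}  h = ⊥-elim (h refl)
≢true {false} h = refl

module _ {n : ℕ} where

  private
    S : Set
    S = Fin n → Bool

  infixl 6 _─_ _∖_ _∪_
  _─_ : S → Fin n → S
  (K ─ u) z = K z ∧ avoid u z

  _∖_ : S → S → S
  (K ∖ B) z = K z ∧ not (B z)

  _∪_ : S → Fin n → S
  (B ∪ x) z = B z ∨ does (z ≟ x)

  ─⁺ : ∀ {K : S} {u z} → K z ≡ true → z ≢ u → (K ─ u) z ≡ true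
  ─⁺ {u = u} {z} k ne rewrite k = avoid-≢ {w = u} {z} ne

  ─⁻ : ∀ {K : S} {u z} → (K ─ u) z ≡ true → K z ≡ true × z ≢ u
  ─⁻ {K} {u} {z} h with K z
  ... | true = refl , ≢-avoid {w = u} {z} h

  ─-self : ∀ {K : S} {u} → (K ─ u) u ≡ false
  ─-self {K} {u} rewrite dec-true (u ≟ u) refl = ∧-zeroʳ (K u)

  ∖⁺ : ∀ {K B : S} {z} → K z ≡ true → B z ≡ false → (K ∖ B) z ≡ true
  ∖⁺ k b rewrite k | b = refl

  ∖⁻ : ∀ {K B : S} {z} → (K ∖ B) z ≡ true → K z ≡ true × B z ≡ false
  ∖⁻ {K} {B} {z} h with K z | B z
  ... | true | false = refl , refl

  ∪ˡ : ∀ {B : S} {x z} → B z ≡ true → (B ∪ x) z ≡ true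
  ∪ˡ b rewrite b = refl

  ∪ʳ : ∀ {B : S} {x} → (B ∪ x) x ≡ true
  ∪ʳ {B} {x} rewrite dec-true (x ≟ x) refl = ∨-zeroʳ (B x)

  ∪⁻ : ∀ {B : S} {x z} → (B ∪ x) z ≡ true → B z ≡ true ⊎ z ≡ x
  ∪⁻ {B} {x} {z} h with B z
  ... | true  = inj₁ refl
  ... | false = inj₂ (does-≡ h)

-- Noncrossing orders

split-⊆ : ∀ {A : Set} {zs} xs {ys : List A} → zs ⊆ xs ++ ys →
          ∃[ as ] ∃[ bs ] (zs ≡ as ++ bs × as ⊆ xs × bs ⊆ ys)
split-⊆ [] τ = [] , _ , refl , [] , τ
split-⊆ (x ∷ xs) (.x ∷ʳ τ) with split-⊆ xs τ
... | as , bs , eq , p , q = as , bs , eq , x ∷ʳ p , q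
split-⊆ (x ∷ xs) (refl ∷ τ) with split-⊆ xs τ
... | as , bs , refl , p , q = x ∷ as , bs , refl , refl ∷ p , q

module Order (G : Graph)
  (star : Paths.NoStar G) where

  open Paths G

  -- Crossing is a cyclic notion: rotating a crossing quadruple keeps its two chords or exchanges
  -- their roles.
  rotate : ∀ xs {ys} → NonCrossing (xs ++ ys) → NonCrossing (ys ++ xs)
  rotate xs {ys} nc τ ac bd with split-⊆ ys τ
  ... | [] , _ , refl , _ , q = nc (++⁺ q (minimum ys)) ac bd
  ... | _ ∷ [] , _ , refl , p , q = nc (++⁺ q p) bd (Adj-sym ac)
  ... | _ ∷ _ ∷ [] , _ , refl , p , q = nc (++⁺ q p) (Adj-sym ac) (Adj-sym bd)
  ... | _ ∷ _ ∷ _ ∷ [] , _ , refl , p , q = nc (++⁺ q p) (Adj-sym bd) ac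
  ... | _ ∷ _ ∷ _ ∷ _ ∷ [] , _ , refl , p , q = nc (++⁺ (minimum xs) p) ac bd

  -- `X` is empty or a single vertex shared by both orders. The only edges across join `u` to `v`,
  -- the two ends of the list, and so cross nothing.
  glue : ∀ {u v} ys X zs → NonCrossing ((u ∷ ys) ++ X) → NonCrossing (X ++ (zs ++ [ v ])) →
         (∀ {b c} → b ∷ c ∷ [] ⊆ X → ⊥) → (∀ {z} → z ∈ ys → z ≢ u) → (∀ {z} → z ∈ zs → z ≢ v) →
         (∀ {p q} → p ∈ u ∷ ys → q ∈ zs ++ [ v ] → Adj p q → p ≡ u × q ≡ v) →
         NonCrossing ((u ∷ ys) ++ (X ++ (zs ++ [ v ])))
  glue {u} {v} ys X zs ncP ncQ X1 u∉ v∉ cross τ ac bd with split-⊆ (u ∷ ys) τ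
  ... | [] , _ , refl , p , q = ncQ q ac bd
  ... | a ∷ as , _ , eq , p , q with split-⊆ X q
  ...   | bs , [] , refl , q₁ , q₂ = ncP (subst (_⊆ (u ∷ ys) ++ X) (trans (cong ((a ∷ as) ++_) (sym (++-identityʳ bs))) (sym eq)) (++⁺ p q₁)) ac bd
  ...   | bs , c ∷ cs , refl , q₁ , q₂ = cases as bs cs eq p q₁ q₂
    where
    last-two : ∀ {c d} → c ∷ d ∷ [] ⊆ zs ++ [ v ] → c ∈ zs
    last-two τ with split-⊆ zs τ
    ... | [] , _ , refl , _ , (refl ∷ ())
    ... | [] , _ , refl , _ , (_ ∷ʳ ())
    ... | _ ∷ [] , _ , refl , p , _ = to∈ p
    ... | _ ∷ _ ∷ [] , _ , refl , p , _ = to∈ p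
    tail-∈ : ∀ {x y : V} {xs ws} → x ∷ y ∷ xs ⊆ u ∷ ws → y ∈ ws
    tail-∈ (_ ∷ʳ τ) = to∈ (∷ˡ⁻ τ)
    tail-∈ (refl ∷ τ) = to∈ τ
    cases : ∀ as bs cs → _ ≡ (a ∷ as) ++ (bs ++ c ∷ cs) → a ∷ as ⊆ u ∷ ys → bs ⊆ X → c ∷ cs ⊆ zs ++ [ v ] → ⊥
    cases (_ ∷ []) [] (_ ∷ []) refl p r s = u∉ (tail-∈ p) (proj₁ (cross (there (tail-∈ p)) (to∈ (∷ˡ⁻ s)) bd))
    cases (_ ∷ []) (_ ∷ []) [] refl p r s = u∉ (tail-∈ p) (proj₁ (cross (there (tail-∈ p)) (to∈ s) bd))
    cases (_ ∷ _ ∷ []) [] [] refl p r s = u∉ (tail-∈ p) (proj₁ (cross (there (tail-∈ p)) (to∈ s) bd))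
    cases [] [] (_ ∷ _ ∷ []) refl p r s = v∉ (last-two (∷ˡ⁻ s)) (proj₂ (cross (to∈ p) (to∈ (∷ˡ⁻ s)) ac))
    cases [] (_ ∷ []) (_ ∷ []) refl p r s = v∉ (last-two s) (proj₂ (cross (to∈ p) (to∈ s) ac))
    cases [] (_ ∷ _ ∷ []) [] refl p r s = X1 r
    cases [] (_ ∷ _ ∷ _ ∷ []) _ ()
    cases [] (_ ∷ _ ∷ _ ∷ _ ∷ _) _ ()
    cases (_ ∷ []) (_ ∷ _ ∷ []) _ ()
    cases (_ ∷ []) (_ ∷ _ ∷ _ ∷ _) _ ()
    cases (_ ∷ _ ∷ []) (_ ∷ []) _ ()
    cases (_ ∷ _ ∷ []) (_ ∷ _ ∷ _) _ ()
    cases (_ ∷ _ ∷ _ ∷ []) [] _ ()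
    cases (_ ∷ _ ∷ _ ∷ []) (_ ∷ _) _ ()
    cases (_ ∷ _ ∷ _ ∷ _ ∷ _) _ _ ()

  Adj? : ∀ x y → Dec (Adj x y)
  Adj? x y = map′ (λ { (e , inj₁ (p , q)) → e , true , p , q ; (e , inj₂ (p , q)) → e , false , p , q })
                  (λ { (e , true , p , q) → e , inj₁ (p , q) ; (e , false , p , q) → e , inj₂ (p , q) })
    (any? λ e → (end G e true ≟ x ×-dec end G e false ≟ y) ⊎-dec (end G e false ≟ x ×-dec end G e true ≟ y))

  module _ (S : V → Bool) where

    private
      -- An edge not contained in `S` becomes a loop and joins nothing.
      l r : Fin (nE G) → V
      l e = end G e true
      r e = if S (end G e true) ∧ S (end G e false) then end G e false else end G e true

    class : V → V
    class = comp l r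

    private
      R : V → V → Set
      R x y = x ≡ y ⊎ Path S x y

      R-sym : ∀ {x y} → R x y → R y x
      R-sym (inj₁ refl) = inj₁ refl
      R-sym (inj₂ p) = inj₂ (reverse p)

      R-trans : ∀ {x y z} → R x y → R y z → R x z
      R-trans (inj₁ refl) q = q
      R-trans (inj₂ p) (inj₁ refl) = inj₂ p
      R-trans (inj₂ p) (inj₂ q) = inj₂ (p ⊙ q)

      R-edge : ∀ e → R (l e) (r e)
      R-edge e with S (end G e true) in p | S (end G e false) in q
      ... | true  | true  = inj₂ (single (e , true , refl , refl) p q)
      ... | true  | false = inj₁ refl
      ... | false | _     = inj₁ refl

      class-edge : ∀ e b → S (end G e b) ≡ true → S (end G e (not b)) ≡ true → class (end G e b) ≡ class (end G e (not b))
      class-edge e true p q with comp-edge l r e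
      ... | c rewrite p | q = c
      class-edge e false p q with comp-edge l r e
      ... | c rewrite p | q = sym c

      class-path : ∀ {x y} → Path S x y → class x ≡ class y
      class-path (nil _) = refl
      class-path (cons e b refl s p) = trans (class-edge e b s (start∈ p)) (class-path p)

    compt : V → V → Bool
    compt x z = S z ∧ does (class x ≟ class z)

    compt⁺ : ∀ {x z} → Path S x z → compt x z ≡ true
    compt⁺ {x} {z} p rewrite stop∈ p = dec-true (class x ≟ class z) (class-path p)

    compt⁻ : ∀ {x z} → S x ≡ true → compt x z ≡ true → Path S x z
    compt⁻ {x} {z} s h with S z in q
    ... | true with R-trans (comp-sound l r R (inj₁ refl) R-sym R-trans R-edge x)
                   (R-sym (subst (R z) (sym (does-≡ h)) (comp-sound l r R (inj₁ refl) R-sym R-trans R-edge z)))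
    ...   | inj₁ refl = nil s
    ...   | inj₂ p = p

  avoid-path : ∀ {S x z w} → Path S x z → (∀ {y} → Path S x y → y ≢ w) → Path (S ─ w) x z
  avoid-path {S} {w = w} (nil s) h = nil (─⁺ {K = S} {w} s (h (nil s)))
  avoid-path {S} {w = w} (cons e b i s p) h = cons e b i (─⁺ {K = S} {w} s (h (nil s))) (avoid-path p λ q → h (cons e b i s q))

  -- The walk is cut at its first visit to `z`; until then it stays in the component of `x` in `S`
  -- without `z`.
  first-hit : ∀ {S x z} → Path S x z → Path (compt (S ─ z) x ∪ z) x z
  first-hit {S} {x} {z} p = go p (λ ne → nil (─⁺ {K = S} {z} (start∈ p) ne))
    where
    go : ∀ {y} → Path S y z → (y ≢ z → Path (S ─ z) x y) → Path (compt (S ─ z) x ∪ z) y z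
    go (nil _) pre = nil (∪ʳ {B = compt (S ─ z) x})
    go {y} (cons e b i s q) pre with y ≟ z
    ... | yes refl = nil (∪ʳ {B = compt (S ─ z) x})
    ... | no ne = cons e b i (∪ˡ {B = compt (S ─ z) x} {z} (compt⁺ (S ─ z) (pre ne)))
                    (go q λ ne' → pre ne ⊙ single (e , b , i , refl) (stop∈ (pre ne)) (─⁺ {K = S} {z} (start∈ q) ne'))

  -- u and v can be made the two ends of an order of K if they are joined by a path outside K ...
  Out : (V → Bool) → V → V → Set
  Out K u v = ∃[ a ] (K a ≡ false × Adj u a × Path ((not ∘ K) ∪ v) a v)

  -- ... or if v is a neighbour of u that does not separate two other neighbours of u.
  Extreme : (V → Bool) → V → V → Set
  Extreme K u v = Adj u v × (∀ {x y} → Adj u x → Adj u y → x ≢ v → y ≢ v →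
    Path (K ─ u) v x → Path (K ─ u) v y → Path (K ─ u ─ v) x y)

  Members : List V → (V → Set) → Set
  Members ys P = (∀ {z} → z ∈ ys → P z) × (∀ {z} → P z → z ∈ ys)

  Order₁ : (V → Bool) → V → Set
  Order₁ K u = ∃[ ys ] (Members ys (λ z → K z ≡ true × z ≢ u) × NonCrossing (u ∷ ys))

  Order₂ : (V → Bool) → V → V → Set
  Order₂ K u v = ∃[ ys ] (Members ys (λ z → K z ≡ true × z ≢ u × z ≢ v) × NonCrossing (u ∷ ys ++ [ v ]))

  -- Otherwise `u` is the centre of a star with neighbours `x`, `y` and, as third, the first vertex
  -- of the route outside `K`, or `v` itself in the extreme case.
  separates : ∀ {K u v x y} → K u ≡ true → K v ≡ true → u ≢ v → Out K u v ⊎ Extreme K u v →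
    Adj u x → Adj u y → x ≢ v → y ≢ v → Path (K ─ u ─ x) v y → Path (K ─ u ─ y) v x → ⊥
  separates {K} {u} {v} {x} {y} ku kv u≢v (inj₁ (a , ka , ua , out)) ux uy x≢v y≢v p q =
    star {S₁ = avoid u ─ x} {S₂ = avoid u ─ y} {S₃ = K ─ u} ux uy ua
      (noU x) (noU y) (─-self {K = K} {u}) (─-self {K = avoid u} {x}) (─-self {K = avoid u} {y}) a∉
      (reverse (weaken (λ z h → proj₁ (─⁻ {K = K ─ u} {y} h)) q) ⊙ weaken (λ z h → proj₁ (─⁻ {K = K ─ u} {x} h)) p)
      (reverse (weaken (drp x) p) ⊙ weaken (outside x (kn x q) (x≢v ∘ sym)) (reverse out))
      (reverse (weaken (drp y) q) ⊙ weaken (outside y (kn y p) (y≢v ∘ sym)) (reverse out))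
    where
    noU : ∀ x → (avoid u ─ x) u ≡ false
    noU x rewrite dec-true (u ≟ u) refl = refl
    a∉ : (K ─ u) a ≡ false
    a∉ rewrite ka = refl
    drp : ∀ x z → (K ─ u ─ x) z ≡ true → (avoid u ─ x) z ≡ true
    drp x z h = ─⁺ {K = avoid u} {x} {z} (avoid-≢ {w = u} {z} (proj₂ (─⁻ {K = K} {u} (proj₁ (─⁻ {K = K ─ u} {x} h))))) (proj₂ (─⁻ {K = K ─ u} {x} h))
    kn : ∀ {S'} x → Path (K ─ u ─ S') v x → K x ≡ true
    kn {S'} x q = proj₁ (─⁻ {K = K} {u} (proj₁ (─⁻ {K = K ─ u} {S'} (stop∈ q))))
    outside : ∀ x → K x ≡ true → v ≢ x → ∀ z → ((not ∘ K) ∪ v) z ≡ true → (avoid u ─ x) z ≡ true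
    outside x kx ne z h with ∪⁻ {B = not ∘ K} {v} {z} h
    ... | inj₁ nk = ─⁺ {K = avoid u} {x} {z} (avoid-≢ {w = u} {z} λ { refl → case trans (sym nk) (cong not ku) of λ () }) λ { refl → case trans (sym nk) (cong not kx) of λ () }
    ... | inj₂ refl = ─⁺ {K = avoid u} {x} (avoid-≢ {w = u} {v} (u≢v ∘ sym)) ne
  separates {K} {u} {v} {x} {y} ku kv u≢v (inj₂ (uv , ext)) ux uy x≢v y≢v p q =
    star {S₁ = K ─ u ─ x} {S₂ = K ─ u ─ y} {S₃ = K ─ u ─ v} ux uy uv
      (noU x) (noU y) (noU v) (─-self {K = K ─ u}) (─-self {K = K ─ u}) (─-self {K = K ─ u})
      (ext ux uy x≢v y≢v (weaken (λ z h → proj₁ (─⁻ {K = K ─ u} {y} h)) q) (weaken (λ z h → proj₁ (─⁻ {K = K ─ u} {x} h)) p))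
      (reverse p) (reverse q)
    where
    noU : ∀ x → (K ─ u ─ x) u ≡ false
    noU x rewrite ─-self {K = K} {u} = refl

  All₁ All₂ : ℕ → Set
  All₁ s = ∀ K u → count K ≤ s → K u ≡ true → Order₁ K u
  All₂ s = ∀ K u v → count K ≤ s → K u ≡ true → K v ≡ true → u ≢ v → Out K u v ⊎ Extreme K u v → Order₂ K u v

  -- The order is cut at a neighbour `x` of `u`: first everything but the component of `v` behind
  -- `x`, ordered from `u` to `x`, then that component, ordered from `x` to `v`. If no such `x`
  -- exists, the component of `v` meets `u` at most through `v` and is ordered separately.
  step₂ : ∀ {s} → All₁ s → All₂ s → All₂ (suc s)
  step₂ all₁ all₂ K u v le ku kv u≢v hyp
    -- The neighbour whose removal leaves the smallest component at `v`, so that no neighbour of `u`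
    -- other than `v` remains in it.
    with search-Fin (λ x → Adj? u x ×-dec ¬? (x ≟ v) ×-dec (compt (K ─ u) v x Boolₚ.≟ true))
                    (λ x → count (compt (K ─ u ─ x) v))
  ... | inj₂ none = ys ++ zs
      , ((λ h → [ (λ h → let (a , n) = m₁ .proj₁ h in proj₁ (∖⁻ {K = K} {C} a) , n , λ { refl → true≢false cv (proj₂ (∖⁻ {K = K} {C} a)) })
                , (λ h → let (c , n) = m₂ .proj₁ h in C⊆K _ c , (λ { refl → true≢false c cu }) , n) ]′ (∈-++⁻ ys h))
        , λ {z} (k , n , m) → place z k n m (C z) refl)
      , subst (λ l → NonCrossing (u ∷ l)) (sym (++-assoc ys zs [ v ]))
          (glue ys [] zs (subst NonCrossing (sym (++-identityʳ (u ∷ ys))) nc₁) (rotate [ v ] nc₂) (λ ())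
            (proj₂ ∘ m₁ .proj₁) (proj₂ ∘ m₂ .proj₁) cross)
    where
    C = compt (K ─ u) v
    skv : (K ─ u) v ≡ true
    skv = ─⁺ {K = K} {u} kv (u≢v ∘ sym)
    cv : C v ≡ true
    cv = compt⁺ (K ─ u) (nil skv)
    cu : C u ≡ false
    cu rewrite ─-self {K = K} {u} = refl
    C⊆K : ∀ z → C z ≡ true → K z ≡ true
    C⊆K z h = proj₁ (─⁻ {K = K} {u} (stop∈ (compt⁻ (K ─ u) skv h)))
    r₁ = all₁ (K ∖ C) u (≤-pred (≤-trans (count-strict (λ z h → proj₁ (∖⁻ {K = K} {C} h)) v (≢true λ h → true≢false cv (proj₂ (∖⁻ {K = K} {C} h))) kv) le)) (∖⁺ {K = K} {C} ku cu)
    r₂ = all₁ C v (≤-pred (≤-trans (count-strict C⊆K u cu ku) le)) cv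
    ys = proj₁ r₁
    zs = proj₁ r₂
    m₁ = proj₁ (proj₂ r₁)
    m₂ = proj₁ (proj₂ r₂)
    nc₁ = proj₂ (proj₂ r₁)
    nc₂ = proj₂ (proj₂ r₂)
    place : ∀ z → K z ≡ true → z ≢ u → z ≢ v → ∀ b → C z ≡ b → z ∈ ys ++ zs
    place z k n m true  c = ∈-++⁺ʳ ys (m₂ .proj₂ (c , m))
    place z k n m false c = ∈-++⁺ˡ (m₁ .proj₂ (∖⁺ {K = K} {C} k c , n))
    inA : ∀ {p} → p ∈ u ∷ ys → K p ≡ true × C p ≡ false
    inA (here refl) = ku , cu
    inA (there h) = ∖⁻ {K = K} {C} (proj₁ (m₁ .proj₁ h))
    inC : ∀ {q} → q ∈ zs ++ [ v ] → C q ≡ true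
    inC h with ∈-++⁻ zs h
    ... | inj₁ h = proj₁ (m₂ .proj₁ h)
    ... | inj₂ (here refl) = cv
    cross : ∀ {p q} → p ∈ u ∷ ys → q ∈ zs ++ [ v ] → Adj p q → p ≡ u × q ≡ v
    cross {p} {q} hp hq pq with p ≟ u
    ... | no ne = ⊥-elim (true≢false (compt⁺ (K ─ u) (c ⊙ single (Adj-sym pq) (stop∈ c) (─⁺ {K = K} {u} (proj₁ (inA hp)) ne))) (proj₂ (inA hp)))
      where c = compt⁻ (K ─ u) skv (inC hq)
    ... | yes refl with q ≟ v
    ...   | yes refl = refl , refl
    ...   | no ne = ⊥-elim (none q (pq , ne , inC hq))
  ... | inj₁ (x , (ux , x≢v , cx) , least) = ys ++ x ∷ zs
      , ((λ h → [ (λ h → let (a , n , m) = m₁ .proj₁ h in proj₁ (∖⁻ {K = K} {B} a) , n , λ { refl → true≢false bv (proj₂ (∖⁻ {K = K} {B} a)) })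
                , (λ { (here refl) → kx , x≢u , x≢v
                     ; (there h) → let (b , n , m) = m₂ .proj₁ h in Bx⊆K _ b , (λ { refl → true≢false b bxu }) , m }) ]′ (∈-++⁻ ys h))
        , λ {z} (k , n , m) → place z k n m)
      , subst (λ l → NonCrossing (u ∷ l)) (sym (++-assoc ys (x ∷ zs) [ v ]))
          (glue ys [ x ] zs nc₁ nc₂ (λ { (_ ∷ʳ ()) ; (refl ∷ ()) })
            (proj₁ ∘ proj₂ ∘ m₁ .proj₁) (proj₂ ∘ proj₂ ∘ m₂ .proj₁) cross)
    where
    skv : (K ─ u) v ≡ true
    skv = ─⁺ {K = K} {u} kv (u≢v ∘ sym)
    B = compt (K ─ u ─ x) v
    sxv : (K ─ u ─ x) v ≡ true
    sxv = ─⁺ {K = K ─ u} {x} skv (x≢v ∘ sym)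
    vx : Path (K ─ u) v x
    vx = compt⁻ (K ─ u) skv cx
    kx : K x ≡ true
    kx = proj₁ (─⁻ {K = K} {u} (stop∈ vx))
    x≢u : x ≢ u
    x≢u = proj₂ (─⁻ {K = K} {u} (stop∈ vx))
    bv : B v ≡ true
    bv = compt⁺ (K ─ u ─ x) (nil sxv)
    B⊆ : ∀ z → B z ≡ true → K z ≡ true × z ≢ u × z ≢ x
    B⊆ z h with ─⁻ {K = K ─ u} {x} (stop∈ (compt⁻ (K ─ u ─ x) sxv h))
    ... | h' , n = proj₁ (─⁻ {K = K} {u} h') , proj₂ (─⁻ {K = K} {u} h') , n
    bu : B u ≡ false
    bu = ≢true λ h → proj₁ (proj₂ (B⊆ u h)) refl
    bx : B x ≡ false
    bx = ≢true λ h → proj₂ (proj₂ (B⊆ x h)) refl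
    bxu : (B ∪ x) u ≡ false
    bxu = ≢true λ h → [ (λ b → true≢false b bu) , (λ q → x≢u (sym q)) ]′ (∪⁻ {B = B} {x} {u} h)
    Bx⊆K : ∀ z → (B ∪ x) z ≡ true → K z ≡ true
    Bx⊆K z h with ∪⁻ {B = B} {x} {z} h
    ... | inj₁ b = proj₁ (B⊆ z b)
    ... | inj₂ refl = kx
    A = K ∖ B
    av : A v ≡ false
    av = ≢true λ h → true≢false bv (proj₂ (∖⁻ {K = K} {B} h))
    notK⇒ : ∀ {T : V → Bool} → (∀ z → T z ≡ true → K z ≡ true) → ∀ w z → T v ≡ false ⊎ w ≡ v → ((not ∘ K) ∪ v) z ≡ true → ((not ∘ T) ∪ w) z ≡ true
    notK⇒ {T} sub w z tv h with ∪⁻ {B = not ∘ K} {v} {z} h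
    ... | inj₁ nk = ∪ˡ {B = not ∘ T} {w} {z} (cong not (≢true λ t → true≢false (sub z t) (not-injective nk)))
    notK⇒ {T} sub w z (inj₁ tv) h | inj₂ refl = ∪ˡ {B = not ∘ T} {w} {v} (cong not tv)
    notK⇒ {T} sub w z (inj₂ refl) h | inj₂ refl = ∪ʳ {B = not ∘ T} {v}
    A⊆K : ∀ z → A z ≡ true → K z ≡ true
    A⊆K z h = proj₁ (∖⁻ {K = K} {B} h)
    v→x : Path ((not ∘ A) ∪ x) v x
    v→x = weaken (λ z h → [ (λ b → ∪ˡ {B = not ∘ A} {x} {z} (cong not (≢true λ a → true≢false b (proj₂ (∖⁻ {K = K} {B} a)))))
                          , (λ { refl → ∪ʳ {B = not ∘ A} {x} }) ]′ (∪⁻ {B = B} {x} {z} h)) (first-hit vx)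
    -- Outside `A`, the old outside route reaches `v` (or starts there) and continues through `B` to
    -- `x`.
    outA : Out K u v ⊎ Extreme K u v → Out A u x
    outA (inj₁ (a , ka , ua , p)) = a , ≢true (λ h → true≢false (A⊆K a h) ka) , ua , weaken (λ z → notK⇒ A⊆K x z (inj₁ av)) p ⊙ v→x
    outA (inj₂ (uv , _)) = v , av , uv , v→x
    -- The route outside `B` and `x` starts at `u` itself and then follows the hypothesis to `v`.
    outB : Out K u v ⊎ Extreme K u v → Out (B ∪ x) x v
    outB h = u , bxu , Adj-sym ux , go h
      where
      u∉ : ((not ∘ (B ∪ x)) ∪ v) u ≡ true
      u∉ = ∪ˡ {B = not ∘ (B ∪ x)} {v} {u} (cong not bxu)
      go : Out K u v ⊎ Extreme K u v → Path ((not ∘ (B ∪ x)) ∪ v) u v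
      go (inj₁ (a , ka , ua , p)) = single ua u∉ (start∈ p') ⊙ p'
        where
        p' : Path ((not ∘ (B ∪ x)) ∪ v) a v
        p' = weaken (λ z → notK⇒ Bx⊆K v z (inj₂ refl)) p
      go (inj₂ (uv , _)) = single uv u∉ (∪ʳ {B = not ∘ (B ∪ x)} {v})
    r₁ = all₂ A u x (≤-pred (≤-trans (count-strict A⊆K v av kv) le)) (∖⁺ {K = K} {B} ku bu) (∖⁺ {K = K} {B} kx bx) (x≢u ∘ sym) (inj₁ (outA hyp))
    r₂ = all₂ (B ∪ x) x v (≤-pred (≤-trans (count-strict Bx⊆K u bxu ku) le)) (∪ʳ {B = B} {x}) (∪ˡ {B = B} {x} {v} bv) x≢v (inj₁ (outB hyp))
    ys = proj₁ r₁
    zs = proj₁ r₂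
    m₁ = proj₁ (proj₂ r₁)
    m₂ = proj₁ (proj₂ r₂)
    nc₁ = proj₂ (proj₂ r₁)
    nc₂ = proj₂ (proj₂ r₂)
    place : ∀ z → K z ≡ true → z ≢ u → z ≢ v → z ∈ ys ++ x ∷ zs
    place z k n m = go (z ≟ x) (B z) refl
      where
      go : Dec (z ≡ x) → ∀ b → B z ≡ b → z ∈ ys ++ x ∷ zs
      go (yes refl) _     _ = ∈-++⁺ʳ ys (here refl)
      go (no ne)    true  b = ∈-++⁺ʳ ys (there (m₂ .proj₂ (∪ˡ {B = B} {x} {z} b , ne , m)))
      go (no ne)    false b = ∈-++⁺ˡ (m₁ .proj₂ (∖⁺ {K = K} {B} k b , n , ne))
    inA : ∀ {p} → p ∈ u ∷ ys → K p ≡ true × B p ≡ false × p ≢ x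
    inA (here refl) = ku , bu , x≢u ∘ sym
    inA (there h) with m₁ .proj₁ h
    ... | a , _ , n = proj₁ (∖⁻ {K = K} {B} a) , proj₂ (∖⁻ {K = K} {B} a) , n
    inB : ∀ {q} → q ∈ zs ++ [ v ] → B q ≡ true
    inB h with ∈-++⁻ zs h
    ... | inj₂ (here refl) = bv
    ... | inj₁ h with m₂ .proj₁ h
    ...   | b , n , _ = [ (λ b → b) , (λ q → ⊥-elim (n q)) ]′ (∪⁻ {B = B} {x} b)
    -- A further neighbour q of u beyond x would cut x off from v, so its component at v would be smaller.
    beyond : ∀ {q} → Adj u q → q ≢ v → B q ≡ true → ⊥
    beyond {q} uq q≢v bq = <⇒≱ (count-strict smaller q (≢true λ h → proj₂ (─⁻ {K = K ─ u} {q} (stop∈ (compt⁻ (K ─ u ─ q) sqv h))) refl) bq)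
                             (least q (uq , q≢v , compt⁺ (K ─ u) (weaken (λ z h → proj₁ (─⁻ {K = K ─ u} {x} h)) vq)))
      where
      vq : Path (K ─ u ─ x) v q
      vq = compt⁻ (K ─ u ─ x) sxv bq
      sqv : (K ─ u ─ q) v ≡ true
      sqv = ─⁺ {K = K ─ u} {q} skv (q≢v ∘ sym)
      noX : ∀ {y} → Path (K ─ u ─ q) v y → y ≢ x
      noX p refl = separates ku kv u≢v hyp ux uq x≢v q≢v vq p
      smaller : ∀ z → compt (K ─ u ─ q) v z ≡ true → B z ≡ true
      smaller z h = compt⁺ (K ─ u ─ x) (weaken sub (avoid-path (compt⁻ (K ─ u ─ q) sqv h) noX))
        where
        sub : ∀ z → (K ─ u ─ q ─ x) z ≡ true → (K ─ u ─ x) z ≡ true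
        sub z h with ─⁻ {K = K ─ u ─ q} {x} h
        ... | h' , n = ─⁺ {K = K ─ u} {x} (proj₁ (─⁻ {K = K ─ u} {q} h')) n
    cross : ∀ {p q} → p ∈ u ∷ ys → q ∈ zs ++ [ v ] → Adj p q → p ≡ u × q ≡ v
    cross {p} {q} hp hq pq with p ≟ u
    ... | no ne = ⊥-elim (true≢false (compt⁺ (K ─ u ─ x) (c ⊙ single (Adj-sym pq) (stop∈ c)
                    (─⁺ {K = K ─ u} {x} (─⁺ {K = K} {u} (proj₁ (inA hp)) ne) (proj₂ (proj₂ (inA hp)))))) (proj₁ (proj₂ (inA hp))))
      where c = compt⁻ (K ─ u ─ x) sxv (inB hq)
    ... | yes refl with q ≟ v
    ...   | yes refl = refl , refl
    ...   | no ne = ⊥-elim (beyond pq ne (inB hq))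

  -- A vertex `u` without neighbours in `K` may precede any order of the rest. Otherwise an extreme
  -- neighbour of `u` exists and becomes the other end.
  step₁ : ∀ {s} → All₁ s → All₂ (suc s) → All₁ (suc s)
  step₁ all₁ all₂ K u le ku with any? (λ y → Adj? u y ×-dec ((K ─ u) y Boolₚ.≟ true))
  ... | no none with any? (λ z → (K ─ u) z Boolₚ.≟ true)
  ...   | no empty = [] , ((λ ()) , λ (k , n) → ⊥-elim (empty (_ , ─⁺ {K = K} {u} k n))) , λ { (_ ∷ʳ ()) ; (refl ∷ ()) }
  ...   | yes (z , kz) = z ∷ proj₁ r
      , ((λ { (here refl) → ─⁻ {K = K} {u} kz ; (there h) → ─⁻ {K = K} {u} (proj₁ (m .proj₁ h)) })
        , λ {y} (k , n) → place y (─⁺ {K = K} {u} k n))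
      , λ { (_ ∷ʳ τ) → nc τ ; (refl ∷ τ) ac _ → none (_ , ac , inK (to∈ (∷ˡ⁻ τ))) }
    where
    r = all₁ (K ─ u) z (≤-pred (≤-trans (count-strict (λ z h → proj₁ (─⁻ {K = K} {u} h)) u (─-self {K = K}) ku) le)) kz
    m = proj₁ (proj₂ r)
    nc = proj₂ (proj₂ r)
    place : ∀ y → (K ─ u) y ≡ true → y ∈ z ∷ proj₁ r
    place y k with y ≟ z
    ... | yes refl = here refl
    ... | no ne = there (m .proj₂ (k , ne))
    inK : ∀ {y} → y ∈ z ∷ proj₁ r → (K ─ u) y ≡ true
    inK (here refl) = kz
    inK (there h) = proj₁ (m .proj₁ h)
  step₁ all₁ all₂ K u le ku | yes (y , uy , ky) = finish choice
    where
    finish : (∃[ v ] ((K ─ u) v ≡ true × Extreme K u v)) → Order₁ K u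
    finish (v , kv , ext) with all₂ K u v le ku (proj₁ (─⁻ {K = K} {u} kv)) (proj₂ (─⁻ {K = K} {u} kv) ∘ sym) (inj₂ ext)
    ... | ys , (m , m') , nc = ys ++ [ v ]
      , ((λ h → [ (λ h → let (k , n , _) = m h in k , n) , (λ { (here refl) → ─⁻ {K = K} {u} kv }) ]′ (∈-++⁻ ys h))
        , λ {z} (k , n) → place z k n)
      , nc
      where
      place : ∀ z → K z ≡ true → z ≢ u → z ∈ ys ++ [ v ]
      place z k n with z ≟ v
      ... | yes refl = ∈-++⁺ʳ ys (here refl)
      ... | no ne = ∈-++⁺ˡ (m' (k , n , ne))
    Cand : V → Set
    Cand v = Adj u v × v ≢ y × compt (K ─ u) y v ≡ true
    Cand? : ∀ v → Dec (Cand v)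
    Cand? v = Adj? u v ×-dec ¬? (v ≟ y) ×-dec (compt (K ─ u) y v Boolₚ.≟ true)
    choice : ∃[ v ] ((K ─ u) v ≡ true × Extreme K u v)
    -- Minimising the complement maximises the component of `y` that survives the removal of `v`. If
    -- this `v` cut another neighbour `x` off from `y`, removing `x` instead would leave a larger
    -- component, one that also contains `v`.
    choice with search-Fin Cand? (λ v → count (not ∘ compt (K ─ u ─ v) y))
    ... | inj₂ none = y , ky , uy , λ ux _ x≢y _ p _ → ⊥-elim (none _ (ux , x≢y , compt⁺ (K ─ u) p))
    ... | inj₁ (v , (uv , v≢y , cv) , least) = v , stop∈ yv , uv , λ ux uz x≢v z≢v p q → reverse (reach ux x≢v p) ⊙ reach uz z≢v q
      where
      yv : Path (K ─ u) y v
      yv = compt⁻ (K ─ u) ky cv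
      kvy : (K ─ u ─ v) y ≡ true
      kvy = ─⁺ {K = K ─ u} {v} ky (v≢y ∘ sym)
      reach : ∀ {x} → Adj u x → x ≢ v → Path (K ─ u) v x → Path (K ─ u ─ v) y x
      reach {x} ux x≢v p with x ≟ y | compt (K ─ u ─ v) y x in c
      ... | yes refl | _    = nil kvy
      ... | no x≢y   | true = compt⁻ (K ─ u ─ v) kvy c
      ... | no x≢y   | false = ⊥-elim (<⇒≱ (count-strict larger v (cong not vIn) (cong not vOut)) (least x (ux , x≢y , compt⁺ (K ─ u) (yv ⊙ p))))
        where
        noX : ∀ {z} → Path (K ─ u ─ v) y z → z ≢ x
        noX q refl = true≢false (compt⁺ (K ─ u ─ v) q) c
        vOut : compt (K ─ u ─ v) y v ≡ false
        vOut = ≢true λ h → proj₂ (─⁻ {K = K ─ u} {v} (stop∈ (compt⁻ (K ─ u ─ v) kvy h))) refl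
        vIn : compt (K ─ u ─ x) y v ≡ true
        vIn = compt⁺ (K ─ u ─ x) (weaken sub (first-hit yv))
          where
          sub : ∀ z → (compt (K ─ u ─ v) y ∪ v) z ≡ true → (K ─ u ─ x) z ≡ true
          sub z h with ∪⁻ {B = compt (K ─ u ─ v) y} {v} {z} h
          ... | inj₁ b = ─⁺ {K = K ─ u} {x} (proj₁ (─⁻ {K = K ─ u} {v} (stop∈ q))) (noX q)
            where q = compt⁻ (K ─ u ─ v) kvy b
          ... | inj₂ refl = ─⁺ {K = K ─ u} {x} (stop∈ yv) (x≢v ∘ sym)
        larger : ∀ z → not (compt (K ─ u ─ x) y z) ≡ true → not (compt (K ─ u ─ v) y z) ≡ true
        larger z h = cong not (≢true λ d → true≢false (compt⁺ (K ─ u ─ x) (weaken sub (avoid-path (compt⁻ (K ─ u ─ v) kvy d) noX))) (not-injective h))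
          where
          sub : ∀ z → (K ─ u ─ v ─ x) z ≡ true → (K ─ u ─ x) z ≡ true
          sub z h with ─⁻ {K = K ─ u ─ v} {x} h
          ... | h' , n = ─⁺ {K = K ─ u} {x} (proj₁ (─⁻ {K = K ─ u} {v} h')) n

  -- Induction on a bound for the size. `step₁` needs the two-ended statement at the same size,
  -- because choosing the second end does not shrink `K`.
  orders : ∀ s → All₁ s × All₂ s
  orders zero = (λ K u le ku → ⊥-elim (empty K u le ku)) , λ K u v le ku _ _ _ → ⊥-elim (empty K u le ku)
    where
    empty : ∀ K u → count K ≤ 0 → K u ≡ true → ⊥
    empty K u le ku = n≮0 (<-≤-trans (count-strict {f = λ _ → false} {g = K} (λ _ ()) u refl ku) le)
  orders (suc s) with orders s
  ... | all₁ , all₂ = step₁ all₁ (step₂ all₁ all₂) , step₂ all₁ all₂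

  outer-order : V → ∃[ xs ] ((∀ z → z ∈ xs) × NonCrossing xs)
  outer-order u with proj₁ (orders (count {nV G} (λ _ → true))) (λ _ → true) u ≤-refl refl
  ... | ys , (_ , m) , nc = u ∷ ys , all , nc
    where
    all : ∀ z → z ∈ u ∷ ys
    all z with z ≟ u
    ... | yes refl = here refl
    ... | no ne = there (m (refl , ne))

-- Drawings from noncrossing orders

-- Numbers the distinct values of `f`, so that a quotient of `Fin k` becomes some `Fin m`.
image : ∀ {k} {A : Set} → (∀ (x y : A) → Dec (x ≡ y)) → (f : Fin k → A) →
        ∃[ m ] Σ (Fin k → Fin m) λ q → (∀ x y → (q x ≡ q y) ⇔ (f x ≡ f y)) × (∀ i → ∃[ x ] q x ≡ i)
image {zero}  _≟A_ f = 0 , (λ ()) , (λ ()) , λ ()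
image {suc k} _≟A_ f with image _≟A_ (f ∘ suc) | search-Fin (λ x → f (suc x) ≟A f zero) (λ _ → 0)
... | m , q , ok , sur | inj₁ (x , fx , _) = m , q' , ok' , λ i → let (y , e) = sur i in suc y , e
  where
  q' : Fin (suc k) → Fin m
  q' zero = q x
  q' (suc y) = q y
  ok' : ∀ y z → (q' y ≡ q' z) ⇔ (f y ≡ f z)
  ok' zero zero = mk⇔ (λ _ → refl) (λ _ → refl)
  ok' zero (suc z) = mk⇔ (λ h → trans (sym fx) (to (ok x z) h)) (λ h → from (ok x z) (trans fx h))
  ok' (suc y) zero = mk⇔ (λ h → trans (to (ok y x) h) fx) (λ h → from (ok y x) (trans h (sym fx)))
  ok' (suc y) (suc z) = ok y z
... | m , q , ok , sur | inj₂ none = suc m , q' , ok' , λ { zero → zero , refl ; (suc i) → let (y , e) = sur i in suc y , cong suc e }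
  where
  q' : Fin (suc k) → Fin (suc m)
  q' zero = zero
  q' (suc y) = suc (q y)
  ok' : ∀ y z → (q' y ≡ q' z) ⇔ (f y ≡ f z)
  ok' zero zero = mk⇔ (λ _ → refl) (λ _ → refl)
  ok' zero (suc z) = mk⇔ (λ ()) (λ h → ⊥-elim (none z (sym h)))
  ok' (suc y) zero = mk⇔ (λ ()) (λ h → ⊥-elim (none y h))
  ok' (suc y) (suc z) = mk⇔ (λ h → to (ok y z) (suc-inj h)) (λ h → cong suc (from (ok y z) h))
    where
    suc-inj : ∀ {m} {i j : Fin m} → Fin.suc i ≡ suc j → i ≡ j
    suc-inj refl = refl

module _ {A : Set} {m : ℕ} (c : A → Fin m) (c-inj : ∀ {x y} → c x ≡ c y → x ≡ y)
         (f : A → A) (f-inj : ∀ {x y} → f x ≡ f y → x ≡ y) where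

  private
    iter-inj : ∀ i {x y} → iter f i x ≡ iter f i y → x ≡ y
    iter-inj zero q = q
    iter-inj (suc i) q = iter-inj i (f-inj q)

    back : ∀ x → Reaches f (f x) x
    back x with pigeonhole (n<1+n m) (λ i → c (iter f (toℕ i) x))
    ... | i , j , i<j , eq = period (toℕ j ∸ toℕ i) (m<n⇒0<n∸m i<j)
        (sym (iter-inj (toℕ i) (trans (c-inj eq) (trans (cong (λ k → iter f k x) (sym (m+[n∸m]≡n (<⇒≤ i<j)))) (iter-+ f (toℕ i) (toℕ j ∸ toℕ i) x)))))
      where
      period : ∀ k → 0 < k → iter f k x ≡ x → Reaches f (f x) x
      period (suc k) _ q = k , trans (iter-shift f k x) q

  -- By the pigeonhole principle an injection of a finite set returns to its starting point, so
  -- orbits are cycles.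
  reaches-sym : ∀ {x y} → Reaches f x y → Reaches f y x
  reaches-sym (zero , refl) = 0 , refl
  reaches-sym {x} (suc j , refl) = reaches-trans (back (iter f j x)) (reaches-sym (j , refl))

module RotationSystem (G : Graph) (nI : ℕ) (endsI : Fin nI → Fin (nV G) × Fin (nV G))
  (σ σ⁻ : Dart G nI → Dart G nI) (σ⁻σ : ∀ d → σ⁻ (σ d) ≡ d) (σσ⁻ : ∀ d → σ (σ⁻ d) ≡ d)
  (σ-vert : ∀ d → dv G nI endsI (σ d) ≡ dv G nI endsI d)
  (σ-cyc : ∀ d d' → dv G nI endsI d ≡ dv G nI endsI d' → Reaches σ d d')
  (connH : ∀ u v → Reach G nI endsI u v)
  (k : ℕ) (label : Dart G nI → Fin k)
  (label-φ : ∀ d → label (σ (flipD G nI d)) ≡ label d)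
  (label-reaches : ∀ d d' → label d ≡ label d' → Reaches (λ x → σ (flipD G nI x)) d d')
  (label-surj : ∀ i → ∃[ d ] label d ≡ i)
  (euler : nV G + k ≡ (nE G + nI) + 2) (nonempty : 0 < nE G + nI)
  where

  private
    φ : Dart G nI → Dart G nI
    φ d = σ (flipD G nI d)

    label-iter : ∀ j d → label (iter φ j d) ≡ label d
    label-iter zero d = refl
    label-iter (suc j) d = trans (label-φ (iter φ j d)) (label-iter j d)

    sideᵗ sideᶠ : Fin nI → Fin k
    sideᵗ i = label (invDart G nI i true)
    sideᶠ i = label (invDart G nI i false)

    -- Faces of the graph are faces of `H` united across every invisible edge.
    cl : Fin k → Fin k
    cl = comp sideᵗ sideᶠ

    img = image _≟_ cl
    q = proj₁ (proj₂ img)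
    q-ok = proj₁ (proj₂ (proj₂ img))
    q-sur = proj₂ (proj₂ (proj₂ img))

    SF : Dart G nI → Dart G nI → Set
    SF = SameFace G nI σ

    sf-reaches : ∀ {d d'} → Reaches φ d d' → SF d d'
    sf-reaches (zero , refl) = sf-refl
    sf-reaches {d} (suc j , refl) = sf-trans (sf-reaches (j , refl)) (sf-walk (iter φ j d))

    Rel : Fin k → Fin k → Set
    Rel x y = ∀ d d' → label d ≡ x → label d' ≡ y → SF d d'

    rel-cl : ∀ x → Rel x (cl x)
    rel-cl = comp-sound sideᵗ sideᶠ Rel
      (λ d d' p p' → sf-reaches (label-reaches d d' (trans p (sym p'))))
      (λ r d d' p p' → sf-sym (r d' d p' p))
      (λ {x} {y} {z} r s d d' p p' → let (m , h) = label-surj y in sf-trans (r d m p h) (s m d' h p'))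
      (λ i d d' p p' → sf-trans (sf-reaches (label-reaches d (invDart G nI i true) p))
        (sf-trans (sf-inv i) (sf-reaches (label-reaches (invDart G nI i false) d' (sym p')))))

    to-SF : ∀ d d' → cl (label d) ≡ cl (label d') → SF d d'
    to-SF d d' h = let (m , k) = label-surj (cl (label d)) in
      sf-trans (rel-cl (label d) d m refl k) (sf-sym (rel-cl (label d') d' m refl (trans k h)))

    from-SF : ∀ {d d'} → SF d d' → cl (label d) ≡ cl (label d')
    from-SF (sf-walk d) = cong cl (sym (label-φ d))
    from-SF (sf-inv i) = comp-edge sideᵗ sideᶠ i
    from-SF sf-refl = refl
    from-SF (sf-sym s) = sym (from-SF s)
    from-SF (sf-trans s t) = trans (from-SF s) (from-SF t)

  embedding : Embedding G
  embedding = record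
    { nI = nI ; endsI = endsI
    ; σ = σ ; σ⁻ = σ⁻ ; σ⁻σ = σ⁻σ ; σσ⁻ = σσ⁻ ; σ-vert = σ-vert ; σ-cyc = σ-cyc ; connH = connH
    ; kH = k ; fH = label
    ; fH-orb = λ d d' → mk⇔ (label-reaches d d') λ { (j , refl) → sym (label-iter j d) }
    ; fH-surj = label-surj
    ; euler = inj₂ euler
    ; nF = proj₁ img ; face = q ∘ label
    ; face-cl = λ d d' → mk⇔ (λ h → to-SF d d' (Equivalence.to (q-ok _ _) h)) (λ s → Equivalence.from (q-ok _ _) (from-SF s))
    ; face-n = inj₂ (nonempty , λ F → let (x , h) = q-sur F ; (d , k) = label-surj x in d , trans (cong q k) h)
    }

  outerplanar : ∀ i → (∀ v → ∃[ d ] (dv G nI endsI d ≡ v × label d ≡ i)) → Outerplanar G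
  outerplanar i h = embedding , q i , λ v → let (d , p , r) = h v in inj₁ (d , p , cong q r)

-- The invisible edges form a closed curve through all vertices in the order of `P`, one edge per
-- vertex. It makes `H` connected and keeps one of its sides free of arcs: a face meeting every
-- vertex.
module Circle (G : Graph) (P : Fin (nV G) → ℕ) (P-inj : ∀ {x y} → P x ≡ P y → x ≡ y)
  (NP : ℕ) (P<NP : ∀ x → P x < NP) where

  module CV = Cyclic {n = 1} search-Fin P P-inj NP P<NP (λ _ → zero)

  succ pred : Fin (nV G) → Fin (nV G)
  succ = CV.next
  pred = CV.prev

  Dt : Set
  Dt = Fin (nE G + nV G) × Bool

  endsC : Fin (nV G) → Fin (nV G) × Fin (nV G)
  endsC v = v , succ v

  vt : Dt → Fin (nV G)
  vt = dv G (nV G) endsC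

  -- The invisible edge w runs from the right end of w to the left end of the next vertex.
  Rd Ld : Fin (nV G) → Dt
  Rd w = nE G ↑ʳ w , true
  Ld w = nE G ↑ʳ w , false

  vt-R : ∀ w → vt (Rd w) ≡ w
  vt-R w = cong (proj₁ ∘ [ ends G , endsC ]′) (splitAt-↑ʳ (nE G) (nV G) w)

  vt-L : ∀ w → vt (Ld w) ≡ succ w
  vt-L w = cong (proj₂ ∘ [ ends G , endsC ]′) (splitAt-↑ʳ (nE G) (nV G) w)

  vt-vis : ∀ e b → vt (e ↑ˡ nV G , b) ≡ end G e b
  vt-vis e true  = cong (proj₁ ∘ [ ends G , endsC ]′) (splitAt-↑ˡ (nE G) e (nV G))
  vt-vis e false = cong (proj₂ ∘ [ ends G , endsC ]′) (splitAt-↑ˡ (nE G) e (nV G))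

  vis≢inv : ∀ {e : Fin (nE G)} {w : Fin (nV G)} {b c} → _≢_ {A = Dt} (e ↑ˡ nV G , b) (nE G ↑ʳ w , c)
  vis≢inv {e} {w} q = case trans (sym (splitAt-↑ˡ (nE G) e (nV G))) (trans (cong (splitAt (nE G) ∘ proj₁) q) (splitAt-↑ʳ (nE G) (nV G) w)) of λ ()

  -- `key` lists the darts from left to right along the line. The darts of a vertex form a block
  -- between its left and right end, and the arcs of visible edges are pairwise nested or disjoint.
  module Diagram (key : Dt → ℕ) (key-inj : ∀ {d d'} → key d ≡ key d' → d ≡ d') (N : ℕ) (key<N : ∀ d → key d < N)
    (block-mono : ∀ d d' → P (vt d) < P (vt d') → key d < key d')
    (L-least : ∀ w d → vt d ≡ succ w → key (Ld w) ≤ key d)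
    (R-greatest : ∀ w d → vt d ≡ w → key d ≤ key (Rd w))
    (lo : Fin (nE G) → Bool)
    (open<close : ∀ e → key (e ↑ˡ nV G , lo e) < key (e ↑ˡ nV G , not (lo e)))
    (noncross : ∀ e e' → key (e ↑ˡ nV G , lo e) < key (e' ↑ˡ nV G , lo e') → key (e' ↑ˡ nV G , lo e') < key (e ↑ˡ nV G , not (lo e)) →
                key (e ↑ˡ nV G , not (lo e)) < key (e' ↑ˡ nV G , not (lo e')) → ⊥)
    (v₀ : Fin (nV G))
    where

    Od Cd : Fin (nE G) → Dt
    Od e = e ↑ˡ nV G , lo e
    Cd e = e ↑ˡ nV G , not (lo e)

    data Kind : Dt → Set where
      kL : ∀ w → Kind (Ld w)
      kR : ∀ w → Kind (Rd w)
      kO : ∀ e → Kind (Od e)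
      kC : ∀ e → Kind (Cd e)

    kind : ∀ d → Kind d
    kind (e , b) with splitAt (nE G) e in s
    ... | inj₂ w rewrite sym (splitAt⁻¹-↑ʳ {nE G} {nV G} {e} s) with b
    ...   | true  = kR w
    ...   | false = kL w
    kind (e , b) | inj₁ e' rewrite sym (splitAt⁻¹-↑ˡ {nE G} {nV G} {e} s) with b Boolₚ.≟ lo e'
    ...   | yes refl = kO e'
    ...   | no ne rewrite ¬-not ne = kC e'

    isL : Dt → Bool
    isL (e , b) = [ (λ _ → false) , (λ _ → not b) ]′ (splitAt (nE G) e)

    isL-L : ∀ w → isL (Ld w) ≡ true
    isL-L w rewrite splitAt-↑ʳ (nE G) (nV G) w = refl
    isL-R : ∀ w → isL (Rd w) ≡ false
    isL-R w rewrite splitAt-↑ʳ (nE G) (nV G) w = refl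
    isL-vis : ∀ e b → isL (e ↑ˡ nV G , b) ≡ false
    isL-vis e b rewrite splitAt-↑ˡ (nE G) e (nV G) = refl

    L≢R : ∀ {w w'} → Ld w ≢ Rd w'
    L≢R ()

    module CD = Cyclic (search-×Bool search-Fin) key key-inj N key<N vt

    rot φ : Dt → Dt
    rot = CD.next
    φ d = rot (flipD G (nV G) d)

    φ-inj : ∀ {d d'} → φ d ≡ φ d' → d ≡ d'
    φ-inj {e , b} {e' , b'} q with CD.next-inj q
    ... | r = cong₂ _,_ (cong proj₁ r) (not-injective (cong proj₂ r))

    rot-R : ∀ w → rot (Rd w) ≡ Ld (pred w)
    rot-R w = CD.next-≡ (CD.wrap (λ y (b , k) → <⇒≱ k (R-greatest w y (trans b (vt-R w))))
                (trans (vt-L (pred w)) (trans (CV.next-prev w) (sym (vt-R w))))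
                (λ y b → L-least (pred w) y (trans b (trans (vt-R w) (sym (CV.next-prev w))))))

    module NonR {d : Dt} (d≢R : ∀ w → d ≢ Rd w) where

      private
        is-up : CD.Up d (rot d) × (∀ y → CD.Up d y → key (rot d) ≤ key y)
        is-up with rot d | CD.next-ok d
        ... | x | CD.up u m = u , m
        ... | x | CD.wrap n _ _ = ⊥-elim (n (Rd (vt d)) (vt-R (vt d) , ≤∧≢⇒< (R-greatest (vt d) d refl) λ q → d≢R _ (key-inj q)))

      rot-vt : vt (rot d) ≡ vt d
      rot-vt = proj₁ (proj₁ is-up)

      rot-> : key d < key (rot d)
      rot-> = proj₂ (proj₁ is-up)

      gap : ∀ y → key d < key y → key (rot d) ≤ key y
      gap y l with <-cmp (P (vt y)) (P (vt d))
      ... | tri< p _ _ = ⊥-elim (<⇒≱ l (<⇒≤ (block-mono y d p)))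
      ... | tri≈ _ q _ = proj₂ is-up y (P-inj q , l)
      ... | tri> _ _ p = <⇒≤ (block-mono (rot d) y (subst (λ v → P v < P (vt y)) (sym rot-vt) p))

      gap' : ∀ y → key y < key (rot d) → key y ≤ key d
      gap' y l = ≮⇒≥ λ k → <⇒≱ l (gap y k)

      rot-notL : isL (rot d) ≡ false
      rot-notL with rot d | rot-vt | rot-> | kind (rot d)
      ... | _ | v | l | kR w = isL-R w
      ... | _ | v | l | kO e = isL-vis e (lo e)
      ... | _ | v | l | kC e = isL-vis e (not (lo e))
      ... | _ | v | l | kL w = ⊥-elim (<⇒≱ l (L-least w d (trans (sym v) (vt-L w))))

    -- A dart lies on the face just before it: below the innermost arc covering that gap, or on the
    -- upper outer face (1), or, for left ends, on the lower face (0), which meets every vertex.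
    Cov : Fin (nE G) → Dt → Set
    Cov e d = key (Od e) < key d × key d ≤ key (Cd e)

    Cd-inj : ∀ {e e'} → Cd e ≡ Cd e' → e ≡ e'
    Cd-inj {e} {e'} q = ↑ˡ-injective (nV G) e e' (cong proj₁ q)

    Od-inj : ∀ {e e'} → Od e ≡ Od e' → e ≡ e'
    Od-inj {e} {e'} q = ↑ˡ-injective (nV G) e e' (cong proj₁ q)

    O≢C : ∀ {e e'} → Od e ≢ Cd e'
    O≢C {e} {e'} q with Od e | Cd e' | q | ↑ˡ-injective (nV G) e e' (cong proj₁ q)
    ... | _ | _ | _ | refl = not-¬ {lo e} refl (cong proj₂ q)

    abstract
      under : Dt → Fin (2 + nE G)
      under d with search-Fin (λ e → key (Od e) <? key d ×-dec key d ≤? key (Cd e)) (λ e → key (Cd e))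
      ... | inj₁ (e , _) = suc (suc e)
      ... | inj₂ _ = suc zero

      under-arc : ∀ {d} e → Cov e d → (∀ e' → Cov e' d → key (Cd e) ≤ key (Cd e')) → under d ≡ suc (suc e)
      under-arc {d} e c m with search-Fin (λ e → key (Od e) <? key d ×-dec key d ≤? key (Cd e)) (λ e → key (Cd e))
      ... | inj₁ (e' , c' , m') = cong (λ e → suc (suc e)) (Cd-inj (key-inj (≤-antisym (m' e c) (m e' c'))))
      ... | inj₂ none = ⊥-elim (none e c)

      under-none : ∀ {d} → (∀ e → ¬ Cov e d) → under d ≡ suc zero
      under-none {d} n with search-Fin (λ e → key (Od e) <? key d ×-dec key d ≤? key (Cd e)) (λ e → key (Cd e))
      ... | inj₁ (e' , c' , m') = ⊥-elim (n e' c')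
      ... | inj₂ none = refl

      under-cong : ∀ {d d'} → (∀ e → Cov e d → Cov e d') → (∀ e → Cov e d' → Cov e d) → under d ≡ under d'
      under-cong {d} {d'} f g with search-Fin (λ e → key (Od e) <? key d ×-dec key d ≤? key (Cd e)) (λ e → key (Cd e))
      ... | inj₁ (e , c , m) = sym (under-arc e (f e c) (λ e' c' → m e' (g e' c')))
      ... | inj₂ none = sym (under-none λ e c → none e (g e c))

      under≢0 : ∀ d → under d ≢ zero
      under≢0 d q with search-Fin (λ e → key (Od e) <? key d ×-dec key d ≤? key (Cd e)) (λ e → key (Cd e))
      under≢0 d () | inj₁ _
      under≢0 d () | inj₂ _

    label : Dt → Fin (2 + nE G)
    label d = if isL d then zero else under d

    label-L : ∀ w → label (Ld w) ≡ zero
    label-L w rewrite isL-L w = refl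

    label-notL : ∀ {d} → isL d ≡ false → label d ≡ under d
    label-notL h rewrite h = refl

    C-label : ∀ e → label (Cd e) ≡ suc (suc e)
    C-label e = trans (label-notL (isL-vis e _)) (under-arc e (open<close e , ≤-refl) λ e' c → proj₂ c)

    last-none : ∀ w → (∀ y → ¬ CV.Up w y) → ∀ e → ¬ Cov e (Rd w)
    last-none w n e (_ , le) with <-cmp (P (vt (Cd e))) (P w)
    ... | tri< p _ _ = <⇒≱ (block-mono (Cd e) (Rd w) (subst (λ v → P (vt (Cd e)) < P v) (sym (vt-R w)) p)) le
    ... | tri≈ _ q _ = vis≢inv (key-inj (≤-antisym (R-greatest w (Cd e) (P-inj q)) le))
    ... | tri> _ _ p = n _ (refl , p)

    last-label : ∀ w → (∀ y → ¬ CV.Up w y) → label (Rd w) ≡ suc zero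
    last-label w n = trans (label-notL (isL-R w)) (under-none (last-none w n))

    -- By noncrossing, the gap after the closing dart of an arc lies under the same arcs as the gap
    -- before its opening dart. The gap after an opening dart lies innermost under its own arc. From
    -- a right end to the next vertex no arc begins or ends, and past the last vertex nothing
    -- covers. Left ends run backwards along the lower face.
    label-φ : ∀ d → label (φ d) ≡ label d
    label-φ d with kind d
    ... | kL w = trans (cong label (rot-R w)) (trans (label-L (pred w)) (sym (label-L w)))
    ... | kO e = trans (label-notL rot-notL) (trans (sym (under-cong from-O to-O)) (sym (label-notL (isL-vis e _))))
      where
      open NonR {Cd e} (λ w → vis≢inv)
      from-O : ∀ e' → Cov e' (Od e) → Cov e' (rot (Cd e))
      from-O e' (l , k) = <-trans l (<-trans (open<close e) rot->) , gap (Cd e') (≤∧≢⇒< (≮⇒≥ (noncross e' e l (≤∧≢⇒< k (O≢C ∘ key-inj)))) λ q →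
        <-irrefl (cong (key ∘ Od) (Cd-inj (key-inj (sym q)))) l)
      to-O : ∀ e' → Cov e' (rot (Cd e)) → Cov e' (Od e)
      to-O e' (l , k) = ≤∧≢⇒< (≮⇒≥ λ h → noncross e e' h (≤∧≢⇒< (gap' (Od e') l) (O≢C ∘ key-inj)) (<-≤-trans rot-> k))
                          (λ q → <-irrefl (cong (key ∘ Cd) (Od-inj (key-inj (sym q)))) (<-≤-trans rot-> k))
                      , <⇒≤ (<-trans (open<close e) (<-≤-trans rot-> k))
    ... | kC e = trans (cong (λ b → label (rot (e ↑ˡ nV G , b))) (not-involutive (lo e)))
        (trans (label-notL rot-notL) (trans (under-arc e (rot-> , gap (Cd e) (open<close e)) least) (sym (C-label e))))
      where
      open NonR {Od e} (λ w → vis≢inv)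
      least : ∀ e' → Cov e' (rot (Od e)) → key (Cd e) ≤ key (Cd e')
      least e' (l , k) with <-cmp (key (Od e')) (key (Od e))
      ... | tri< p _ _ = ≮⇒≥ (noncross e' e p (<-≤-trans rot-> k))
      ... | tri≈ _ q _ = ≤-reflexive (cong (key ∘ Cd) (Od-inj (key-inj (sym q))))
      ... | tri> _ _ p = ⊥-elim (<⇒≱ p (gap' (Od e') l))
    ... | kR w = trans (label-notL rot-notL) (trans (sym (adjacent (CV.next-ok w))) (sym (label-notL (isL-R w))))
      where
      open NonR {Ld w} (λ w → L≢R)
      adjacent : CV.Next w (succ w) → under (Rd w) ≡ under (rot (Ld w))
      adjacent (CV.up (_ , up) m) = under-cong
          (λ e (l , k) → <-trans l R<q , gap (Cd e) (≤∧≢⇒< (between (Cd e) (λ q → vis≢inv q) k) λ q → vis≢inv (key-inj (sym q))))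
          (λ e (l , k) → ≰⇒> (λ h → <⇒≱ (≤∧≢⇒< (gap' (Od e) l) (λ q → vis≢inv (key-inj q))) (between (Od e) (λ q → vis≢inv q) h)) , <⇒≤ (<-≤-trans R<q k))
        where
        R<L : key (Rd w) < key (Ld w)
        R<L = block-mono _ _ (subst₂ (λ x y → P x < P y) (sym (vt-R w)) (sym (vt-L w)) up)
        R<q : key (Rd w) < key (rot (Ld w))
        R<q = <-trans R<L rot->
        between : ∀ y → y ≢ Rd w → key (Rd w) ≤ key y → key (Ld w) ≤ key y
        between y ne le with <-cmp (P (vt y)) (P w)
        ... | tri< p _ _ = ⊥-elim (<⇒≱ (block-mono y (Rd w) (subst (λ v → P (vt y) < P v) (sym (vt-R w)) p)) le)
        ... | tri≈ _ q _ = ⊥-elim (ne (key-inj (≤-antisym (R-greatest w y (P-inj q)) le)))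
        ... | tri> _ _ p with <-cmp (P (succ w)) (P (vt y))
        ...   | tri< r _ _ = <⇒≤ (block-mono (Ld w) y (subst (λ v → P v < P (vt y)) (sym (vt-L w)) r))
        ...   | tri≈ _ r _ = L-least w y (P-inj (sym r))
        ...   | tri> _ _ r = ⊥-elim (<⇒≱ r (m (vt y) (refl , p)))
      adjacent (CV.wrap n _ m) = trans (under-none (last-none w n)) (sym (under-none none))
        where
        none : ∀ e → ¬ Cov e (rot (Ld w))
        none e (l , k) with <-cmp (P (succ w)) (P (vt (Od e)))
        ... | tri< r _ _ = <⇒≱ (block-mono (Ld w) (Od e) (subst (λ v → P v < P (vt (Od e))) (sym (vt-L w)) r)) (gap' (Od e) l)
        ... | tri≈ _ r _ = vis≢inv (key-inj (≤-antisym (gap' (Od e) l) (L-least w (Od e) (P-inj (sym r)))))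
        ... | tri> _ _ r = <⇒≱ r (m (vt (Od e)) refl)

    -- The dart of largest key on each face but the lower one. A face walk increases the key until
    -- it stops there, so all darts with one label share an orbit.
    data Stop : Dt → Set where
      stop-C : ∀ e → Stop (Cd e)
      stop-R : ∀ w → (∀ y → ¬ CV.Up w y) → Stop (Rd w)

    stop-unique : ∀ {d d'} → Stop d → Stop d' → label d ≡ label d' → d ≡ d'
    stop-unique (stop-C e) (stop-C e') q with trans (sym (C-label e)) (trans q (C-label e'))
    ... | refl = refl
    stop-unique (stop-C e) (stop-R w n) q = case trans (sym (C-label e)) (trans q (last-label w n)) of λ ()
    stop-unique (stop-R w n) (stop-C e) q = case trans (sym (last-label w n)) (trans q (C-label e)) of λ ()
    stop-unique (stop-R w n) (stop-R w' n') q = cong Rd (P-inj (≤-antisym (≮⇒≥ λ l → n' w (refl , l)) (≮⇒≥ λ l → n w' (refl , l))))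

    progress : ∀ d → isL d ≡ false → Stop d ⊎ (isL (φ d) ≡ false × key d < key (φ d))
    progress d h with kind d
    ... | kL w = ⊥-elim (true≢false (isL-L w) h)
    ... | kC e = inj₁ (stop-C e)
    ... | kO e = inj₂ (rot-notL , <-trans (open<close e) rot->)
      where open NonR {Cd e} (λ w → vis≢inv)
    ... | kR w with CV.next-ok w
    ...   | CV.wrap n _ _ = inj₁ (stop-R w n)
    ...   | CV.up (_ , up) _ = inj₂ (rot-notL , <-trans (block-mono _ _ (subst₂ (λ x y → P x < P y) (sym (vt-R w)) (sym (vt-L w)) up)) rot->)
      where open NonR {Ld w} (λ w → L≢R)

    to-stop : ∀ s d → N ∸ key d ≤ s → isL d ≡ false → ∃[ t ] (Stop t × Reaches φ d t × label t ≡ label d)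
    to-stop s d le h with progress d h
    ... | inj₁ st = d , st , (0 , refl) , refl
    to-stop zero d le h | inj₂ _ = ⊥-elim (<⇒≱ (key<N d) (m∸n≡0⇒m≤n (n≤0⇒n≡0 le)))
    to-stop (suc s) d le h | inj₂ (h' , l) with to-stop s (φ d) (≤-pred (≤-trans (∸-monoʳ-< l (<⇒≤ (key<N (φ d)))) le)) h'
    ... | t , st , r , q = t , st , reaches-step r , trans q (label-φ d)

    private
      code : Dt → Fin ((nE G + nV G) * 2)
      code (e , b) = combine e (if b then suc zero else zero)

      code-inj : ∀ {d d'} → code d ≡ code d' → d ≡ d'
      code-inj {e , b} {e' , b'} q with combine-injective e (if b then suc zero else zero) e' (if b' then suc zero else zero) q
      code-inj {e , true} {e' , true} q | refl , _ = refl
      code-inj {e , false} {e' , false} q | refl , _ = refl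
      code-inj {e , true} {e' , false} q | _ , ()
      code-inj {e , false} {e' , true} q | _ , ()

      back : ∀ {d d'} → Reaches φ d d' → Reaches φ d' d
      back = reaches-sym code code-inj φ φ-inj

    L-reaches : ∀ w w' → Reaches φ (Ld w) (Ld w')
    L-reaches w w' with CV.next-reaches w' w refl
    ... | j , q = subst (λ u → Reaches φ (Ld u) (Ld w')) q (go j)
      where
      go : ∀ j → Reaches φ (Ld (iter succ j w')) (Ld w')
      go zero = 0 , refl
      go (suc j) = reaches-step (subst (λ d → Reaches φ d (Ld w'))
        (sym (trans (rot-R (succ (iter succ j w'))) (cong Ld (CV.prev-next (iter succ j w'))))) (go j))

    label-reaches : ∀ d d' → label d ≡ label d' → Reaches φ d d'
    label-reaches d d' q with isL d in p | isL d' in p'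
    ... | true | true = both d d' p p'
      where
      both : ∀ d d' → isL d ≡ true → isL d' ≡ true → Reaches φ d d'
      both d d' p p' with kind d | kind d'
      ... | kL w | kL w' = L-reaches w w'
      ... | kR w | _ = ⊥-elim (true≢false p (isL-R w))
      ... | kO e | _ = ⊥-elim (true≢false p (isL-vis e _))
      ... | kC e | _ = ⊥-elim (true≢false p (isL-vis e _))
      ... | kL _ | kR w = ⊥-elim (true≢false p' (isL-R w))
      ... | kL _ | kO e = ⊥-elim (true≢false p' (isL-vis e _))
      ... | kL _ | kC e = ⊥-elim (true≢false p' (isL-vis e _))
    ... | true | false = ⊥-elim (under≢0 d' (sym q))
    ... | false | true = ⊥-elim (under≢0 d q)
    ... | false | false with to-stop _ d ≤-refl p | to-stop _ d' ≤-refl p'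
    ...   | t , st , r , l | t' , st' , r' , l' =
      reaches-trans r (back (subst (Reaches φ d') (stop-unique st' st (trans l' (trans (label-notL p') (trans (sym q) (trans (sym (label-notL p)) (sym l)))))) r'))

    label-surj : ∀ i → ∃[ d ] label d ≡ i
    label-surj zero = Ld v₀ , label-L v₀
    label-surj (suc (suc e)) = Cd e , C-label e
    label-surj (suc zero) with search-Fin {P = λ _ → v₀ ≡ v₀} (λ w → yes refl) (λ w → NP ∸ P w)
    ... | inj₂ none = ⊥-elim (none v₀ refl)
    ... | inj₁ (w , _ , m) = Rd w , last-label w λ y (_ , l) → <⇒≱ (∸-monoʳ-< l (<⇒≤ (P<NP y))) (m y refl)

    private
      reach : ∀ u v → Reach G (nV G) endsC u v
      reach u v with CV.next-reaches u v refl
      ... | j , refl = go j u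
        where
        go : ∀ j u → Reach G (nV G) endsC u (iter succ j u)
        go zero u = here
        go (suc j) u = subst₂ (Reach G (nV G) endsC) (vt-R u) (iter-shift succ j u)
          (step (Rd u) (subst (λ x → Reach G (nV G) endsC x (iter succ j (succ u))) (sym (vt-L u)) (go j (succ u))))

      pos : ∀ {m n} → Fin n → 0 < m + n
      pos {zero}  zero    = s≤s z≤n
      pos {zero}  (suc _) = s≤s z≤n
      pos {suc m} _       = s≤s z≤n

    -- Euler's formula: there are `nE G + nV G` edges and `nE G + 2` faces, one under each arc
    -- together with the upper and the lower one. The face `zero` is the lower one.
    outerplanar : Outerplanar G
    outerplanar = RotationSystem.outerplanar G (nV G) endsC rot CD.prev CD.prev-next CD.next-prev CD.next-blk CD.next-reaches
      reach (2 + nE G) label label-φ label-reaches label-surj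
      (trans (+-comm (nV G) (2 + nE G)) (+-comm 2 (nE G + nV G))) (pos {nE G} v₀)
      zero λ v → Ld (pred v) , trans (vt-L (pred v)) (CV.next-prev v) , label-L (pred v)

-- Keys of darts, as three-digit numbers

lex-< : ∀ {B a a' b b'} → b < B → a < a' → a * B + b < a' * B + b'
lex-< {B} {a} {a'} {b} {b'} b<B a<a' = begin-strict
  a * B + b   <⟨ +-monoʳ-< (a * B) b<B ⟩
  a * B + B   ≡⟨ +-comm (a * B) B ⟩
  suc a * B   ≤⟨ *-monoˡ-≤ B a<a' ⟩
  a' * B      ≤⟨ m≤m+n (a' * B) b' ⟩
  a' * B + b' ∎
  where open ≤-Reasoning

lex-≤ : ∀ {B a a' b b'} → b < B → a * B + b ≤ a' * B + b' → b' < B → a ≤ a'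
lex-≤ {B} {a} {a'} b<B le b'<B = ≮⇒≥ λ l → <⇒≱ (lex-< b'<B l) le

lex-≡ : ∀ {B a a' b b'} → b < B → b' < B → a * B + b ≡ a' * B + b' → a ≡ a' × b ≡ b'
lex-≡ {B} {a} {a'} {b} {b'} l l' q with ≤-antisym (lex-≤ {B} {a} {a'} l (≤-reflexive q) l') (lex-≤ {B} {a'} {a} l' (≤-reflexive (sym q)) l)
... | refl = refl , +-cancelˡ-≡ (a * B) b b' q

double-inj : ∀ {a b} → 2 * a ≡ 2 * b → a ≡ b
double-inj {a} {b} = *-cancelˡ-≡ a b 2

module Keys (G : Graph) (P : Fin (nV G) → ℕ) (P-inj : ∀ {x y} → P x ≡ P y → x ≡ y)
  (NP : ℕ) (P<NP : ∀ x → P x < NP) (v₀ : Fin (nV G))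
  (nc : ∀ e e' b b' → P (end G e b) < P (end G e' b') → P (end G e' b') < P (end G e (not b)) →
        P (end G e (not b)) < P (end G e' (not b')) → ⊥) where

  open Circle G P P-inj NP P<NP

  lo : Fin (nE G) → Bool
  lo e = does (P (end G e true) ≤? P (end G e false))

  src tgt : Fin (nE G) → Fin (nV G)
  src e = end G e (lo e)
  tgt e = end G e (not (lo e))

  src≤tgt : ∀ e → P (src e) ≤ P (tgt e)
  src≤tgt e with lo e in q
  ... | true  = ≤ᵇ⇒≤ _ _ (subst T (sym q) _)
  ... | false = ≰⇒≥ λ h → true≢false (dec-true (P (end G e true) ≤? P (end G e false)) h) q

  -- Length of the arc first, edge index as tie-break, so that parallel edges are nested as well.
  rank : Fin (nE G) → ℕ
  rank e = (P (tgt e) ∸ P (src e)) * nE G + toℕ e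

  -- `Rm` exceeds every rank, and `B` exceeds every last digit, which is at most 1 + 2 * `Rm`; keys
  -- therefore compare lexicographically.
  Rm B : ℕ
  Rm = NP * nE G
  B = 2 + 2 * Rm

  rank<Rm : ∀ e → rank e < Rm
  rank<Rm e = subst (rank e <_) (+-identityʳ Rm) (lex-< (toℕ<n e) (≤-<-trans (m∸n≤m (P (tgt e)) (P (src e))) (P<NP (tgt e))))

  rank-inj : ∀ {e e'} → rank e ≡ rank e' → e ≡ e'
  rank-inj {e} {e'} q = toℕ-injective (proj₂ (lex-≡ {nE G} {P (tgt e) ∸ P (src e)} {P (tgt e') ∸ P (src e')} (toℕ<n e) (toℕ<n e') q))

  rank-span : ∀ {e e'} → rank e ≤ rank e' → P (tgt e) ∸ P (src e) ≤ P (tgt e') ∸ P (src e')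
  rank-span {e} {e'} le = lex-≤ (toℕ<n e) le (toℕ<n e')

  -- Around v, from left to right: the left end, closing darts of arcs by increasing length, opening
  -- darts by decreasing length (a loop closes immediately after it opens), and the right end.
  at : Fin (nV G) → ℕ → ℕ → ℕ
  at v c s = (P v * 4 + c) * B + s

  -- Subtraction from `Rm` reverses the order by length; the factor 2 leaves the odd values free for
  -- the closing darts of loops.
  opKey clKey : Fin (nE G) → ℕ
  opKey e = at (src e) 2 (2 * (Rm ∸ rank e))
  clKey e = if does (P (src e) ℕₚ.≟ P (tgt e)) then at (tgt e) 2 (1 + 2 * (Rm ∸ rank e)) else at (tgt e) 1 (rank e)

  visKey : Fin (nE G) → Bool → ℕ
  visKey e b = if does (b Boolₚ.≟ lo e) then opKey e else clKey e

  invKey : Fin (nV G) → Bool → ℕ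
  invKey w true  = at w 3 0
  invKey w false = at (succ w) 0 0

  key : Dt → ℕ
  key (e , b) = [ (λ e → visKey e b) , (λ w → invKey w b) ]′ (splitAt (nE G) e)

  key-inv : ∀ w b → key (nE G ↑ʳ w , b) ≡ invKey w b
  key-inv w b = cong [ (λ e → visKey e b) , (λ w → invKey w b) ]′ (splitAt-↑ʳ (nE G) (nV G) w)

  key-vis : ∀ e b → key (e ↑ˡ nV G , b) ≡ visKey e b
  key-vis e b = cong [ (λ e → visKey e b) , (λ w → invKey w b) ]′ (splitAt-↑ˡ (nE G) e (nV G))

  key-O : ∀ e → key (e ↑ˡ nV G , lo e) ≡ opKey e
  key-O e = trans (key-vis e (lo e)) (cong (λ b → if b then opKey e else clKey e) (dec-true (lo e Boolₚ.≟ lo e) refl))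

  key-C : ∀ e → key (e ↑ˡ nV G , not (lo e)) ≡ clKey e
  key-C e = trans (key-vis e (not (lo e))) (cong (λ b → if b then opKey e else clKey e) (dec-false (not (lo e) Boolₚ.≟ lo e) (λ q → not-¬ {lo e} refl (sym q))))

  key-loop : ∀ e → P (src e) ≡ P (tgt e) → key (e ↑ˡ nV G , not (lo e)) ≡ at (tgt e) 2 (1 + 2 * (Rm ∸ rank e))
  key-loop e q = trans (key-C e) (cong (λ b → if b then at (tgt e) 2 (1 + 2 * (Rm ∸ rank e)) else at (tgt e) 1 (rank e)) (dec-true (P (src e) ℕₚ.≟ P (tgt e)) q))

  key-arc : ∀ e → P (src e) ≢ P (tgt e) → key (e ↑ˡ nV G , not (lo e)) ≡ at (tgt e) 1 (rank e)
  key-arc e q = trans (key-C e) (cong (λ b → if b then at (tgt e) 2 (1 + 2 * (Rm ∸ rank e)) else at (tgt e) 1 (rank e)) (dec-false (P (src e) ℕₚ.≟ P (tgt e)) q))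

  data View : Dt → Fin (nV G) → ℕ → ℕ → Set where
    vL    : ∀ w → View (Ld w) (succ w) 0 0
    vR    : ∀ w → View (Rd w) w 3 0
    vO    : ∀ e → View (e ↑ˡ nV G , lo e) (src e) 2 (2 * (Rm ∸ rank e))
    vArc  : ∀ e → View (e ↑ˡ nV G , not (lo e)) (tgt e) 1 (rank e)
    vLoop : ∀ e → View (e ↑ˡ nV G , not (lo e)) (tgt e) 2 (1 + 2 * (Rm ∸ rank e))

  view : ∀ d → ∃[ v ] ∃[ c ] ∃[ s ] (View d v c s × key d ≡ at v c s)
  view (e , b) = go (splitAt (nE G) e) refl b
    where
    go : ∀ z → splitAt (nE G) e ≡ z → ∀ b → ∃[ v ] ∃[ c ] ∃[ s ] (View (e , b) v c s × key (e , b) ≡ at v c s)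
    go (inj₂ w) s b with splitAt⁻¹-↑ʳ {nE G} {nV G} {e} s
    go (inj₂ w) s true  | refl = _ , _ , _ , vR w , key-inv w true
    go (inj₂ w) s false | refl = _ , _ , _ , vL w , key-inv w false
    go (inj₁ e') s b with splitAt⁻¹-↑ˡ {nE G} {nV G} {e} s | b Boolₚ.≟ lo e'
    ... | refl | yes refl = _ , _ , _ , vO e' , key-O e'
    ... | refl | no ne with ¬-not ne | P (src e') ℕₚ.≟ P (tgt e')
    ...   | refl | yes q = _ , _ , _ , vLoop e' , key-loop e' q
    ...   | refl | no q  = _ , _ , _ , vArc e' , key-arc e' q

  view-vt : ∀ {d v c s} → View d v c s → vt d ≡ v
  view-vt (vL w) = vt-L w
  view-vt (vR w) = vt-R w
  view-vt (vO e) = vt-vis e (lo e)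
  view-vt (vArc e) = vt-vis e (not (lo e))
  view-vt (vLoop e) = vt-vis e (not (lo e))

  view-c : ∀ {d v c s} → View d v c s → c < 4
  view-c (vL w) = s≤s z≤n
  view-c (vR w) = s≤s (s≤s (s≤s (s≤s z≤n)))
  view-c (vO e) = s≤s (s≤s (s≤s z≤n))
  view-c (vArc e) = s≤s (s≤s z≤n)
  view-c (vLoop e) = s≤s (s≤s (s≤s z≤n))

  twice≤ : ∀ e → 2 * (Rm ∸ rank e) ≤ 2 * Rm
  twice≤ e = *-monoʳ-≤ 2 (m∸n≤m Rm (rank e))

  rank<B : ∀ e → rank e < B
  rank<B e = <-≤-trans (rank<Rm e) (≤-trans (m≤m+n Rm (Rm + 0)) (≤-trans (n≤1+n _) (n≤1+n _)))

  view-s : ∀ {d v c s} → View d v c s → s < B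
  view-s (vL w) = s≤s z≤n
  view-s (vR w) = s≤s z≤n
  view-s (vO e) = s≤s (≤-trans (twice≤ e) (n≤1+n _))
  view-s (vArc e) = rank<B e
  view-s (vLoop e) = s≤s (s≤s (twice≤ e))

  rank-of : ∀ {e e'} → Rm ∸ rank e ≡ Rm ∸ rank e' → e ≡ e'
  rank-of {e} {e'} q = rank-inj (∸-cancelˡ-≡ (<⇒≤ (rank<Rm e)) (<⇒≤ (rank<Rm e')) q)

  view-inj : ∀ {d d' v v' c c' s s'} → View d v c s → View d' v' c' s' → v ≡ v' → c ≡ c' → s ≡ s' → d ≡ d'
  view-inj (vL w) (vL w') q refl _ = cong Ld (CV.next-inj q)
  view-inj (vR w) (vR w') q refl _ = cong Rd q
  view-inj (vO e) (vO e') _ refl q with rank-of (double-inj {Rm ∸ rank e} q)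
  ... | refl = refl
  view-inj (vArc e) (vArc e') _ refl q with rank-inj q
  ... | refl = refl
  view-inj (vLoop e) (vLoop e') _ refl q with rank-of (double-inj {Rm ∸ rank e} (suc-injective q))
  ... | refl = refl
  view-inj (vO e) (vLoop e') _ refl q = ⊥-elim (even≢odd (Rm ∸ rank e) (Rm ∸ rank e') q)
  view-inj (vLoop e) (vO e') _ refl q = ⊥-elim (even≢odd (Rm ∸ rank e') (Rm ∸ rank e) (sym q))

  key-inj : ∀ {d d'} → key d ≡ key d' → d ≡ d'
  key-inj {d} {d'} q with view d | view d'
  ... | v , c , s , V , k | v' , c' , s' , V' , k' with lex-≡ (view-s V) (view-s V') (trans (sym k) (trans q k'))
  ...   | h , t with lex-≡ (view-c V) (view-c V') h
  ...     | p , r = view-inj V V' (P-inj p) r t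

  key<N : ∀ d → key d < NP * 4 * B
  key<N d with view d
  ... | v , c , s , V , k = subst₂ _<_ (sym k) (+-identityʳ (NP * 4 * B))
    (lex-< (view-s V) (subst (P v * 4 + c <_) (+-identityʳ (NP * 4)) (lex-< (view-c V) (P<NP v))))

  block-mono : ∀ d d' → P (vt d) < P (vt d') → key d < key d'
  block-mono d d' l with view d | view d'
  ... | v , c , s , V , k | v' , c' , s' , V' , k' rewrite k | k' =
    lex-< (view-s V) (lex-< (view-c V) (subst₂ (λ x y → P x < P y) (view-vt V) (view-vt V') l))

  L-least : ∀ w d → vt d ≡ succ w → key (Ld w) ≤ key d
  L-least w d q with view d
  ... | v , c , s , V , k rewrite k | key-inv w false | sym q | view-vt V =
    +-mono-≤ (*-monoˡ-≤ B (+-monoʳ-≤ (P v * 4) (z≤n {c}))) (z≤n {s})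

  R-greatest : ∀ w d → vt d ≡ w → key d ≤ key (Rd w)
  R-greatest w d q with view d
  ... | v , c , s , V , k rewrite k | key-inv w true | sym q | view-vt V = go V
    where
    low : ∀ {c s} → c < 3 → s < B → at v c s ≤ at v 3 0
    low c<3 s<B = <⇒≤ (lex-< s<B (+-monoʳ-< (P v * 4) c<3))
    go : ∀ {d c s} → View d v c s → at v c s ≤ at v 3 0
    go (vR w) = ≤-refl
    go V@(vL w) = low (s≤s z≤n) (view-s V)
    go V@(vO e) = low (s≤s (s≤s (s≤s z≤n))) (view-s V)
    go V@(vArc e) = low (s≤s (s≤s z≤n)) (view-s V)
    go V@(vLoop e) = low (s≤s (s≤s (s≤s z≤n))) (view-s V)

  loop-adjacent : ∀ e → P (src e) ≡ P (tgt e) → key (e ↑ˡ nV G , not (lo e)) ≡ suc (key (e ↑ˡ nV G , lo e))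
  loop-adjacent e q rewrite key-loop e q | key-O e | sym q = +-suc _ _

  open<close : ∀ e → key (e ↑ˡ nV G , lo e) < key (e ↑ˡ nV G , not (lo e))
  open<close e with P (src e) ℕₚ.≟ P (tgt e)
  ... | yes q = ≤-reflexive (sym (loop-adjacent e q))
  ... | no ne = subst₂ _<_ (sym (key-O e)) (sym (key-arc e ne))
    (lex-< (view-s (vO e)) (lex-< (view-c (vO e)) (≤∧≢⇒< (src≤tgt e) ne)))

  -- Four distinct positions contradict `nc`; at a common end the sorting by `rank` nests the arcs;
  -- a loop leaves no key between its two darts.
  noncross : ∀ e e' → key (e ↑ˡ nV G , lo e) < key (e' ↑ˡ nV G , lo e') → key (e' ↑ˡ nV G , lo e') < key (e ↑ˡ nV G , not (lo e)) →
             key (e ↑ˡ nV G , not (lo e)) < key (e' ↑ˡ nV G , not (lo e')) → ⊥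
  noncross e e' h₁ h₂ h₃ with P (src e) ℕₚ.≟ P (tgt e) | P (src e') ℕₚ.≟ P (tgt e')
  ... | yes q | _ = <⇒≱ h₂ (subst (_≤ key (e' ↑ˡ nV G , lo e')) (sym (loop-adjacent e q)) h₁)
  ... | no _ | yes q = <⇒≱ h₃ (subst (_≤ key (e ↑ˡ nV G , not (lo e))) (sym (loop-adjacent e' q)) h₂)
  ... | no ne | no ne' with subst₂ _<_ (key-O e) (key-O e') h₁ | subst₂ _<_ (key-O e') (key-arc e ne) h₂ | subst₂ _<_ (key-arc e ne) (key-arc e' ne') h₃
  ...   | k₁ | k₂ | k₃ = cases (at-inv (view-c (vO e)) (view-c (vO e')) (view-s (vO e)) (view-s (vO e')) k₁)
                           (at-inv (view-c (vO e')) (view-c (vArc e)) (view-s (vO e')) (view-s (vArc e)) k₂)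
                           (at-inv (view-c (vArc e)) (view-c (vArc e')) (view-s (vArc e)) (view-s (vArc e')) k₃)
    where
    Lex : Fin (nV G) → ℕ → ℕ → Fin (nV G) → ℕ → ℕ → Set
    Lex v c s v' c' s' = P v < P v' ⊎ (P v ≡ P v' × (c < c' ⊎ (c ≡ c' × s < s')))
    at-inv : ∀ {v c s v' c' s'} → c < 4 → c' < 4 → s < B → s' < B → at v c s < at v' c' s' → Lex v c s v' c' s'
    at-inv {v} {c} {s} {v'} {c'} {s'} hc hc' hs hs' l with <-cmp (P v) (P v')
    ... | tri< p _ _ = inj₁ p
    ... | tri> _ _ p = ⊥-elim (<⇒≱ l (<⇒≤ (lex-< hs' (lex-< hc' p))))
    ... | tri≈ _ p _ with <-cmp c c'
    ...   | tri< r _ _ = inj₂ (p , inj₁ r)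
    ...   | tri> _ _ r = ⊥-elim (<⇒≱ l (<⇒≤ (lex-< hs' (subst (λ z → P v' * 4 + c' < z * 4 + c) (sym p) (+-monoʳ-< (P v' * 4) r)))))
    ...   | tri≈ _ refl _ = inj₂ (p , inj₂ (refl , +-cancelˡ-< ((P v * 4 + c) * B) s s' (subst (λ z → at v c s < (z * 4 + c) * B + s') (sym p) l)))
    longer : 2 * (Rm ∸ rank e) < 2 * (Rm ∸ rank e') → rank e' < rank e
    longer l = ≰⇒> λ h → <⇒≱ (*-cancelˡ-< 2 (Rm ∸ rank e) (Rm ∸ rank e') l) (∸-monoʳ-≤ Rm h)
    cases : Lex (src e) 2 (2 * (Rm ∸ rank e)) (src e') 2 (2 * (Rm ∸ rank e')) → Lex (src e') 2 (2 * (Rm ∸ rank e')) (tgt e) 1 (rank e) →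
            Lex (tgt e) 1 (rank e) (tgt e') 1 (rank e') → ⊥
    cases _ (inj₂ (_ , inj₁ (s≤s ()))) _
    cases (inj₂ (_ , inj₁ l)) _ _ = <-irrefl refl l
    cases _ _ (inj₂ (_ , inj₁ l)) = <-irrefl refl l
    cases (inj₁ a) (inj₁ b) (inj₁ c) = nc e e' (lo e) (lo e') a b c
    cases (inj₁ a) (inj₁ b) (inj₂ (q , inj₂ (_ , r))) =
      <⇒≱ (∸-monoʳ-< a (<⇒≤ b)) (subst (λ z → P (tgt e) ∸ P (src e) ≤ z ∸ P (src e')) (sym q) (rank-span (<⇒≤ r)))
    cases (inj₂ (q , inj₂ (_ , r))) (inj₁ b) (inj₁ c) =
      <⇒≱ (∸-monoˡ-< c (src≤tgt e)) (subst (λ z → P (tgt e') ∸ z ≤ P (tgt e) ∸ P (src e)) (sym q) (rank-span (<⇒≤ (longer r))))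
    cases (inj₂ (_ , inj₂ (_ , r))) _ (inj₂ (_ , inj₂ (_ , r'))) = <⇒≱ r' (<⇒≤ (longer r))

  outerplanar : Outerplanar G
  outerplanar = Diagram.outerplanar key key-inj (NP * 4 * B) key<N block-mono L-least R-greatest lo open<close noncross v₀

-- From list positions to sublists, and the theorem

module _ {A : Set} where

  private
    _‼_ : (xs : List A) → Fin (length xs) → A
    _‼_ = lookup

  sublist₁ : ∀ xs i → (xs ‼ i) ∷ [] ⊆ xs
  sublist₁ (x ∷ xs) zero    = refl ∷ minimum xs
  sublist₁ (x ∷ xs) (suc i) = x ∷ʳ sublist₁ xs i

  sublist₂ : ∀ xs {i j} → toℕ i < toℕ j → (xs ‼ i) ∷ (xs ‼ j) ∷ [] ⊆ xs
  sublist₂ (x ∷ xs) {zero}  {suc j} _ = refl ∷ sublist₁ xs j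
  sublist₂ (x ∷ xs) {suc i} {suc j} (s≤s p) = x ∷ʳ sublist₂ xs p

  sublist₃ : ∀ xs {i j k} → toℕ i < toℕ j → toℕ j < toℕ k → (xs ‼ i) ∷ (xs ‼ j) ∷ (xs ‼ k) ∷ [] ⊆ xs
  sublist₃ (x ∷ xs) {zero}  {suc j} {suc k} _ (s≤s q) = refl ∷ sublist₂ xs q
  sublist₃ (x ∷ xs) {suc i} {suc j} {suc k} (s≤s p) (s≤s q) = x ∷ʳ sublist₃ xs p q

  sublist₄ : ∀ xs {i j k l} → toℕ i < toℕ j → toℕ j < toℕ k → toℕ k < toℕ l →
             (xs ‼ i) ∷ (xs ‼ j) ∷ (xs ‼ k) ∷ (xs ‼ l) ∷ [] ⊆ xs
  sublist₄ (x ∷ xs) {zero}  {suc j} {suc k} {suc l} _ (s≤s q) (s≤s r) = refl ∷ sublist₃ xs q r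
  sublist₄ (x ∷ xs) {suc i} {suc j} {suc k} {suc l} (s≤s p) (s≤s q) (s≤s r) = x ∷ʳ sublist₄ xs p q r

noncrossing⇒outerplanar : (G : Graph) (let open Paths G) (v₀ : V) (xs : List V) → (∀ v → v ∈ xs) →
  NonCrossing xs → Outerplanar G
noncrossing⇒outerplanar G v₀ xs all nc = Keys.outerplanar G pos pos-inj (length xs) (λ v → toℕ<n (idx v)) v₀
  λ e e' b b' p q r → nc (sub p q r) (e , b , refl , refl) (e' , b' , refl , refl)
  where
  open Paths G
  idx : V → Fin (length xs)
  idx v = index (all v)
  pos : V → ℕ
  pos v = toℕ (idx v)
  pos-inj : ∀ {v w} → pos v ≡ pos w → v ≡ w
  pos-inj {v} {w} q = trans (lookup-index (all v)) (trans (cong (lookup xs) (toℕ-injective q)) (sym (lookup-index (all w))))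
  sub : ∀ {a b c d} → pos a < pos b → pos b < pos c → pos c < pos d → a ∷ b ∷ c ∷ d ∷ [] ⊆ xs
  sub {a} {b} {c} {d} p q r = subst (_⊆ xs)
    (cong₂ _∷_ (at a) (cong₂ _∷_ (at b) (cong₂ _∷_ (at c) (cong₂ _∷_ (at d) refl)))) (sublist₄ xs p q r)
    where
    at : ∀ v → lookup xs (idx v) ≡ v
    at v = sym (lookup-index (all v))

no-star⇒outerplanar : (G : Graph) → Fin (nV G) → Paths.NoStar G → Outerplanar G
no-star⇒outerplanar G v₀ star with Order.outer-order G star v₀
... | xs , all , nc = noncrossing⇒outerplanar G v₀ xs all nc

theorem2p4 : (M : PlanarMap) → DimVEF≤ M 3 →
    WeaklyOuterplanar M × Outerplanar (dualGraph M)
theorem2p4 M (t , t≤3 , R) =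
    no-star⇒outerplanar (graph M) (some-vertex (drawing M)) primal-star
  , no-star⇒outerplanar (dualGraph M) (some-face (drawing M)) dual-star
  where open Realized (three-realizer t≤3 R)
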